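{- Let $p$ be a prime and let $a,b\in\mathbb{F}_p^\ast$. Let $n\ge 4$ be a divisor of $p-1$ such that $n^4-2n^3-3n^2-8n\ge 4(p-1)$, and put $k=(p-1)/n$. Then \[ N_n(a,b,p)<n^2\left(3(k/2)^{2/3}-\frac{7}{2}(k/2)^{1/3}+\frac{25}{12}\right). \]
   Context: For a prime $p$, an integer $n>1$ prime to $p$, and $a,b\in\mathbb{F}_p^\ast$, $N_n(a,b,p)$ denotes the number of projective $\mathbb{F}_p$-rational points of the Fermat curve $ax^n+by^n=z^n$ (in homogeneous coordinates $(x:y:z)$) in the projective plane over $\mathbb{F}_p$. -}

module Defs where

open import Data.Nat using (ℕ; _+_; _*_; _^_; NonZero)
open import Data.Nat.DivMod using (_%_)
open import Data.Nat.Properties using (_≟_)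
open import Data.List using (List; []; _∷_; _++_; map; concatMap; upTo; filter; length)
open import Data.Product using (_×_; _,_)
open import Relation.Binary.PropositionalEquality using (_≡_)
open import Relation.Nullary using (Dec)

-- Elements of F_p are represented by 0,1,...,p-1.
-- Normalized representatives of the projective plane P²(F_p):
--   (x : y : 1) for x,y ∈ F_p,  (x : 1 : 0) for x ∈ F_p,  (1 : 0 : 0).
projPlane : ℕ → List (ℕ × ℕ × ℕ)
projPlane p =
  concatMap (λ x → map (λ y → (x , y , 1)) (upTo p)) (upTo p)
  ++ map (λ x → (x , 1 , 0)) (upTo p)
  ++ ((1 , 0 , 0) ∷ [])

OnFermat : (n a b p : ℕ) → .{{NonZero p}} → ℕ × ℕ × ℕ → Set
OnFermat n a b p (x , y , z) = (a * x ^ n + b * y ^ n) % p ≡ (z ^ n) % p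

onFermat? : (n a b p : ℕ) → .{{_ : NonZero p}} → (t : ℕ × ℕ × ℕ) → Dec (OnFermat n a b p t)
onFermat? n a b p (x , y , z) = ((a * x ^ n + b * y ^ n) % p) ≟ ((z ^ n) % p)

Npts : (n a b p : ℕ) → .{{NonZero p}} → ℕ
Npts n a b p = length (filter (onFermat? n a b p) (projPlane p))

{-# OPTIONS --safe #-}
module Submission where

-- Put u = a xⁿ / zⁿ, so that 1 - u = b yⁿ / zⁿ.  A point with xyz ≠ 0 gives w = u ≠ 0, 1 with α wᵏ = β (1-w)ᵏ = 1,
-- where α = a⁻ᵏ and β = b⁻ᵏ, and each such w comes from at most n² points; each of the τ coordinate lines that
-- meet the curve contributes at most n more.  The w are counted by the method of Stepanov, in the form that
-- corresponds to the bound of Stöhr and Voloch for the system of plane curves of degree m.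
-- Linear algebra provides polynomials A i j, i + j ≤ m, of degree ≤ d such that
--   Φ = Σ αⁱ βʲ u^(ik) (1-u)^(jk) A i j
-- vanishes to order M = m(m+3)/2 at every w: if T is the operator with θ (u^(ik) (1-u)^(jk) f) = u^(ik) (1-u)^(jk) T f,
-- θ = u(1-u) d/du, this follows from Σ Tʳ A i j = 0 for r < M.  Prescribing in addition the order of certain
-- combinations of the A i j at 0, 1 and ∞ makes Σ Tʳ A i j vanish to order m there, which lowers d, and
-- makes Φ vanish to order m at those of the three places that belong to points of the curve.
-- That Φ is not zero is seen from its expansion at u = 0, where the leading coefficients of the A i j solve a
-- Vandermonde system.  Hence M #{w} + m τ ≤ d + k m, and m + 3 is chosen as the integer part of 2s + 5/3, with s a
-- rational number slightly below the cube root of k/2 (for small k the choice is found by computation).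
-- Polynomials have integer coefficients, and Z x says that x vanishes modulo p.

open import Data.Empty using (⊥-elim; ⊥)
open import Data.Integer as ℤ using (ℤ; 0ℤ; 1ℤ; -1ℤ)
open import Data.Integer.Divisibility.Signed using (_∣_; divides; _∣?_; ∣ᵤ⇒∣; ∣⇒∣ᵤ; ∣m∣n⇒∣m+n; ∣m∣n⇒∣m-n; ∣n⇒∣m*n; ∣m⇒∣m*n)
import Data.Integer.Properties as ℤ
open import Data.List using (List; []; _∷_; length; _++_; map; filter; concatMap; upTo)
open import Data.List.Membership.Propositional using (_∈_)
open import Data.List.Membership.Propositional.Properties using (∈-++⁺ˡ; ∈-++⁺ʳ; ∈-filter⁺; ∈-upTo⁺)
import Data.List.Properties as List
open import Data.List.Relation.Unary.All as All using (All; []; _∷_; all?)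
import Data.List.Relation.Unary.All.Properties as All
open import Data.List.Relation.Unary.AllPairs as AllPairs using (AllPairs; []; _∷_)
import Data.List.Relation.Unary.AllPairs.Properties as AllPairs
open import Data.List.Relation.Unary.Any using (here; there; Any; any?; satisfied)
open import Data.List.Relation.Unary.Unique.Propositional using (Unique)
import Data.List.Relation.Unary.Unique.Propositional.Properties as Unique
open import Data.Nat as ℕ using (ℕ; zero; suc; z≤n; s≤s; NonZero; >-nonZero⁻¹)
open import Data.Nat.Combinatorics using (_C_; nCk+nC[k+1]≡[n+1]C[k+1]; k>n⇒nCk≡0; nCn≡1)
import Data.Nat.DivMod as ℕ
import Data.Nat.Divisibility as ℕ∣
open import Data.Nat.ListAction using (sum)
open import Data.Nat.Primality using (Prime; euclidsLemma; prime⇒nonTrivial)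
import Data.Nat.Properties as ℕ
import Data.Nat.Tactic.RingSolver as ℕSolver
open import Data.Product using (_×_; _,_; proj₁; proj₂; Σ-syntax; ∃)
open import Data.Sum using (_⊎_; inj₁; inj₂)
open import Defs
open import Relation.Binary using (tri<; tri≈; tri>)
open import Relation.Binary.PropositionalEquality using (_≡_; refl; sym; trans; cong; cong₂; subst; module ≡-Reasoning; _≢_; subst₂)
open import Relation.Nullary using (¬_; Dec; yes; no)
open import Relation.Nullary.Decidable using (_×-dec_; ¬?; map′; toWitness)
open import Relation.Unary using (Decidable)

-- The A i j provide M + 1 blocks of d + 1 unknowns, while the vanishing of the M sums Σ Tʳ A i j,
-- of degree at most d + r, consumes M such blocks and M(M-1)/2 further conditions. One block is
-- left over, so every condition saved lowers d by one. The orders prescribed at 0, 1 and ∞ cost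
-- about m³ conditions once. As T preserves them, they save 3m conditions in each of the M - 1 sums
-- with r ≥ 1, about 3m³/2 in all. So d falls by about m³/2, on which the coefficient of s in the
-- bound depends. A coordinate line that meets the curve adds up to n points, but the zero of order
-- m that it gives Φ lowers the bound for #{w} by m/M = 2/(m+3), hence the main term by 2n²/(m+3).
-- This covers the n points as soon as m + 3 ≤ 2n; the condition on n enters through m < n, which
-- gives it. The bound is stated at a rational s ≥ 7/12 with s³ ≤ k/2. The quadratic 3s² - (7/2)s +
-- 25/12 increases from its vertex 7/12 on, so the bound at the real cube root of k/2 follows.

-- Polynomials through their Taylor coefficients, and the count of zeros modulo p

module Expressions where
  open import Data.Integer using (+_; _+_; _*_; -_; _-_; ∣_∣)
  open import Data.Integer.Tactic.RingSolver using (solve-∀)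

  infixl 6 _⊕_
  infixr 7 _·_
  infix 4 _≈_

  -- Expressions rather than coefficient lists: the effect of `U` and `D` on Taylor coefficients
  -- then holds by definition, and an identity between operators becomes, for fixed `w` and `s`, an
  -- identity between integers for the ring solver.
  data Poly : Set where
    𝟘 𝟙 : Poly
    _⊕_ : Poly → Poly → Poly
    _·_ : ℤ → Poly → Poly
    U D : Poly → Poly

  -- The s-th Taylor coefficient at w of a polynomial expression, where U is
  -- multiplication by the variable and D is the derivative.
  tc : ℤ → ℕ → Poly → ℤ
  tc w s 𝟘 = 0ℤ
  tc w zero 𝟙 = 1ℤ
  tc w (suc s) 𝟙 = 0ℤ
  tc w s (f ⊕ g) = tc w s f + tc w s g
  tc w s (c · f) = c * tc w s f
  tc w zero (U f) = w * tc w zero f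
  tc w (suc s) (U f) = w * tc w (suc s) f + tc w s f
  tc w s (D f) = + suc s * tc w (suc s) f

  record _≈_ (f g : Poly) : Set where
    constructor mk
    field at : ∀ w s → tc w s f ≡ tc w s g
  open _≈_ public

  V θ : Poly → Poly
  V f = f ⊕ (-1ℤ · U f)
  θ f = U (V (D f))

  -- The same coefficients for lists. Lists have what expressions lack, a length to induct on and a
  -- division by X - w, and so they carry the count of zeros.
  lc : ℤ → ℕ → List ℤ → ℤ
  lc w s [] = 0ℤ
  lc w zero (a ∷ f) = a + w * lc w zero f
  lc w (suc s) (a ∷ f) = w * lc w (suc s) f + lc w s f

  private
    addL : List ℤ → List ℤ → List ℤ
    addL [] g = g
    addL (a ∷ f) [] = a ∷ f
    addL (a ∷ f) (b ∷ g) = (a + b) ∷ addL f g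

    mulL : ℤ → List ℤ → List ℤ
    mulL c [] = []
    mulL c (a ∷ f) = (c * a) ∷ mulL c f

    derL : List ℤ → List ℤ
    derL [] = []
    derL (a ∷ f) = addL f (0ℤ ∷ derL f)

    lc-add : ∀ w s f g → lc w s (addL f g) ≡ lc w s f + lc w s g
    lc-add w s [] g = sym (ℤ.+-identityˡ _)
    lc-add w s (a ∷ f) [] = sym (ℤ.+-identityʳ _)
    lc-add w zero (a ∷ f) (b ∷ g) rewrite lc-add w zero f g = lem a b w (lc w 0 f) (lc w 0 g)
      where lem : ∀ a b w x y → a + b + w * (x + y) ≡ a + w * x + (b + w * y)
            lem = solve-∀
    lc-add w (suc s) (a ∷ f) (b ∷ g) rewrite lc-add w s f g | lc-add w (suc s) f g =
      lem w (lc w (suc s) f) (lc w (suc s) g) (lc w s f) (lc w s g)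
      where lem : ∀ w x y z t → w * (x + y) + (z + t) ≡ w * x + z + (w * y + t)
            lem = solve-∀

    lc-mul : ∀ w s c f → lc w s (mulL c f) ≡ c * lc w s f
    lc-mul w s c [] = sym (ℤ.*-zeroʳ c)
    lc-mul w zero c (a ∷ f) rewrite lc-mul w 0 c f = lem c a w (lc w 0 f)
      where lem : ∀ c a w x → c * a + w * (c * x) ≡ c * (a + w * x)
            lem = solve-∀
    lc-mul w (suc s) c (a ∷ f) rewrite lc-mul w (suc s) c f | lc-mul w s c f = lem c w (lc w (suc s) f) (lc w s f)
      where lem : ∀ c w x y → w * (c * x) + c * y ≡ c * (w * x + y)
            lem = solve-∀

    lc-der : ∀ w s f → lc w s (derL f) ≡ + suc s * lc w (suc s) f
    lc-der w s [] = sym (ℤ.*-zeroʳ (+ suc s))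
    lc-der w zero (a ∷ f) rewrite lc-add w 0 f (0ℤ ∷ derL f) | lc-der w 0 f = lem w (lc w 0 f) (lc w 1 f)
      where lem : ∀ w x y → x + (+ 0 + w * (+ 1 * y)) ≡ + 1 * (w * y + x)
            lem = solve-∀
    lc-der w (suc s) (a ∷ f)
      rewrite lc-add w (suc s) f (0ℤ ∷ derL f) | lc-der w (suc s) f | lc-der w s f =
      lem (+ suc s) w (lc w (suc s) f) (lc w (suc (suc s)) f)
      where lem : ∀ s w x y → x + (w * ((+ 1 + s) * y) + s * x) ≡ (+ 1 + s) * (w * y + x)
            lem = solve-∀

    toL : Poly → List ℤ
    toL 𝟘 = []
    toL 𝟙 = 1ℤ ∷ []
    toL (f ⊕ g) = addL (toL f) (toL g)
    toL (c · f) = mulL c (toL f)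
    toL (U f) = 0ℤ ∷ toL f
    toL (D f) = derL (toL f)

    lc-toL : ∀ w s f → lc w s (toL f) ≡ tc w s f
    lc-toL w s 𝟘 = refl
    lc-toL w zero 𝟙 = cong (λ x → 1ℤ + x) (ℤ.*-zeroʳ w)
    lc-toL w (suc s) 𝟙 = cong (λ x → x + 0ℤ) (ℤ.*-zeroʳ w)
    lc-toL w s (f ⊕ g) = trans (lc-add w s (toL f) (toL g)) (cong₂ _+_ (lc-toL w s f) (lc-toL w s g))
    lc-toL w s (c · f) = trans (lc-mul w s c (toL f)) (cong (c *_) (lc-toL w s f))
    lc-toL w zero (U f) = trans (ℤ.+-identityˡ _) (cong (w *_) (lc-toL w 0 f))
    lc-toL w (suc s) (U f) = cong₂ (λ x y → w * x + y) (lc-toL w (suc s) f) (lc-toL w s f)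
    lc-toL w s (D f) = trans (lc-der w s (toL f)) (cong (+ suc s *_) (lc-toL w (suc s) f))

  -- Synthetic division by X - w. A nonempty list keeps its length, with 0 as last entry, so the
  -- drop in degree has to be read from the coefficients.
  quo : ℤ → List ℤ → List ℤ
  quo w [] = []
  quo w (a ∷ f) = lc w 0 f ∷ quo w f

  lc-quo₀ : ∀ w v f → lc v 0 f ≡ lc w 0 f + (v - w) * lc v 0 (quo w f)
  lc-quo₀ w v [] = sym (trans (ℤ.+-identityˡ _) (ℤ.*-zeroʳ (v - w)))
  lc-quo₀ w v (a ∷ f) = trans (cong (λ x → a + v * x) (lc-quo₀ w v f)) (lem a v w (lc w 0 f) (lc v 0 (quo w f)))
    where lem : ∀ a v w x y → a + v * (x + (v - w) * y) ≡ a + w * x + (v - w) * (x + v * y)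
          lem = solve-∀

  lc-quo : ∀ w v s f → lc v (suc s) f ≡ (v - w) * lc v (suc s) (quo w f) + lc v s (quo w f)
  lc-quo w v s [] = sym (trans (ℤ.+-identityʳ _) (ℤ.*-zeroʳ (v - w)))
  lc-quo w v zero (a ∷ f) = trans (cong₂ (λ x y → v * x + y) (lc-quo w v 0 f) (lc-quo₀ w v f))
      (lem v w (lc w 0 f) (lc v 1 (quo w f)) (lc v 0 (quo w f)))
    where lem : ∀ v w x y z → v * ((v - w) * y + z) + (x + (v - w) * z) ≡ (v - w) * (v * y + z) + (x + v * z)
          lem = solve-∀
  lc-quo w v (suc s) (a ∷ f) = trans (cong₂ (λ x y → v * x + y) (lc-quo w v (suc s) f) (lc-quo w v s f))
      (lem v w (lc v (suc (suc s)) (quo w f)) (lc v (suc s) (quo w f)) (lc v s (quo w f)))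
    where lem : ∀ v w x y z → v * ((v - w) * x + y) + ((v - w) * y + z) ≡ (v - w) * (v * x + y) + (v * y + z)
          lem = solve-∀

  total : List (ℤ × ℕ) → ℕ
  total [] = 0
  total ((w , e) ∷ zs) = e ℕ.+ total zs

  module ModP (p : ℕ) (pp : Prime p) where

    Z : ℤ → Set
    Z x = + p ∣ x

    Z-resp : ∀ {x y} → x ≡ y → Z y → Z x
    Z-resp refl z = z

    Z-0 : Z 0ℤ
    Z-0 = divides 0ℤ refl

    Z-+ : ∀ {x y} → Z x → Z y → Z (x + y)
    Z-+ = ∣m∣n⇒∣m+n

    Z-- : ∀ {x y} → Z x → Z y → Z (x - y)
    Z-- = ∣m∣n⇒∣m-n

    Z-* : ∀ c {x} → Z x → Z (c * x)
    Z-* c = ∣n⇒∣m*n c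

    Z-*ʳ : ∀ c {x} → Z x → Z (x * c)
    Z-*ʳ c = ∣m⇒∣m*n c

    Z? : ∀ x → Dec (Z x)
    Z? x = + p ∣? x

    Z-prime : ∀ x {y} → Z (x * y) → Z x ⊎ Z y
    Z-prime x {y} z with euclidsLemma ∣ x ∣ ∣ y ∣ pp (subst (p ℕ∣.∣_) (ℤ.abs-* x y) (∣⇒∣ᵤ z))
    ... | inj₁ h = inj₁ (∣ᵤ⇒∣ h)
    ... | inj₂ h = inj₂ (∣ᵤ⇒∣ h)

    Z-cancel : ∀ x {y} → ¬ Z x → Z (x * y) → Z y
    Z-cancel x nz z with Z-prime x z
    ... | inj₁ h = ⊥-elim (nz h)
    ... | inj₂ h = h

    ¬Z-pos : ∀ s → 0 ℕ.< s → s ℕ.< p → ¬ Z (+ s)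
    ¬Z-pos (suc s) _ s<p z = ℕ.<⇒≱ s<p (ℕ∣.∣⇒≤ (∣⇒∣ᵤ z))

    1<p : 1 ℕ.< p
    1<p = ℕ.nonTrivial⇒n>1 p ⦃ prime⇒nonTrivial pp ⦄

    ¬Z-1 : ¬ Z 1ℤ
    ¬Z-1 = ¬Z-pos 1 (s≤s z≤n) 1<p

    record Ord (w : ℤ) (e : ℕ) (f : Poly) : Set where
      constructor ord
      field taylor : ∀ s → s ℕ.< e → Z (tc w s f)
    open Ord public

    -- The degree of f is smaller than d - e; the bound is written with e on the right to avoid truncated subtraction.
    record Deg (d e : ℕ) (f : Poly) : Set where
      constructor deg
      field coeff : ∀ s → d ℕ.≤ s ℕ.+ e → Z (tc 0ℤ s f)
    open Deg public

    Null : Poly → Set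
    Null f = ∀ w s → Z (tc w s f)

    Apart : ℤ × ℕ → ℤ × ℕ → Set
    Apart x y = ¬ Z (proj₁ x - proj₁ y)

    private
      null-list : ∀ f → (∀ s → Z (lc 0ℤ s f)) → ∀ w s → Z (lc w s f)
      null-list [] h w s = Z-0
      null-list (a ∷ f) h = go
        where
        tl : ∀ w s → Z (lc w s f)
        tl = null-list f (λ s → Z-resp (sym (ℤ.+-identityˡ _)) (h (suc s)))
        hd : Z a
        hd = Z-resp (sym (ℤ.+-identityʳ a)) (h 0)
        go : ∀ w s → Z (lc w s (a ∷ f))
        go w zero = Z-+ hd (Z-* w (tl w 0))
        go w (suc s) = Z-+ (Z-* w (tl w (suc s))) (tl w s)

      lc-long : ∀ w s f → length f ℕ.≤ s → lc w s f ≡ 0ℤ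
      lc-long w s [] _ = refl
      lc-long w (suc s) (a ∷ f) (s≤s h)
        rewrite lc-long w (suc s) f (ℕ.m≤n⇒m≤1+n h) | lc-long w s f h = cong (λ x → x + 0ℤ) (ℤ.*-zeroʳ w)

      quo-deg : ∀ w d f → (∀ s → suc d ℕ.≤ s → Z (lc 0ℤ s f)) → ∀ s → d ℕ.≤ s → Z (lc 0ℤ s (quo w f))
      quo-deg w d f h s d≤s = go (length (quo w f)) s d≤s (ℕ.m≤n+m _ s)
        where
        -- Downward from the end of the list: coefficient `s` of the quotient is coefficient `s + 1`
        -- of `f` plus `w` times coefficient `s + 1` of the quotient.
        go : ∀ r s → d ℕ.≤ s → length (quo w f) ℕ.≤ s ℕ.+ r → Z (lc 0ℤ s (quo w f))
        go zero s d≤s l = Z-resp (lc-long 0ℤ s (quo w f) (subst (_ ℕ.≤_) (ℕ.+-identityʳ s) l)) Z-0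
        go (suc r) s d≤s l = Z-resp (trans (lem w (lc 0ℤ (suc s) (quo w f)) (lc 0ℤ s (quo w f)))
                                 (cong (_+ w * lc 0ℤ (suc s) (quo w f)) (sym (lc-quo w 0ℤ s f))))
            (Z-+ (h (suc s) (s≤s d≤s))
                 (Z-* w (go r (suc s) (ℕ.m≤n⇒m≤1+n d≤s) (subst (length (quo w f) ℕ.≤_) (ℕ.+-suc s r) l))))
          where lem : ∀ w x y → y ≡ ((+ 0 - w) * x + y) + w * x
                lem = solve-∀

      OrdL : List ℤ → ℤ × ℕ → Set
      OrdL f (w , e) = ∀ s → s ℕ.< e → Z (lc w s f)

      -- In f = f(w) + (X - w) q the value f(w) vanishes and v - w is invertible modulo p, so the
      -- coefficients of q at `v` vanish one after another.
      quo-ord-other : ∀ w f v e → Z (lc w 0 f) → ¬ Z (w - v) → OrdL f (v , e) → OrdL (quo w f) (v , e)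
      quo-ord-other w f v e fw ap h = go
        where
        ap' : ¬ Z (v - w)
        ap' z = ap (Z-resp (lem w v) (Z-* -1ℤ z))
          where lem : ∀ w v → w - v ≡ -1ℤ * (v - w)
                lem = solve-∀
        l1 : ∀ x y z → z ≡ (x + z) - x
        l1 x y z = lem x z
          where lem : ∀ x z → z ≡ (x + z) - x
                lem = solve-∀
        l2 : ∀ x y → x ≡ (x + y) - y
        l2 = solve-∀
        go : OrdL (quo w f) (v , e)
        go zero s<e = Z-cancel (v - w) ap'
          (Z-resp (trans (l1 (lc w 0 f) 0ℤ _) (cong (_- lc w 0 f) (sym (lc-quo₀ w v f)))) (Z-- (h 0 s<e) fw))
        go (suc s) s<e = Z-cancel (v - w) ap'
          (Z-resp (trans (l2 _ (lc v s (quo w f))) (cong (_- lc v s (quo w f)) (sym (lc-quo w v s f))))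
            (Z-- (h (suc s) s<e) (go s (ℕ.<-trans (ℕ.n<1+n s) s<e))))

      quo-ord-self : ∀ w f e → OrdL f (w , suc e) → OrdL (quo w f) (w , e)
      quo-ord-self w f e h s s<e = Z-resp (trans (lem w (lc w (suc s) (quo w f)) _) (sym (lc-quo w w s f))) (h (suc s) (s≤s s<e))
        where lem : ∀ w x y → y ≡ (w - w) * x + y
              lem = solve-∀

      -- Each division by X - w removes one zero and lowers the degree bound `d`, on which the
      -- induction runs; an entry whose multiplicity has come down to 0 is dropped.
      roots-list : ∀ d zs f → AllPairs Apart zs → (∀ s → d ℕ.≤ s → Z (lc 0ℤ s f)) → All (OrdL f) zs
                 → d ℕ.≤ total zs → ∀ w s → Z (lc w s f)
      roots-list zero zs f ap dg os le = null-list f (λ s → dg s z≤n)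
      roots-list (suc d) ((w , zero) ∷ zs) f (_ ∷ ap) dg (_ ∷ os) le = roots-list (suc d) zs f ap dg os le
      roots-list (suc d) ((w , suc e) ∷ zs) f (a ∷ ap) dg (o ∷ os) (s≤s le) = go
        where
        fw : Z (lc w 0 f)
        fw = o 0 (s≤s z≤n)
        qnull : ∀ v s → Z (lc v s (quo w f))
        qnull = roots-list d ((w , e) ∷ zs) (quo w f) (a ∷ ap) (quo-deg w d f dg)
          (quo-ord-self w f e o ∷ All.map (λ {z} (a , o) → quo-ord-other w f (proj₁ z) (proj₂ z) fw a o) (All.zip (a , os))) le
        go : ∀ v s → Z (lc v s f)
        go v zero = Z-resp (lc-quo₀ w v f) (Z-+ fw (Z-* (v - w) (qnull v 0)))
        go v (suc s) = Z-resp (lc-quo w v s f) (Z-+ (Z-* (v - w) (qnull v (suc s))) (qnull v s))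

    null-coeffs : ∀ f → (∀ s → Z (tc 0ℤ s f)) → Null f
    null-coeffs f h w s = Z-resp (sym (lc-toL w s f))
      (null-list (toL f) (λ s → Z-resp (lc-toL 0ℤ s f) (h s)) w s)

    -- Order `e` at infinity counts as `e` further zeros. The truncated subtraction `d ∸ e` in the
    -- proof is harmless, since `d ≤ e` already makes every coefficient vanish.
    too-many-roots : ∀ d e zs f → AllPairs Apart zs → Deg d e f → All (λ z → Ord (proj₁ z) (proj₂ z) f) zs
                   → d ℕ.≤ total zs ℕ.+ e → Null f
    too-many-roots d e zs f ap dg os le w s = Z-resp (sym (lc-toL w s f))
      (roots-list (d ℕ.∸ e) zs (toL f) ap
        (λ s h → Z-resp (lc-toL 0ℤ s f) (coeff dg s (subst (d ℕ.≤_) (ℕ.+-comm e s)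
            (ℕ.≤-trans (ℕ.m≤n+m∸n d e) (ℕ.+-monoʳ-≤ e h)))))
        (All.map (λ {z} o s h → Z-resp (lc-toL (proj₁ z) s f) (taylor o s h)) os)
        (ℕ.m≤n+o⇒m∸n≤o d e (subst (d ℕ.≤_) (ℕ.+-comm (total zs) e) le)) w s)

-- Linear operators on polynomials and expansions in powers of y - 1

module Operators where
  open Expressions
  open import Data.Integer using (+_; _+_; _*_; -_; _-_)
  open import Data.Integer.Tactic.RingSolver using (solve-∀)

  ≈-refl : ∀ {f} → f ≈ f
  ≈-refl = mk λ _ _ → refl

  ≡⇒≈ : ∀ {f g} → f ≡ g → f ≈ g
  ≡⇒≈ refl = ≈-refl

  ≈-sym : ∀ {f g} → f ≈ g → g ≈ f
  ≈-sym h = mk λ w s → sym (at h w s)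

  ≈-trans : ∀ {f g h} → f ≈ g → g ≈ h → f ≈ h
  ≈-trans h k = mk λ w s → trans (at h w s) (at k w s)

  infixr 2 _⟫_
  _⟫_ : ∀ {f g h} → f ≈ g → g ≈ h → f ≈ h
  _⟫_ = ≈-trans

  ⊕-cong : ∀ {f f′ g g′} → f ≈ f′ → g ≈ g′ → f ⊕ g ≈ f′ ⊕ g′
  ⊕-cong h k = mk λ w s → cong₂ _+_ (at h w s) (at k w s)

  ·-cong : ∀ c {f f′} → f ≈ f′ → c · f ≈ c · f′
  ·-cong c h = mk λ w s → cong (c *_) (at h w s)

  ⊕-interchange : ∀ a b c d → (a ⊕ b) ⊕ (c ⊕ d) ≈ (a ⊕ c) ⊕ (b ⊕ d)
  ⊕-interchange a b c d = mk λ w s → lem (tc w s a) (tc w s b) (tc w s c) (tc w s d)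
    where lem : ∀ a b c d → (a + b) + (c + d) ≡ (a + c) + (b + d)
          lem = solve-∀

  ·-⊕ : ∀ c f g → c · (f ⊕ g) ≈ c · f ⊕ c · g
  ·-⊕ c f g = mk λ w s → ℤ.*-distribˡ-+ c (tc w s f) (tc w s g)

  ·-· : ∀ c d f → c · (d · f) ≈ (c * d) · f
  ·-· c d f = mk λ w s → sym (ℤ.*-assoc c d (tc w s f))

  ·-comm : ∀ c d f → c · (d · f) ≈ d · (c · f)
  ·-comm c d f = mk λ w s → lem c d (tc w s f)
    where lem : ∀ c d f → c * (d * f) ≡ d * (c * f)
          lem = solve-∀

  record Linear (O : Poly → Poly) : Set where
    field
      lcong : ∀ {f g} → f ≈ g → O f ≈ O g
      ladd  : ∀ f g → O (f ⊕ g) ≈ O f ⊕ O g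
      lscal : ∀ c f → O (c · f) ≈ c · O f
  open Linear public

  lid : Linear (λ f → f)
  lid = record { lcong = λ h → h ; ladd = λ _ _ → ≈-refl ; lscal = λ _ _ → ≈-refl }

  l∘ : ∀ {O P} → Linear O → Linear P → Linear (λ f → O (P f))
  l∘ o p = record
    { lcong = λ h → lcong o (lcong p h)
    ; ladd = λ f g → lcong o (ladd p f g) ⟫ ladd o _ _
    ; lscal = λ c f → lcong o (lscal p c f) ⟫ lscal o c _ }

  l⊕ : ∀ {O P} → Linear O → Linear P → Linear (λ f → O f ⊕ P f)
  l⊕ o p = record
    { lcong = λ h → ⊕-cong (lcong o h) (lcong p h)
    ; ladd = λ f g → ⊕-cong (ladd o f g) (ladd p f g) ⟫ ⊕-interchange _ _ _ _
    ; lscal = λ c f → ⊕-cong (lscal o c f) (lscal p c f) ⟫ ≈-sym (·-⊕ c _ _) }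

  l· : ∀ {O} c → Linear O → Linear (λ f → c · O f)
  l· c o = record
    { lcong = λ h → ·-cong c (lcong o h)
    ; ladd = λ f g → ·-cong c (ladd o f g) ⟫ ·-⊕ c _ _
    ; lscal = λ d f → ·-cong c (lscal o d f) ⟫ ·-comm c d _ }

  lU : Linear U
  lU = record { lcong = λ h → mk (c h) ; ladd = λ f g → mk (a f g) ; lscal = λ x f → mk (s x f) }
    where
    c : ∀ {f g} → f ≈ g → ∀ w s → tc w s (U f) ≡ tc w s (U g)
    c h w zero = cong (w *_) (at h w 0)
    c h w (suc s) = cong₂ (λ x y → w * x + y) (at h w (suc s)) (at h w s)
    a : ∀ f g w s → tc w s (U (f ⊕ g)) ≡ tc w s (U f) + tc w s (U g)
    a f g w zero = ℤ.*-distribˡ-+ w _ _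
    a f g w (suc s) = lem w (tc w (suc s) f) (tc w (suc s) g) (tc w s f) (tc w s g)
      where lem : ∀ w a b c d → w * (a + b) + (c + d) ≡ w * a + c + (w * b + d)
            lem = solve-∀
    s : ∀ x f w s → tc w s (U (x · f)) ≡ x * tc w s (U f)
    s x f w zero = lem w x (tc w 0 f)
      where lem : ∀ w x a → w * (x * a) ≡ x * (w * a)
            lem = solve-∀
    s x f w (suc s) = lem w x (tc w (suc s) f) (tc w s f)
      where lem : ∀ w x a b → w * (x * a) + x * b ≡ x * (w * a + b)
            lem = solve-∀

  lD : Linear D
  lD = record
    { lcong = λ h → mk λ w s → cong (+ suc s *_) (at h w (suc s))
    ; ladd = λ f g → mk λ w s → ℤ.*-distribˡ-+ (+ suc s) (tc w (suc s) f) (tc w (suc s) g)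
    ; lscal = λ c f → mk λ w s → lem (+ suc s) c (tc w (suc s) f) }
    where lem : ∀ w x a → w * (x * a) ≡ x * (w * a)
          lem = solve-∀

  lV : Linear V
  lV = l⊕ lid (l· -1ℤ lU)

  lθ : Linear θ
  lθ = l∘ lU (l∘ lV lD)

  iter : (Poly → Poly) → ℕ → Poly → Poly
  iter O zero f = f
  iter O (suc n) f = O (iter O n f)

  liter : ∀ {O} n → Linear O → Linear (iter O n)
  liter zero o = lid
  liter (suc n) o = l∘ o (liter n o)

  iter-comm : ∀ {O P : Poly → Poly} → Linear O → (∀ f → O (P f) ≈ P (O f)) → ∀ n f → iter O n (P f) ≈ P (iter O n f)
  iter-comm o h zero f = ≈-refl
  iter-comm o h (suc n) f = lcong o (iter-comm o h n f) ⟫ h _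

  iter-iter-comm : ∀ {O P : Poly → Poly} → Linear O → Linear P → (∀ f → O (P f) ≈ P (O f)) → ∀ n m f
                 → iter O n (iter P m f) ≈ iter P m (iter O n f)
  iter-iter-comm {O} {P} o p h n m = iter-comm {O} {iter P m} o
    (λ f → ≈-sym (iter-comm {P} {O} p (λ f → ≈-sym (h f)) m f)) n

  iter-suc : ∀ {O : Poly → Poly} n f → iter O (suc n) f ≡ iter O n (O f)
  iter-suc zero f = refl
  iter-suc {O} (suc n) f = cong O (iter-suc n f)

  iter-+ : ∀ O a b f → iter O (a ℕ.+ b) f ≡ iter O a (iter O b f)
  iter-+ O zero b f = refl
  iter-+ O (suc a) b f = cong O (iter-+ O a b f)

  UV-comm : ∀ f → U (V f) ≈ V (U f)
  UV-comm f = ladd lU _ _ ⟫ ⊕-cong ≈-refl (lscal lU -1ℤ (U f))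

  DU : ∀ f → D (U f) ≈ f ⊕ U (D f)
  DU f = mk λ
    { w zero → lem₀ (tc w 0 f) (tc w 1 f) w
    ; w (suc s) → lem (+ suc s) (tc w (suc s) f) (tc w (suc (suc s)) f) w }
    where
    lem₀ : ∀ a b w → + 1 * (w * b + a) ≡ a + w * (+ 1 * b)
    lem₀ = solve-∀
    lem : ∀ s a b w → (+ 1 + s) * (w * b + a) ≡ a + (w * ((+ 1 + s) * b) + s * a)
    lem = solve-∀

  θU : ∀ f → θ (U f) ≈ U (θ f ⊕ V f)
  θU f = lcong lU (lcong lV (DU f) ⟫ ladd lV f (U (D f)) ⟫ ⊕-cong ≈-refl (≈-sym (UV-comm (D f)))
     ⟫ mk λ w s → ℤ.+-comm (tc w s (V f)) (tc w s (U (V (D f)))))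

  θV : ∀ f → θ (V f) ≈ V (θ f ⊕ -1ℤ · U f)
  θV f = lcong lU (lcong lV DV) ⟫ lcong lU (ladd lV (V (D f)) (-1ℤ · f)) ⟫ ladd lU (V (V (D f))) (V (-1ℤ · f))
      ⟫ ⊕-cong (UV-comm (V (D f))) (UV-comm (-1ℤ · f) ⟫ lcong lV (lscal lU -1ℤ f))
      ⟫ ≈-sym (ladd lV _ _)
    where
    DV : D (V f) ≈ V (D f) ⊕ -1ℤ · f
    DV = ladd lD f _ ⟫ ⊕-cong ≈-refl (lscal lD -1ℤ (U f) ⟫ ·-cong -1ℤ (DU f))
       ⟫ mk λ w s → lem (tc w s (D f)) (tc w s f) (tc w s (U (D f)))
      where lem : ∀ a b c → a + -1ℤ * (b + c) ≡ (a + -1ℤ * c) + -1ℤ * b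
            lem = solve-∀

  ΣZ : ℕ → (ℕ → ℤ) → ℤ
  ΣZ zero f = 0ℤ
  ΣZ (suc n) f = ΣZ n f + f n

  Σₚ : ℕ → (ℕ → Poly) → Poly
  Σₚ zero f = 𝟘
  Σₚ (suc n) f = Σₚ n f ⊕ f n

  tc-Σ : ∀ w s n f → tc w s (Σₚ n f) ≡ ΣZ n (λ i → tc w s (f i))
  tc-Σ w s zero f = refl
  tc-Σ w s (suc n) f = cong (_+ tc w s (f n)) (tc-Σ w s n f)

  ΣZ-cong : ∀ n {f g} → (∀ i → i ℕ.< n → f i ≡ g i) → ΣZ n f ≡ ΣZ n g
  ΣZ-cong zero h = refl
  ΣZ-cong (suc n) h = cong₂ _+_ (ΣZ-cong n (λ i l → h i (ℕ.m<n⇒m<1+n l))) (h n (ℕ.n<1+n n))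

  Σ-cong : ∀ n {f g} → (∀ i → i ℕ.< n → f i ≈ g i) → Σₚ n f ≈ Σₚ n g
  Σ-cong zero h = ≈-refl
  Σ-cong (suc n) h = ⊕-cong (Σ-cong n (λ i l → h i (ℕ.m<n⇒m<1+n l))) (h n (ℕ.n<1+n n))

  Σ-⊕ : ∀ n f g → Σₚ n (λ i → f i ⊕ g i) ≈ Σₚ n f ⊕ Σₚ n g
  Σ-⊕ zero f g = mk λ _ _ → refl
  Σ-⊕ (suc n) f g = ⊕-cong (Σ-⊕ n f g) ≈-refl ⟫ ⊕-interchange _ _ _ _

  linear-𝟘 : ∀ {O} → Linear O → O 𝟘 ≈ 𝟘
  linear-𝟘 o = lcong o (mk λ _ _ → refl) ⟫ lscal o 0ℤ 𝟘 ⟫ mk λ _ _ → refl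

  linear-Σ : ∀ {O} → Linear O → ∀ n f → O (Σₚ n f) ≈ Σₚ n (λ i → O (f i))
  linear-Σ o zero f = linear-𝟘 o
  linear-Σ o (suc n) f = ladd o _ _ ⟫ ⊕-cong (linear-Σ o n f) ≈-refl

  Σ-𝟘 : ∀ n → Σₚ n (λ _ → 𝟘) ≈ 𝟘
  Σ-𝟘 zero = ≈-refl
  Σ-𝟘 (suc n) = ⊕-cong (Σ-𝟘 n) ≈-refl ⟫ mk λ _ _ → refl

  Σ-swap : ∀ n m (f : ℕ → ℕ → Poly) → Σₚ n (λ i → Σₚ m (f i)) ≈ Σₚ m (λ j → Σₚ n (λ i → f i j))
  Σ-swap zero m f = ≈-sym (Σ-𝟘 m)
  Σ-swap (suc n) m f = ⊕-cong (Σ-swap n m f) ≈-refl ⟫ ≈-sym (Σ-⊕ m _ _)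

  lΣ : ∀ n {O : ℕ → Poly → Poly} → (∀ i → Linear (O i)) → Linear (λ f → Σₚ n (λ i → O i f))
  lΣ n o = record
    { lcong = λ h → Σ-cong n (λ i _ → lcong (o i) h)
    ; ladd = λ f g → Σ-cong n (λ i _ → ladd (o i) f g) ⟫ Σ-⊕ n _ _
    ; lscal = λ c f → Σ-cong n (λ i _ → lscal (o i) c f) ⟫ ≈-sym (linear-Σ (l· c lid) n _) }

  Σ-shift : ∀ n f → Σₚ (suc n) f ≈ f 0 ⊕ Σₚ n (λ i → f (suc i))
  Σ-shift zero f = mk λ w s → trans (ℤ.+-identityˡ (tc w s (f 0))) (sym (ℤ.+-identityʳ (tc w s (f 0))))
  Σ-shift (suc n) f = ⊕-cong (Σ-shift n f) ≈-refl ⟫ mk λ w s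
      → ℤ.+-assoc (tc w s (f 0)) (tc w s (Σₚ n (λ i → f (suc i)))) (tc w s (f (suc n)))

  -- Taylor coefficients at 1 of a polynomial in a further variable y with coefficients B 0, …, B m.
  tay : ℕ → (ℕ → Poly) → ℕ → Poly
  tay m B t = Σₚ (suc m) (λ j → (+ (j C t)) · B j)

  tay-cong : ∀ m {A B} t → (∀ j → j ℕ.≤ m → A j ≈ B j) → tay m A t ≈ tay m B t
  tay-cong m t h = Σ-cong (suc m) (λ { j (s≤s l) → ·-cong (+ (j C t)) (h j l) })

  tay-linear : ∀ {O} → Linear O → ∀ m B t → O (tay m B t) ≈ tay m (λ j → O (B j)) t
  tay-linear o m B t = linear-Σ o (suc m) _ ⟫ Σ-cong (suc m) (λ j _ → lscal o (+ (j C t)) (B j))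

  tay-⊕ : ∀ m A B t → tay m (λ j → A j ⊕ B j) t ≈ tay m A t ⊕ tay m B t
  tay-⊕ m A B t = Σ-cong (suc m) (λ j _ → ·-⊕ (+ (j C t)) (A j) (B j)) ⟫ Σ-⊕ (suc m) _ _

  tay-0 : ∀ m B → tay m B 0 ≈ Σₚ (suc m) B
  tay-0 m B = Σ-cong (suc m) (λ j _ → mk λ w s → ℤ.*-identityˡ (tc w s (B j)))

  tay-high : ∀ m B t → m ℕ.< t → tay m B t ≈ 𝟘
  tay-high m B t m<t = Σ-cong (suc m) (λ { j (s≤s l) → mk λ w s →
      cong (λ x → + x * tc w s (B j)) (k>n⇒nCk≡0 (ℕ.≤-<-trans l m<t)) }) ⟫ Σ-𝟘 (suc m)

  tay-vanish : ∀ m B t → (∀ j → t ℕ.≤ j → B j ≈ 𝟘) → tay m B t ≈ 𝟘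
  tay-vanish m B t h = Σ-cong (suc m) (λ j _ → zero-term j) ⟫ Σ-𝟘 (suc m)
    where
    zero-term : ∀ j → + (j C t) · B j ≈ 𝟘
    zero-term j with j ℕ.<? t
    ... | yes j<t = mk λ w s → cong (λ x → + x * tc w s (B j)) (k>n⇒nCk≡0 j<t)
    ... | no j≮t = ·-cong (+ (j C t)) (h j (ℕ.≮⇒≥ j≮t)) ⟫ mk λ w s → ℤ.*-zeroʳ (+ (j C t))

  -- This is y d/dy yʲ = j yʲ, expanded in powers of y - 1. With j = p it also yields the
  -- divisibility of binomial coefficients behind Fermat's little theorem.
  C-absorb : ∀ j t → j ℕ.* (j C t) ≡ t ℕ.* (j C t) ℕ.+ suc t ℕ.* (j C suc t)
  C-absorb zero zero = refl
  C-absorb zero (suc t) = sym (trans (cong₂ (λ x y → suc t ℕ.* x ℕ.+ suc (suc t) ℕ.* y)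
      (k>n⇒nCk≡0 {0} {suc t} (s≤s z≤n)) (k>n⇒nCk≡0 {0} {suc (suc t)} (s≤s z≤n)))
      (cong₂ ℕ._+_ (ℕ.*-zeroʳ (suc t)) (ℕ.*-zeroʳ (suc (suc t)))))
  C-absorb (suc j) zero = trans (ℕ.*-identityʳ (suc j)) (trans
      (cong suc (sym (trans (cong (ℕ._+ 0) (c1 j)) (ℕ.+-identityʳ j))))
          (sym (cong (λ x → x ℕ.+ 0) (sym (nCk+nC[k+1]≡[n+1]C[k+1] j 0)))))
    where
    c1 : ∀ j → j C 1 ≡ j
    c1 zero = refl
    c1 (suc j) = trans (sym (nCk+nC[k+1]≡[n+1]C[k+1] j 0)) (cong suc (c1 j))
  C-absorb (suc j) (suc t)
    rewrite sym (nCk+nC[k+1]≡[n+1]C[k+1] j t) | sym (nCk+nC[k+1]≡[n+1]C[k+1] j (suc t)) =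
    begin
      suc j ℕ.* (a ℕ.+ b)
        ≡⟨ l1 j a b ⟩
      (j ℕ.* a ℕ.+ j ℕ.* b) ℕ.+ (a ℕ.+ b)
        ≡⟨ cong (ℕ._+ (a ℕ.+ b)) (cong₂ ℕ._+_ (C-absorb j t) (C-absorb j (suc t))) ⟩
      (t ℕ.* a ℕ.+ suc t ℕ.* b ℕ.+ (suc t ℕ.* b ℕ.+ suc (suc t) ℕ.* c)) ℕ.+ (a ℕ.+ b)
        ≡⟨ l2 t a b c ⟩
      suc t ℕ.* (a ℕ.+ b) ℕ.+ suc (suc t) ℕ.* (b ℕ.+ c) ∎
    where
    open ≡-Reasoning
    a = j C t
    b = j C suc t
    c = j C suc (suc t)
    l1 : ∀ j a b → suc j ℕ.* (a ℕ.+ b) ≡ (j ℕ.* a ℕ.+ j ℕ.* b) ℕ.+ (a ℕ.+ b)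
    l1 = ℕSolver.solve-∀
    l2 : ∀ t a b c → (t ℕ.* a ℕ.+ suc t ℕ.* b ℕ.+ (suc t ℕ.* b ℕ.+ suc (suc t) ℕ.* c)) ℕ.+ (a ℕ.+ b) ≡ suc t ℕ.*
        (a ℕ.+ b) ℕ.+ suc (suc t) ℕ.* (b ℕ.+ c)
    l2 = ℕSolver.solve-∀

  -- The operator y d/dy in the coordinate y - 1.
  tay-euler : ∀ m B t → tay m (λ j → + j · B j) t ≈ + t · tay m B t ⊕ + suc t · tay m B (suc t)
  tay-euler m B t = Σ-cong (suc m) (λ j _ → mk λ w s → lem j (tc w s (B j)))
      ⟫ Σ-⊕ (suc m) _ _ ⟫ ⊕-cong (≈-sym (linear-Σ (l· (+ t) lid) (suc m) _)) (≈-sym (linear-Σ (l· (+ suc t) lid) (suc m) _))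
    where
    rearr : ∀ a b x → a * (b * x) ≡ (b * a) * x
    rearr = solve-∀
    dist : ∀ a b c d x → (a * b + c * d) * x ≡ a * (b * x) + c * (d * x)
    dist = solve-∀
    lem : ∀ j x → + (j C t) * (+ j * x) ≡ + t * (+ (j C t) * x) + + suc t * (+ (j C suc t) * x)
    lem j x = trans (rearr (+ (j C t)) (+ j) x)
      (trans (cong (_* x) (trans (sym (ℤ.pos-* j (j C t))) (trans (cong +_ (C-absorb j t))
         (trans (ℤ.pos-+ (t ℕ.* (j C t)) (suc t ℕ.* (j C suc t)))
             (cong₂ _+_ (ℤ.pos-* t (j C t)) (ℤ.pos-* (suc t) (j C suc t)))))))
        (dist (+ t) (+ (j C t)) (+ suc t) (+ (j C suc t)) x))

  -- Homogeneous Taylor expansion: with `Q` as y, `P` as 1 and `E` as y - 1, a form of degree m in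
  -- `Q` and `P` is rewritten in powers of `E`, with the coefficients `tay m B t`. In the
  -- applications at 0, 1 and ∞ the operator `E` raises the order.
  module Binomial {Q E P : Poly → Poly} (lQ : Linear Q) (lE : Linear E) (lP : Linear P)
      (split : ∀ f → Q f ≈ E f ⊕ P f) (comm : ∀ f → P (E f) ≈ E (P f)) where

    term : ℕ → ℕ → Poly → Poly
    term T t f = iter E t (iter P (T ℕ.∸ t) f)

    lterm : ∀ T t → Linear (term T t)
    lterm T t = l∘ (liter t lE) (liter (T ℕ.∸ t) lP)

    -- Induction on `j`: one factor `Q` splits into `E` and `P`, the latter joins the `e` factors
    -- already present, and Pascal's rule merges the two sums. Hence only `j + e` is fixed.
    power : ∀ T j e f → j ℕ.+ e ≡ T →
            iter Q j (iter P e f) ≈ Σₚ (suc T) (λ t → + (j C t) · term T t f)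
    power T zero e f refl = ≈-sym (Σ-shift e _ ⟫ ⊕-cong ≈-refl
        (Σ-cong e (λ t _ → mk λ w s → cong (λ x → + x * tc w s (term e (suc t) f)) (k>n⇒nCk≡0 {0} {suc t} (s≤s z≤n))) ⟫ Σ-𝟘 e)
        ⟫ mk λ w s → trans (ℤ.+-identityʳ (1ℤ * tc w s (iter P e f))) (ℤ.*-identityˡ (tc w s (iter P e f))))
    power (suc T) (suc j) e f eq =
      lcong (liter (suc j) lQ) ≈-refl
      ⟫ ≡⇒≈ ((iter-suc {Q} j (iter P e f)))
      ⟫ lcong (liter j lQ) (split (iter P e f) ⟫ ⊕-cong (≈-sym (iter-comm {P} {E} lP comm e f)) ≈-refl)
      ⟫ ladd (liter j lQ) _ _
      ⟫ ⊕-cong (power T j e (E f) (ℕ.suc-injective eq)) (power (suc T) j (suc e) f (trans (ℕ.+-suc j e) eq))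
      ⟫ ⊕-cong (Σ-cong (suc T) (λ t _ → ·-cong (+ (j C t)) (g-step t))) (Σ-shift (suc T) _)
      ⟫ (mk λ w s → rot (tc w s (Σₚ (suc T) (λ t → + (j C t) · g (suc t)))) (tc w s (+ (j C 0) · g 0))
          (tc w s (Σₚ (suc T) (λ t → + (j C suc t) · g (suc t)))))
      ⟫ ⊕-cong ≈-refl (≈-sym (Σ-⊕ (suc T) _ _) ⟫ Σ-cong (suc T) (λ t _ → mk λ w s →
          trans (sym (ℤ.*-distribʳ-+ (tc w s (g (suc t))) (+ (j C t)) (+ (j C suc t))))
            (cong (λ x → x * tc w s (g (suc t))) (trans (sym (ℤ.pos-+ (j C t) (j C suc t)))
                (cong +_ (nCk+nC[k+1]≡[n+1]C[k+1] j t))))))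
      ⟫ ≈-sym (Σ-shift (suc T) _)
      where
      g : ℕ → Poly
      g t = term (suc T) t f
      g-step : ∀ t → term T t (E f) ≈ g (suc t)
      g-step t = lcong (liter t lE) (iter-comm {P} {E} lP comm (T ℕ.∸ t) f) ⟫ ≡⇒≈ (sym (iter-suc {E} t (iter P (T ℕ.∸ t) f)))
      rot : ∀ a b c → a + (b + c) ≡ b + (a + c)
      rot = solve-∀

    expand : ∀ m B → Σₚ (suc m) (λ j → iter Q j (iter P (m ℕ.∸ j) (B j))) ≈ Σₚ (suc m) (λ t → term m t (tay m B t))
    expand m B = Σ-cong (suc m) (λ { j (s≤s l) → power m j (m ℕ.∸ j) (B j) (ℕ.m+[n∸m]≡n l) })
      ⟫ Σ-swap (suc m) (suc m) (λ j t → + (j C t) · term m t (B j))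
      ⟫ Σ-cong (suc m) (λ t _ → Σ-cong (suc m) (λ j _ → ≈-sym (lscal (lterm m t) (+ (j C t)) (B j)))
          ⟫ ≈-sym (linear-Σ (lterm m t) (suc m) (λ j → + (j C t) · B j)))

-- Congruences modulo p, and orders at points and at infinity

module Localisation where
  open Expressions
  open Operators
  open import Data.Integer using (+_; _+_; _*_; -_; _-_; _^_)
  open import Data.Integer.Tactic.RingSolver using (solve-∀)

  module Local (p : ℕ) (pp : Prime p) where
    open ModP p pp public

    infix 4 _≅_
    record _≅_ (x y : ℤ) : Set where
      constructor mk≅
      field difference : Z (x - y)
    open _≅_ public

    ≅-refl : ∀ {x} → x ≅ x
    ≅-refl {x} = mk≅ (Z-resp (ℤ.+-inverseʳ x) Z-0)

    ≅-reflexive : ∀ {x y} → x ≡ y → x ≅ y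
    ≅-reflexive refl = ≅-refl

    ≅-trans : ∀ {x y z} → x ≅ y → y ≅ z → x ≅ z
    ≅-trans {x} {y} {z} h k = mk≅ (Z-resp (lem x y z) (Z-+ (difference h) (difference k)))
      where lem : ∀ x y z → x - z ≡ (x - y) + (y - z)
            lem = solve-∀

    ≅-sym : ∀ {x y} → x ≅ y → y ≅ x
    ≅-sym {x} {y} h = mk≅ (Z-resp (lem x y) (Z-* -1ℤ (difference h)))
      where lem : ∀ x y → y - x ≡ -1ℤ * (x - y)
            lem = solve-∀

    ≅-+ : ∀ {x y u v} → x ≅ y → u ≅ v → x + u ≅ y + v
    ≅-+ {x} {y} {u} {v} h k = mk≅ (Z-resp (lem x y u v) (Z-+ (difference h) (difference k)))
      where lem : ∀ x y u v → (x + u) - (y + v) ≡ (x - y) + (u - v)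
            lem = solve-∀

    ≅-* : ∀ {x y u v} → x ≅ y → u ≅ v → x * u ≅ y * v
    ≅-* {x} {y} {u} {v} h k = mk≅ (Z-resp (lem x y u v) (Z-+ (Z-* u (difference h)) (Z-* y (difference k))))
      where lem : ∀ x y u v → x * u - y * v ≡ u * (x - y) + y * (u - v)
            lem = solve-∀

    ≅-^ : ∀ {x y} n → x ≅ y → x ^ n ≅ y ^ n
    ≅-^ zero h = ≅-refl
    ≅-^ (suc n) h = ≅-* h (≅-^ n h)

    Z→≅0 : ∀ {x} → Z x → x ≅ 0ℤ
    Z→≅0 {x} z = mk≅ (Z-resp (ℤ.+-identityʳ x) z)

    ≅-Z : ∀ {x y} → x ≅ y → Z y → Z x
    ≅-Z {x} {y} h z = Z-resp (lem x y) (Z-+ (difference h) z)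
      where lem : ∀ x y → x ≡ (x - y) + y
            lem = solve-∀

    isolate : ∀ w s n (f : ℕ → Poly) i₀ → i₀ ℕ.< n → (∀ i → i ℕ.< n → i ≢ i₀ → Z (tc w s (f i)))
      → Z (tc w s (Σₚ n f)) → Z (tc w s (f i₀))
    isolate w s (suc n) f i₀ (s≤s l) h z with ℕ.m≤n⇒m<n∨m≡n l
    ... | inj₁ i₀<n = isolate w s n f i₀ i₀<n (λ i l′ → h i (ℕ.m<n⇒m<1+n l′))
           (Z-resp (lem (tc w s (Σₚ n f)) (tc w s (f n))) (Z-- z (h n (ℕ.n<1+n n) (λ e → ℕ.<-irrefl (sym e) i₀<n))))
      where lem : ∀ x y → x ≡ (x + y) - y
            lem = solve-∀
    ... | inj₂ refl = Z-resp (lem (tc w s (Σₚ n f)) (tc w s (f n))) (Z-- z (closed n (λ i l′ → h i (ℕ.m<n⇒m<1+n l′) (ℕ.<⇒≢ l′))))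
      where
      lem : ∀ x y → y ≡ (x + y) - x
      lem = solve-∀
      closed : ∀ n → (∀ i → i ℕ.< n → Z (tc w s (f i))) → Z (tc w s (Σₚ n f))
      closed zero h = Z-0
      closed (suc n) h = Z-+ (closed n (λ i l → h i (ℕ.m<n⇒m<1+n l))) (h n (ℕ.n<1+n n))

    -- What `Ord`, `Deg` and `Null` have in common; it allows one argument to serve for the places
    -- 0, 1 and ∞.
    record Closed (Q : Poly → Set) : Set where
      field
        resp : ∀ {f g} → f ≈ g → Q g → Q f
        czero : Q 𝟘
        cadd : ∀ {f g} → Q f → Q g → Q (f ⊕ g)
        cscal : ∀ c {f} → Q f → Q (c · f)
    open Closed public

    closed-Σ : ∀ {Q} → Closed Q → ∀ n f → (∀ i → i ℕ.< n → Q (f i)) → Q (Σₚ n f)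
    closed-Σ c zero f h = czero c
    closed-Σ c (suc n) f h = cadd c (closed-Σ c n f (λ i l → h i (ℕ.m<n⇒m<1+n l))) (h n (ℕ.n<1+n n))

    Ord-closed : ∀ w e → Closed (Ord w e)
    Ord-closed w e = record
      { resp = λ e h → ord λ s x → Z-resp (at e w s) (taylor h s x)
      ; czero = ord λ _ _ → Z-0
      ; cadd = λ h k → ord λ s x → Z-+ (taylor h s x) (taylor k s x)
      ; cscal = λ c h → ord λ s x → Z-* c (taylor h s x) }

    Deg-closed : ∀ d e → Closed (Deg d e)
    Deg-closed d e = record
      { resp = λ e h → deg λ s x → Z-resp (at e 0ℤ s) (coeff h s x)
      ; czero = deg λ _ _ → Z-0
      ; cadd = λ h k → deg λ s x → Z-+ (coeff h s x) (coeff k s x)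
      ; cscal = λ c h → deg λ s x → Z-* c (coeff h s x) }

    V-closed : ∀ {Q} → Closed Q → (∀ {f} → Q f → Q (U f)) → ∀ {f} → Q f → Q (V f)
    V-closed c u h = cadd c h (cscal c -1ℤ (u h))

    iter-closed : ∀ {Q : Poly → Set} {O : Poly → Poly} → (∀ {f} → Q f → Q (O f)) → ∀ n {f} → Q f → Q (iter O n f)
    iter-closed h zero q = q
    iter-closed {Q} h (suc n) q = h (iter-closed {Q} h n q)

    Ord-weaken : ∀ {w e e′ f} → e ℕ.≤ e′ → Ord w e′ f → Ord w e f
    Ord-weaken l h = ord λ s s<e → taylor h s (ℕ.<-≤-trans s<e l)

    Ord-U : ∀ {w e f} → Ord w e f → Ord w e (U f)
    Ord-U {w} h = ord λ
      { zero l → Z-* w (taylor h 0 l)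
      ; (suc s) l → Z-+ (Z-* w (taylor h (suc s) l)) (taylor h s (ℕ.<-trans (ℕ.n<1+n s) l)) }

    Ord-V : ∀ {w e f} → Ord w e f → Ord w e (V f)
    Ord-V {w} {e} = V-closed (Ord-closed w e) Ord-U

    Ord-D : ∀ {w e f} → Ord w (suc e) f → Ord w e (D f)
    Ord-D h = ord λ s l → Z-* (+ suc s) (taylor h (suc s) (s≤s l))

    Ord₀-U : ∀ {e f} → Ord 0ℤ e f → Ord 0ℤ (suc e) (U f)
    Ord₀-U {f = f} h = ord λ
      { zero l → Z-0
      ; (suc s) (s≤s l) → Z-resp (ℤ.+-identityˡ (tc 0ℤ s f)) (taylor h s l) }

    Ord₁-V : ∀ {e f} → Ord 1ℤ e f → Ord 1ℤ (suc e) (V f)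
    Ord₁-V {f = f} h = ord λ
      { zero l → Z-resp (lem₀ (tc 1ℤ 0 f)) Z-0
      ; (suc s) (s≤s l) → Z-resp (lem (tc 1ℤ (suc s) f) (tc 1ℤ s f)) (Z-* -1ℤ (taylor h s l)) }
      where
      lem₀ : ∀ x → x + -1ℤ * (1ℤ * x) ≡ 0ℤ
      lem₀ = solve-∀
      lem : ∀ x y → x + -1ℤ * (1ℤ * x + y) ≡ -1ℤ * y
      lem = solve-∀

    Ord₀-θ : ∀ {e f} → Ord 0ℤ e f → Ord 0ℤ e (θ f)
    Ord₀-θ {zero} h = ord λ _ ()
    Ord₀-θ {suc e} h = Ord₀-U (Ord-V (Ord-D h))

    Ord₁-θ : ∀ {e f} → Ord 1ℤ e f → Ord 1ℤ e (θ f)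
    Ord₁-θ {zero} h = ord λ _ ()
    Ord₁-θ {suc e} {f} h = resp (Ord-closed 1ℤ (suc e)) (UV-comm (D f)) (Ord₁-V (Ord-U (Ord-D h)))

    Deg-U : ∀ {d e f} → Deg d e f → Deg (suc d) e (U f)
    Deg-U {f = f} h = deg λ
      { zero l → Z-0
      ; (suc s) (s≤s l) → Z-resp (ℤ.+-identityˡ (tc 0ℤ s f)) (coeff h s l) }

    Deg-weaken : ∀ {d d′ e e′ f} → (∀ s → d′ ℕ.≤ s ℕ.+ e′ → d ℕ.≤ s ℕ.+ e) → Deg d e f → Deg d′ e′ f
    Deg-weaken l h = deg λ s x → coeff h s (l s x)

    Deg-V : ∀ {d e f} → Deg d e f → Deg (suc d) e (V f)
    Deg-V {d} {e} h = cadd (Deg-closed (suc d) e) (deg λ s l → coeff h s (ℕ.<⇒≤ l)) (cscal (Deg-closed (suc d) e) -1ℤ (Deg-U h))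

    -- `U` and `V` raise the degree by one each and `D` lowers it, so that the total is one. Thus r
    -- applications of T raise the degree by at most r, as the count of conditions supposes.
    Deg-θ : ∀ {d e f} → Deg d e f → Deg (suc d) e (θ f)
    Deg-θ {d} {e} {f} h = deg λ
      { zero l → Z-0
      ; (suc s) (s≤s l) → Z-resp (ℤ.+-identityˡ (tc 0ℤ s (V (D f))))
        (Z-+ (Z-* (+ suc s) (coeff h (suc s) (ℕ.m≤n⇒m≤1+n l))) (Z-* -1ℤ (go s l))) }
      where
      go : ∀ s → d ℕ.≤ s ℕ.+ e → Z (tc 0ℤ s (U (D f)))
      go zero l = Z-0
      go (suc s) l = Z-resp (ℤ.+-identityˡ _) (Z-* (+ suc s) (coeff h (suc s) l))

    -- At 0, 1 and ∞ alike, T has the form R + κ j W in a suitable index j, where R keeps the order and W raises it.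
    -- As y d/dy does not lower the degree in y - 1 by more than one, the t-th coefficient keeps order m - t under T.
    loc-step : ∀ {R W} → Linear R → Linear W → (O O′ : ℕ → Poly → Set) → (∀ e → Closed (O′ e))
      → (∀ e {f} → O e f → O′ e (R f)) → (∀ e {f} → O e f → O′ (suc e) (W f)) → (∀ e {f} → O′ (suc e) f → O′ e f)
      → (∀ e → Closed (O e))
      → ∀ m b → b ℕ.≤ m → ∀ κ (B B′ : ℕ → Poly) → (∀ j → j ℕ.≤ b → B′ j ≈ R (B j) ⊕ κ · W (+ j · B j))
      → (∀ t → t ℕ.≤ b → O (m ℕ.∸ t) (tay b B t)) → ∀ t → t ℕ.≤ b → O′ (m ℕ.∸ t) (tay b B′ t)
    loc-step {R} {W} lR lW O O′ cl rO wO weak clO m b b≤m κ B B′ B′≈ h t t≤b =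
      resp (cl e) (tay-cong b t B′≈ ⟫ tay-⊕ b _ _ t
          ⟫ ⊕-cong (≈-sym (tay-linear lR b B t))
                   (≈-sym (tay-linear (l· κ lW) b (λ j → + j · B j) t) ⟫ ·-cong κ (lcong lW (tay-euler b B t) ⟫ ladd lW _ _)))
        (cadd (cl e) (rO e (h t t≤b))
          (cscal (cl e) κ (cadd (cl e) (weak e (wO e (cscal (clO e) (+ t) (h t t≤b)))) next)))
      where
      e = m ℕ.∸ t
      next : O′ e (W (+ suc t · tay b B (suc t)))
      next with ℕ.m≤n⇒m<n∨m≡n t≤b
      -- Coefficient `t + 1` has only order `m - (t + 1)`; `W` makes up for the missing one.
      ... | inj₁ t<b = subst (λ x → O′ x (W (+ suc t · tay b B (suc t)))) (sym (ℕ.+-∸-assoc 1 (ℕ.<-≤-trans t<b b≤m)))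
                         (wO (m ℕ.∸ suc t) (cscal (clO (m ℕ.∸ suc t)) (+ suc t) (h (suc t) t<b)))
      ... | inj₂ refl = resp (cl e) (lcong lW (·-cong (+ suc t) (tay-high b B (suc b) (ℕ.n<1+n b)) ) ⟫ lcong lW (mk λ _ _ → ℤ.*-zeroʳ (+ suc t)) ⟫ linear-𝟘 lW) (czero (cl e))

    -- The t-th coefficient has order m - t, and the t factors `E` in front of it gain t. The first
    -- index of `O` counts the operators applied: at ∞ each of them also raises the degree bound by
    -- k, at 0 and 1 it is ignored.
    gain : ∀ {Q E P} (lQ : Linear Q) (lE : Linear E) (lP : Linear P)
      → (∀ f → Q f ≈ E f ⊕ P f) → (∀ f → P (E f) ≈ E (P f))
      → (O : ℕ → ℕ → Poly → Set) → (∀ n e → Closed (O n e))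
      → (∀ n e {f} → O n e f → O (suc n) (suc e) (E f)) → (∀ n e {f} → O n e f → O (suc n) e (P f))
      → ∀ m B → (∀ t → t ℕ.≤ m → O 0 (m ℕ.∸ t) (tay m B t))
      → O m m (Σₚ (suc m) (λ j → iter Q j (iter P (m ℕ.∸ j) (B j))))
    gain {Q} {E} {P} lQ lE lP split comm O cl eO pO m B h =
      resp (cl m m) (Binomial.expand lQ lE lP split comm m B)
        (closed-Σ (cl m m) (suc m) _ (λ { t (s≤s t≤m) →
          subst (λ x → O x x (iter E t (iter P (m ℕ.∸ t) (tay m B t)))) (ℕ.m+[n∸m]≡n t≤m)
            (goE t {m ℕ.∸ t} {m ℕ.∸ t} (goP (m ℕ.∸ t) (h t t≤m))) }))
      where
      goP : ∀ a {e f} → O 0 e f → O a e (iter P a f)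
      goP zero q = q
      goP (suc a) q = pO a _ (goP a q)
      goE : ∀ t {n e f} → O n e f → O (t ℕ.+ n) (t ℕ.+ e) (iter E t f)
      goE zero q = q
      goE (suc t) {n} {e} q = eO (t ℕ.+ n) (t ℕ.+ e) (goE t q)

    -- sym-O gives the factor (the symbol) by which the operator O multiplies the leading Taylor coefficient.

    sym-U : ∀ {w e f} → Ord w e f → tc w e (U f) ≅ w * tc w e f
    sym-U {w} {zero} h = ≅-refl
    sym-U {w} {suc e} {f} h = mk≅ (Z-resp (lem (w * tc w (suc e) f) (tc w e f)) (taylor h e (ℕ.n<1+n e)))
      where lem : ∀ x y → (x + y) - x ≡ y
            lem = solve-∀

    sym-V : ∀ {w e f} → Ord w e f → tc w e (V f) ≅ (1ℤ - w) * tc w e f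
    sym-V {w} {e} {f} h = ≅-trans (≅-+ (≅-refl {tc w e f}) (≅-* (≅-refl { -1ℤ}) (sym-U {w} {e} {f} h)))
        (≅-reflexive (lem w (tc w e f)))
      where lem : ∀ w x → x + -1ℤ * (w * x) ≡ (1ℤ - w) * x
            lem = solve-∀

    sym-θ : ∀ {w e f} → Ord w (suc e) f → tc w e (θ f) ≅ (+ suc e * (w * (1ℤ - w))) * tc w (suc e) f
    sym-θ {w} {e} {f} h = ≅-trans (sym-U {w} {e} {V (D f)} (Ord-V {w} {e} {D f} (Ord-D {w} {e} {f} h)))
        (≅-trans (≅-* (≅-refl {w}) (sym-V {w} {e} {D f} (Ord-D {w} {e} {f} h))) (≅-reflexive (lem w (+ suc e) (tc w (suc e) f))))
      where lem : ∀ w n x → w * ((1ℤ - w) * (n * x)) ≡ (n * (w * (1ℤ - w))) * x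
            lem = solve-∀

    Ord-suc : ∀ {w e f} → Ord w e f → Z (tc w e f) → Ord w (suc e) f
    Ord-suc {w} {e} {f} h z = ord go
      where
      go : ∀ s → s ℕ.< suc e → Z (tc w s f)
      go s (s≤s l) with ℕ.m≤n⇒m<n∨m≡n l
      ... | inj₁ s<e = taylor h s s<e
      ... | inj₂ refl = z

    -- If f has order e at w, the value of the e-th iterate of θ is the leading coefficient times e!
    -- (w(1-w))ᵉ, and this factor is invertible because e < M ≤ p. So iterates of θ detect the order
    -- as derivatives do.
    θ-vanishing : ∀ {w} → ¬ Z w → ¬ Z (1ℤ - w) → ∀ M → M ℕ.≤ p → ∀ f
      → (∀ r → r ℕ.< M → Z (tc w 0 (iter θ r f))) → Ord w M f
    θ-vanishing {w} nw nv M M≤p f h = go M ℕ.≤-refl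
      where
      lead : ∀ e f → e ℕ.< p → Ord w e f → Z (tc w 0 (iter θ e f)) → Z (tc w e f)
      lead zero f _ o z = z
      lead (suc e) f e<p o z =
        Z-cancel w nw (Z-cancel (1ℤ - w) nv (Z-cancel (+ suc e) (¬Z-pos (suc e) (s≤s z≤n) e<p)
          (Z-resp (lem (+ suc e) w (tc w (suc e) f))
          (≅-Z (≅-sym (sym-θ {w} {e} {f} o)) (lead e (θ f) (ℕ.<-trans (ℕ.n<1+n e) e<p)
             (Ord-U (Ord-V (Ord-D o))) (subst (λ g → Z (tc w 0 g)) (iter-suc {θ} e f) z))))))
        where lem : ∀ n w x → n * ((1ℤ - w) * (w * x)) ≡ (n * (w * (1ℤ - w))) * x
              lem = solve-∀
      go : ∀ e → e ℕ.≤ M → Ord w e f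
      go zero _ = ord λ _ ()
      go (suc e) l = Ord-suc {w} {e} {f} o (lead e f (ℕ.<-≤-trans l M≤p) o (h e l))
        where o = go e (ℕ.<⇒≤ l)

    sym-iter : ∀ {w e} {O : Poly → Poly} {σ} → (∀ {f} → Ord w e f → Ord w e (O f))
        → (∀ {f} → Ord w e f → tc w e (O f) ≅ σ * tc w e f)
      → ∀ n {f} → Ord w e f → tc w e (iter O n f) ≅ σ ^ n * tc w e f
    sym-iter {w} {e} o h zero {f} q = ≅-reflexive (sym (ℤ.*-identityˡ (tc w e f)))
    sym-iter {w} {e} {O} {σ} o h (suc n) {f} q = ≅-trans (h (iter-closed {Ord w e} {O} o n q))
       (≅-trans (≅-* (≅-refl {σ}) (sym-iter {w} {e} {O} {σ} o h n q)) (≅-reflexive (sym (ℤ.*-assoc σ (σ ^ n) (tc w e f)))))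

-- The derivation θ on products of powers of u and 1 - u, and the local conditions

module Derivation where
  open Expressions
  open Operators
  open Localisation
  open import Data.Integer using (+_; _+_; _*_; -_; _-_; _^_)
  open import Data.Integer.Tactic.RingSolver using (solve-∀)

  -- T a b and S a describe θ on u^a (1-u)^b f and on u^a f.
  S : ℤ → Poly → Poly
  S c f = θ f ⊕ c · V f

  T : ℕ → ℕ → Poly → Poly
  T a b f = S (+ a) f ⊕ (- (+ b)) · U f

  lS : ∀ c → Linear (S c)
  lS c = l⊕ lθ (l· c lV)

  lT : ∀ a b → Linear (T a b)
  lT a b = l⊕ (lS (+ a)) (l· (- (+ b)) lU)

  US : ∀ c f → U (S c f) ≈ S (c - 1ℤ) (U f)
  US c f = ladd lU _ _ ⟫ ⊕-cong ≈-refl (lscal lU c (V f) ⟫ ·-cong c (UV-comm f))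
     ⟫ (mk λ w s → lem c (tc w s (U (θ f))) (tc w s (V (U f))))
     ⟫ ⊕-cong (⊕-cong ≈-refl (≈-sym (UV-comm f)) ⟫ ≈-sym (ladd lU _ _) ⟫ ≈-sym (θU f)) ≈-refl
    where lem : ∀ c a b → a + c * b ≡ (a + b) + (c - 1ℤ) * b
          lem = solve-∀

  VT : ∀ a b f → V (T a (suc b) f) ≈ T a b (V f)
  VT a b f = ladd lV _ _ ⟫ ⊕-cong (ladd lV _ _ ⟫ ⊕-cong ≈-refl (lscal lV (+ a) (V f))) (lscal lV _ _)
     ⟫ (mk λ w s → lem (+ a) (+ b) (tc w s (V (θ f))) (tc w s (V (V f))) (tc w s (V (U f))))
     ⟫ ⊕-cong (⊕-cong (⊕-cong ≈-refl (≈-sym (lscal lV -1ℤ (U f))) ⟫ ≈-sym (ladd lV _ _) ⟫ ≈-sym (θV f)) ≈-refl)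
              (·-cong (- (+ b)) (≈-sym (UV-comm f)))
    where lem : ∀ a b x y z → (x + a * y) + (- (1ℤ + b)) * z ≡ ((x + -1ℤ * z) + a * y) + (- b) * z
          lem = solve-∀

  T0 : ∀ a f → T a 0 f ≈ S (+ a) f
  T0 a f = mk λ w s → lem (tc w s (S (+ a) f)) (tc w s (U f))
    where lem : ∀ x y → x + (- (+ 0)) * y ≡ x
          lem = solve-∀

  VⁿT : ∀ a b f → iter V b (T a b f) ≈ S (+ a) (iter V b f)
  VⁿT a zero f = T0 a f
  VⁿT a (suc b) f = ≡⇒≈ ((iter-suc {V} b (T a (suc b) f)))
    ⟫ lcong (liter b lV) (VT a b f) ⟫ VⁿT a b (V f)
    ⟫ lcong (lS (+ a)) (≡⇒≈ (sym (iter-suc {V} b f)))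

  VⁿTʳ : ∀ a b r f → iter V b (iter (T a b) r f) ≈ iter (S (+ a)) r (iter V b f)
  VⁿTʳ a b zero f = ≈-refl
  VⁿTʳ a b (suc r) f = VⁿT a b (iter (T a b) r f) ⟫ lcong (lS (+ a)) (VⁿTʳ a b r f)

  -- The exponent of `S` is an integer because `t` may exceed it: later c is ik, where i can be 0.
  UⁿS : ∀ t c f → iter U t (S c f) ≈ S (c - + t) (iter U t f)
  UⁿS zero c f = mk λ w s → cong (λ x → tc w s (θ f) + x * tc w s (V f)) (sym (ℤ.+-identityʳ c))
  UⁿS (suc t) c f = lcong lU (UⁿS t c f) ⟫ US (c - + t) (iter U t f)
     ⟫ mk λ w s → cong (λ x → tc w s (θ (iter U (suc t) f)) + x * tc w s (V (iter U (suc t) f))) (lem c (+ t))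
    where lem : ∀ c t → (c - t) - 1ℤ ≡ c - (1ℤ + t)
          lem = solve-∀

  UⁿSʳ : ∀ t c r f → iter U t (iter (S c) r f) ≈ iter (S (c - + t)) r (iter U t f)
  UⁿSʳ t c zero f = ≈-refl
  UⁿSʳ t c (suc r) f = UⁿS t c (iter (S c) r f) ⟫ lcong (lS (c - + t)) (UⁿSʳ t c r f)

  -- Read from right to left: each factor 1 - u lowers the second exponent of `T` until `S` is left,
  -- then each factor u lowers the exponent of `S`, down to a - a = 0, where `S` is θ.
  θUV : ∀ a b r f → iter θ r (iter U a (iter V b f)) ≈ iter U a (iter V b (iter (T a b) r f))
  θUV a b r f = ≈-sym (lcong (liter a lU) (VⁿTʳ a b r f) ⟫ UⁿSʳ a (+ a) r (iter V b f) ⟫ go r)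
    where
    S0 : ∀ g → S (+ a - + a) g ≈ θ g
    S0 g = mk λ w s → lem (+ a) (tc w s (θ g)) (tc w s (V g))
      where lem : ∀ a x y → x + (a - a) * y ≡ x
            lem = solve-∀
    go : ∀ r {g} → iter (S (+ a - + a)) r g ≈ iter θ r g
    go zero = ≈-refl
    go (suc r) = S0 _ ⟫ lcong lθ (go r)

  Σ-trunc : ∀ a n f → (∀ j → a ℕ.≤ j → j ℕ.< n → f j ≈ 𝟘) → a ℕ.≤ n → Σₚ n f ≈ Σₚ a f
  Σ-trunc a n f h l with ℕ.m≤n⇒m<n∨m≡n l
  ... | inj₂ refl = ≈-refl
  Σ-trunc a (suc n) f h l | inj₁ (s≤s a≤n) =
    ⊕-cong (Σ-trunc a n f (λ j x y → h j x (ℕ.m<n⇒m<1+n y)) a≤n) (h n a≤n (ℕ.n<1+n n)) ⟫ mk λ w s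
        → ℤ.+-identityʳ (tc w s (Σₚ a f))

  antidiagonal : ∀ n (f : ℕ → ℕ → Poly) → Σₚ n (λ i → Σₚ (n ℕ.∸ i) (f i)) ≈ Σₚ n (λ c → Σₚ (suc c) (λ i → f i (c ℕ.∸ i)))
  antidiagonal zero f = ≈-refl
  antidiagonal (suc n) f =
    ⊕-cong (Σ-cong n (λ i l → (mk λ w s → cong (λ x → tc w s (Σₚ x (f i))) (ℕ.+-∸-assoc 1 (ℕ.<⇒≤ l))))
              ⟫ Σ-⊕ n (λ i → Σₚ (n ℕ.∸ i) (f i)) (λ i → f i (n ℕ.∸ i))
              ⟫ ⊕-cong (antidiagonal n f) ≈-refl) corner
    ⟫ mk λ w s → ℤ.+-assoc (tc w s (Σₚ n (λ c → Σₚ (suc c) (λ i → f i (c ℕ.∸ i)))))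
        (tc w s (Σₚ n (λ i → f i (n ℕ.∸ i)))) (tc w s (f n (n ℕ.∸ n)))
    where
    corner : Σₚ (suc n ℕ.∸ n) (f n) ≈ f n (n ℕ.∸ n)
    corner rewrite ℕ.+-∸-assoc 1 (ℕ.≤-refl {n}) | ℕ.n∸n≡0 n = mk λ w s → ℤ.+-identityˡ (tc w s (f n 0))

  -- The degree of u^(ik) (1-u)^(jk) depends on i + j only, so the rows that matter at infinity are
  -- those with i + j = c.
  triangle-antidiagonal : ∀ m (f : ℕ → ℕ → Poly) → (∀ i j → m ℕ.< i ℕ.+ j → f i j ≈ 𝟘)
    → Σₚ (suc m) (λ i → Σₚ (suc m) (f i)) ≈ Σₚ (suc m) (λ c → Σₚ (suc c) (λ i → f i (c ℕ.∸ i)))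
  triangle-antidiagonal m f h = Σ-cong (suc m) (λ { i (s≤s l) →
      Σ-trunc (suc m ℕ.∸ i) (suc m) (f i) (λ j x y → h i j (ℕ.≤-trans (ℕ.m≤n+m∸n (suc m) i) (ℕ.+-monoʳ-≤ i x)))
          (ℕ.m∸n≤m (suc m) i) })
    ⟫ antidiagonal (suc m) f

  iter-mul : ∀ (O : Poly → Poly) k j f → iter (iter O k) j f ≡ iter O (j ℕ.* k) f
  iter-mul O k zero f = refl
  iter-mul O k (suc j) f = trans (cong (iter O k) (iter-mul O k j f)) (sym (iter-+ O k (j ℕ.* k) f))

  module Family (k : ℕ) where

    Tᵢⱼ : ℕ → ℕ → Poly → Poly
    Tᵢⱼ i j = T (i ℕ.* k) (j ℕ.* k)

    step : (ℕ → ℕ → Poly) → ℕ → ℕ → ℕ → Poly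
    step A r i j = iter (Tᵢⱼ i j) r (A i j)

    F : ℕ → (ℕ → ℕ → Poly) → ℕ → Poly
    F m A r = Σₚ (suc m) (λ i → Σₚ (suc m) (λ j → step A r i j))

    module _ (p : ℕ) (pp : Prime p) where
      open Local p pp

      T-at-0 : ∀ i j f → Tᵢⱼ i j f ≈ S (+ (i ℕ.* k)) f ⊕ (- (+ k)) · U (+ j · f)
      T-at-0 i j f = ⊕-cong ≈-refl ((mk λ w s → trans (cong (λ x → - x * tc w s (U f)) (ℤ.pos-* j k))
          (lem (+ j) (+ k) (tc w s (U f)))) ⟫ ·-cong (- (+ k)) (≈-sym (lscal lU (+ j) f)))
        where lem : ∀ j k x → - (j * k) * x ≡ - k * (j * x)
              lem = solve-∀

      R₁ : ℕ → Poly → Poly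
      R₁ b f = θ f ⊕ (- (+ b)) · U f

      lR₁ : ∀ b → Linear (R₁ b)
      lR₁ b = l⊕ lθ (l· (- (+ b)) lU)

      T-at-1 : ∀ i j f → Tᵢⱼ i j f ≈ R₁ (j ℕ.* k) f ⊕ (+ k) · V (+ i · f)
      T-at-1 i j f = (mk λ w s → trans (cong (λ x → tc w s (θ f) + x * tc w s (V f) + - (+ (j ℕ.* k)) * tc w s (U f))
          (ℤ.pos-* i k))
            (lem (+ i) (+ k) (- (+ (j ℕ.* k))) (tc w s (θ f)) (tc w s (V f)) (tc w s (U f))))
          ⟫ ⊕-cong ≈-refl (·-cong (+ k) (≈-sym (lscal lV (+ i) f)))
        where lem : ∀ i k b x y z → (x + i * k * y) + b * z ≡ (x + b * z) + k * (i * y)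
              lem = solve-∀

      -- As V = 1 - U, for i + j = c the sum ik V - jk U equals ik - ck U: what depends on i is a
      -- constant factor. While `R₁` raises the degree by one, a constant does not, and so it counts
      -- as gaining one order at infinity.
      T-at-∞ : ∀ c i f → i ℕ.≤ c → Tᵢⱼ i (c ℕ.∸ i) f ≈ R₁ (c ℕ.* k) f ⊕ (+ k) · (+ i · f)
      T-at-∞ c i f i≤c = mk λ w s → trans (cong₂ (λ x y → tc w s (θ f) + x * tc w s (V f) + - y * tc w s (U f))
          (ℤ.pos-* i k) (ℤ.pos-* (c ℕ.∸ i) k))
          (trans (lem (+ i) (+ (c ℕ.∸ i)) (+ k) (tc w s (θ f)) (tc w s f) (tc w s (U f)))
            (cong (λ x → tc w s (θ f) + - x * tc w s (U f) + + k * (+ i * tc w s f))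
               (trans (cong (_* + k) (trans (sym (ℤ.pos-+ (c ℕ.∸ i) i)) (cong +_ (ℕ.m∸n+n≡m i≤c)))) (sym (ℤ.pos-* c k)))))
        where lem : ∀ i j k x y z → (x + i * k * (y + -1ℤ * z)) + - (j * k) * z ≡ (x + - ((j + i) * k) * z) + k * (i * y)
              lem = solve-∀

      module _ (m : ℕ) (A : ℕ → ℕ → Poly) where

        -- Let y stand for a function equal to 1 at the place: (1-u)ᵏ at 0, uᵏ at 1, and, up to
        -- sign, (u/(1-u))ᵏ at ∞, where the rows are those with i + j = c. As y - 1 vanishes there,
        -- order m - t for the coefficient of (y-1)ᵗ is what gives order m for the whole row.
        At0 At1 : ℕ → Set
        At0 r = ∀ i t → i ℕ.≤ m → t ℕ.≤ m → Ord 0ℤ (m ℕ.∸ t) (tay m (λ j → step A r i j) t)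
        At1 r = ∀ j t → j ℕ.≤ m → t ℕ.≤ m → Ord 1ℤ (m ℕ.∸ t) (tay m (λ i → step A r i j) t)
        At∞ : ℕ → ℕ → Set
        At∞ d r = ∀ c t → c ℕ.≤ m → t ℕ.≤ c → Deg (r ℕ.+ d) (m ℕ.∸ t) (tay c (λ i → step A r i (c ℕ.∸ i)) t)

        at0-step : ∀ r → At0 r → At0 (suc r)
        at0-step r h i t i≤m t≤m = loc-step (lS (+ (i ℕ.* k))) lU (Ord 0ℤ) (Ord 0ℤ) (Ord-closed 0ℤ)
          (λ e q → cadd (Ord-closed 0ℤ e) (Ord₀-θ q) (cscal (Ord-closed 0ℤ e) (+ (i ℕ.* k)) (Ord-V q)))
          (λ e → Ord₀-U) (λ e → Ord-weaken (ℕ.n≤1+n e)) (Ord-closed 0ℤ)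
          m m ℕ.≤-refl (- (+ k)) (λ j → step A r i j) (λ j → step A (suc r) i j)
          (λ j _ → T-at-0 i j (step A r i j)) (λ t l → h i t i≤m l) t t≤m

        at1-step : ∀ r → At1 r → At1 (suc r)
        at1-step r h j t j≤m t≤m = loc-step (lR₁ (j ℕ.* k)) lV (Ord 1ℤ) (Ord 1ℤ) (Ord-closed 1ℤ)
          (λ e q → cadd (Ord-closed 1ℤ e) (Ord₁-θ q) (cscal (Ord-closed 1ℤ e) (- (+ (j ℕ.* k))) (Ord-U q)))
          (λ e → Ord₁-V) (λ e → Ord-weaken (ℕ.n≤1+n e)) (Ord-closed 1ℤ)
          m m ℕ.≤-refl (+ k) (λ i → step A r i j) (λ i → step A (suc r) i j)
          (λ i _ → T-at-1 i j (step A r i j)) (λ t l → h j t j≤m l) t t≤m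

        at∞-step : ∀ d r → At∞ d r → At∞ d (suc r)
        at∞-step d r h c t c≤m t≤c = loc-step (lR₁ (c ℕ.* k)) lid (Deg (r ℕ.+ d)) (Deg (suc r ℕ.+ d)) (Deg-closed (suc r ℕ.+ d))
          (λ e q → cadd (Deg-closed (suc r ℕ.+ d) e) (Deg-θ q) (cscal (Deg-closed (suc r ℕ.+ d) e) (- (+ (c ℕ.* k))) (Deg-U q)))
          (λ e → Deg-weaken (λ s x → ℕ.≤-pred (ℕ.≤-trans x (ℕ.≤-reflexive (ℕ.+-suc s e)))))
          (λ e → Deg-weaken (λ s x → ℕ.≤-trans x (ℕ.+-monoʳ-≤ s (ℕ.n≤1+n e)))) (Deg-closed (r ℕ.+ d))
          m c c≤m (+ k) (λ i → step A r i (c ℕ.∸ i)) (λ i → step A (suc r) i (c ℕ.∸ i))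
          (λ i i≤c → T-at-∞ c i (step A r i (c ℕ.∸ i)) i≤c) (λ t l → h c t c≤m l) t t≤c

        step-outside : (∀ i j → m ℕ.< i ℕ.+ j → A i j ≈ 𝟘) → ∀ r i j → m ℕ.< i ℕ.+ j → step A r i j ≈ 𝟘
        step-outside h zero i j l = h i j l
        step-outside h (suc r) i j l = lcong (lT _ _) (step-outside h r i j l) ⟫ linear-𝟘 (lT _ _)

        F-at0 : ∀ r → At0 r → Ord 0ℤ m (F m A r)
        F-at0 r h = closed-Σ (Ord-closed 0ℤ m) (suc m) _ (λ { i (s≤s l) →
          resp (Ord-closed 0ℤ m) (≈-sym (tay-0 m (step A r i))) (h i 0 l z≤n) })

        F-at1 : ∀ r → At1 r → Ord 1ℤ m (F m A r)
        F-at1 r h = resp (Ord-closed 1ℤ m) (Σ-swap (suc m) (suc m) (step A r))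
            (closed-Σ (Ord-closed 1ℤ m) (suc m) _ (λ { j (s≤s l) →
          resp (Ord-closed 1ℤ m) (≈-sym (tay-0 m (λ i → step A r i j))) (h j 0 l z≤n) }))

        F-at∞ : (∀ i j → m ℕ.< i ℕ.+ j → A i j ≈ 𝟘) → ∀ d r → At∞ d r → Deg (r ℕ.+ d) m (F m A r)
        F-at∞ out d r h = resp (Deg-closed _ m) (triangle-antidiagonal m (step A r) (step-outside out r))
          (closed-Σ (Deg-closed _ m) (suc m) _ (λ { c (s≤s l) →
            resp (Deg-closed _ m) (≈-sym (tay-0 c (λ i → step A r i (c ℕ.∸ i)))) (h c 0 l z≤n) }))

-- The auxiliary polynomial Φ and its orders

module AuxiliaryPolynomial where
  open Expressions
  open Operators
  open Localisation
  open Derivation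
  open import Data.Integer using (+_; _+_; _*_; -_; _-_; _^_)
  open import Data.Integer.Tactic.RingSolver using (solve-∀)

  iter-scaled : ∀ {O} → Linear O → ∀ c n f → iter (λ g → c · O g) n f ≈ (c ^ n) · iter O n f
  iter-scaled o c zero f = mk λ w s → sym (ℤ.*-identityˡ (tc w s f))
  iter-scaled {O} o c (suc n) f = ·-cong c (lcong o (iter-scaled o c n f) ⟫ lscal o (c ^ n) (iter O n f)) ⟫ ·-· c (c ^ n) _

  tc-Uⁿ : ∀ w n f → tc w 0 (iter U n f) ≡ w ^ n * tc w 0 f
  tc-Uⁿ w zero f = sym (ℤ.*-identityˡ (tc w 0 f))
  tc-Uⁿ w (suc n) f = trans (cong (w *_) (tc-Uⁿ w n f)) (sym (ℤ.*-assoc w (w ^ n) (tc w 0 f)))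

  tc-Vⁿ : ∀ w n f → tc w 0 (iter V n f) ≡ (1ℤ - w) ^ n * tc w 0 f
  tc-Vⁿ w zero f = sym (ℤ.*-identityˡ (tc w 0 f))
  tc-Vⁿ w (suc n) f = trans (cong (λ x → x + -1ℤ * (w * x)) (tc-Vⁿ w n f)) (lem w ((1ℤ - w) ^ n) (tc w 0 f))
    where lem : ∀ w y x → y * x + -1ℤ * (w * (y * x)) ≡ (1ℤ - w) * y * x
          lem = solve-∀

  iter-id : ∀ n f → iter (λ g → g) n f ≡ f
  iter-id zero f = refl
  iter-id (suc n) f = iter-id n f

  module Auxiliary (k : ℕ) (α β : ℤ) where
    open Family k

    Xα Wβ : Poly → Poly
    Xα f = α · iter U k f
    Wβ f = β · iter V k f

    lX : Linear Xα
    lX = l· α (liter k lU)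

    lW : Linear Wβ
    lW = l· β (liter k lV)

    Xⁿ : ∀ i f → iter Xα i f ≈ (α ^ i) · iter U (i ℕ.* k) f
    Xⁿ i f = iter-scaled (liter k lU) α i f ⟫ ·-cong (α ^ i) (≡⇒≈ (iter-mul U k i f))

    Wⁿ : ∀ i f → iter Wβ i f ≈ (β ^ i) · iter V (i ℕ.* k) f
    Wⁿ i f = iter-scaled (liter k lV) β i f ⟫ ·-cong (β ^ i) (≡⇒≈ (iter-mul V k i f))

    mono : ∀ i j f → iter Xα i (iter Wβ j f) ≈ (α ^ i) · ((β ^ j) · iter U (i ℕ.* k) (iter V (j ℕ.* k) f))
    mono i j f = Xⁿ i _ ⟫ ·-cong (α ^ i) (lcong (liter (i ℕ.* k) lU) (Wⁿ j f) ⟫ lscal (liter (i ℕ.* k) lU) (β ^ j) _)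

    θ-mono : ∀ r i j f → iter θ r (iter Xα i (iter Wβ j f)) ≈ iter Xα i (iter Wβ j (iter (Tᵢⱼ i j) r f))
    θ-mono r i j f = lcong (liter r lθ) (mono i j f) ⟫ lscal (liter r lθ) (α ^ i) _
      ⟫ ·-cong (α ^ i) (lscal (liter r lθ) (β ^ j) _ ⟫ ·-cong (β ^ j) (θUV (i ℕ.* k) (j ℕ.* k) r f))
      ⟫ ≈-sym (mono i j _)

    XW-comm : ∀ f → Wβ (Xα f) ≈ Xα (Wβ f)
    XW-comm f = ·-cong β (lscal (liter k lV) α _) ⟫ ·-comm β α _
      ⟫ ·-cong α (·-cong β (≈-sym (iter-iter-comm {U} {V} lU lV UV-comm k k f)) ⟫ ≈-sym (lscal (liter k lU) β _))

    Φ : ℕ → (ℕ → ℕ → Poly) → Poly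
    Φ m A = Σₚ (suc m) (λ i → Σₚ (suc m) (λ j → iter Xα i (iter Wβ j (A i j))))

    module _ (p : ℕ) (pp : Prime p) where
      open Local p pp

      ≅1-^ : ∀ {x} n → x ≅ 1ℤ → x ^ n ≅ 1ℤ
      ≅1-^ n h = ≅-trans (≅-^ n h) (≅-reflexive (ℤ.^-zeroˡ n))

      ΣZ-≅ : ∀ n {f g} → (∀ i → i ℕ.< n → f i ≅ g i) → ΣZ n f ≅ ΣZ n g
      ΣZ-≅ zero h = ≅-refl
      ΣZ-≅ (suc n) h = ≅-+ (ΣZ-≅ n (λ i l → h i (ℕ.m<n⇒m<1+n l))) (h n (ℕ.n<1+n n))

      ΣP-≅ : ∀ w s n {f g} → (∀ i → i ℕ.< n → tc w s (f i) ≅ tc w s (g i)) → tc w s (Σₚ n f) ≅ tc w s (Σₚ n g)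
      ΣP-≅ w s zero h = ≅-refl
      ΣP-≅ w s (suc n) h = ≅-+ (ΣP-≅ w s n (λ i l → h i (ℕ.m<n⇒m<1+n l))) (h n (ℕ.n<1+n n))

      Φ-at-point : ∀ m A {w} → ¬ Z w → ¬ Z (1ℤ - w) → α * w ^ k ≅ 1ℤ → β * (1ℤ - w) ^ k ≅ 1ℤ
        → ∀ M → M ℕ.≤ p → (∀ r → r ℕ.< M → Z (tc w 0 (F m A r))) → Ord w M (Φ m A)
      Φ-at-point m A {w} nw nv αw βv M M≤p h = θ-vanishing nw nv M M≤p (Φ m A) (λ r r<M → ≅-Z (value r) (h r r<M))
        where
        x-val : ∀ i g → tc w 0 (iter Xα i g) ≅ tc w 0 g
        x-val zero g = ≅-refl
        x-val (suc i) g = ≅-trans (≅-reflexive (trans (cong (α *_) (tc-Uⁿ w k (iter Xα i g))) (sym (ℤ.*-assoc α (w ^ k) _))))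
          (≅-trans (≅-* αw (x-val i g)) (≅-reflexive (ℤ.*-identityˡ (tc w 0 g))))
        w-val : ∀ i g → tc w 0 (iter Wβ i g) ≅ tc w 0 g
        w-val zero g = ≅-refl
        w-val (suc i) g = ≅-trans (≅-reflexive (trans (cong (β *_) (tc-Vⁿ w k (iter Wβ i g)))
            (sym (ℤ.*-assoc β ((1ℤ - w) ^ k) _))))
          (≅-trans (≅-* βv (w-val i g)) (≅-reflexive (ℤ.*-identityˡ (tc w 0 g))))
        value : ∀ r → tc w 0 (iter θ r (Φ m A)) ≅ tc w 0 (F m A r)
        value r = ≅-trans (≅-reflexive (at (linear-Σ (liter r lθ) (suc m) _
            ⟫ Σ-cong (suc m) (λ i _ → linear-Σ (liter r lθ) (suc m) _ ⟫ Σ-cong (suc m) (λ j _ → θ-mono r i j (A i j)))) w 0))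
          (ΣP-≅ w 0 (suc m) (λ i _ → ΣP-≅ w 0 (suc m) (λ j _ → ≅-trans (x-val i _) (w-val j _))))

      Ord-Uⁿ : ∀ n {e f} → Ord 0ℤ e f → Ord 0ℤ (n ℕ.+ e) (iter U n f)
      Ord-Uⁿ zero q = q
      Ord-Uⁿ (suc n) q = Ord₀-U (Ord-Uⁿ n q)

      Ord-Vⁿ : ∀ n {e f} → Ord 1ℤ e f → Ord 1ℤ (n ℕ.+ e) (iter V n f)
      Ord-Vⁿ zero q = q
      Ord-Vⁿ (suc n) q = Ord₁-V (Ord-Vⁿ n q)

      Ord-Xα : ∀ {w e f} → Ord w e f → Ord w e (Xα f)
      Ord-Xα {w} {e} q = cscal (Ord-closed w e) α (iter-closed {Ord w e} Ord-U k q)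

      Ord-Wβ : ∀ {w e f} → Ord w e f → Ord w e (Wβ f)
      Ord-Wβ {w} {e} q = cscal (Ord-closed w e) β (iter-closed {Ord w e} Ord-V k q)

      Ord-0 : ∀ w f → Ord w 0 f
      Ord-0 w f = ord λ _ ()

      -- Rows with i ≥ 1 are divisible by uᵏ, and k ≥ m. The row i = 0 is a polynomial in β(1-u)ᵏ,
      -- and β(1-u)ᵏ - 1 vanishes at u = 0 because β = 1, so `gain` applies to it.
      Φ-at-0 : ∀ m A → m ℕ.≤ k → β ≅ 1ℤ → At0 p pp m A 0 → Ord 0ℤ m (Φ m A)
      Φ-at-0 m A m≤k β1 h = resp c (Σ-shift m _) (cadd c
          (resp c (Σ-cong (suc m) (λ j _ → mk λ w s → cong (λ g → tc w s (iter Wβ j g)) (sym (iter-id (m ℕ.∸ j) (A 0 j)))))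
            (gain lW lE lid split (λ _ → ≈-refl) (λ _ → Ord 0ℤ) (λ _ → Ord-closed 0ℤ) (λ _ e → raise e) (λ _ _ q → q) m (A 0)
               (λ t → h 0 t z≤n)))
          (closed-Σ c m _ (λ i _ → closed-Σ c (suc m) _ (λ j _ →
            Ord-weaken (ℕ.≤-trans m≤k (ℕ.≤-reflexive (sym (ℕ.+-identityʳ k))))
                (cscal (Ord-closed 0ℤ (k ℕ.+ 0)) α (Ord-Uⁿ k (Ord-0 0ℤ _)))))))
        where
        c = Ord-closed 0ℤ m
        E : Poly → Poly
        E f = Wβ f ⊕ -1ℤ · f
        lE : Linear E
        lE = l⊕ lW (l· -1ℤ lid)
        split : ∀ f → Wβ f ≈ E f ⊕ f
        split f = mk λ w s → lem (tc w s (Wβ f)) (tc w s f)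
          where lem : ∀ x y → x ≡ (x + -1ℤ * y) + y
                lem = solve-∀
        raise : ∀ e {f} → Ord 0ℤ e f → Ord 0ℤ (suc e) (E f)
        raise e {f} q = Ord-suc (cadd (Ord-closed 0ℤ e) (Ord-Wβ q) (cscal (Ord-closed 0ℤ e) -1ℤ q))
          (≅-Z (≅-+ (≅-* β1 (≅-trans (sym-iter {0ℤ} {e} {V} {1ℤ - 0ℤ} Ord-V sym-V k q)
              (≅-* {u = tc 0ℤ e f} (≅1-^ k ≅-refl) ≅-refl))) ≅-refl)
               (Z-resp (lem (tc 0ℤ e f)) Z-0))
          where lem : ∀ x → 1ℤ * (1ℤ * x) + -1ℤ * x ≡ 0ℤ
                lem = solve-∀

      Φ-at-1 : ∀ m A → m ℕ.≤ k → α ≅ 1ℤ → At1 p pp m A 0 → Ord 1ℤ m (Φ m A)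
      Φ-at-1 m A m≤k α1 h = resp c (Σ-swap (suc m) (suc m) (λ i j → iter Xα i (iter Wβ j (A i j))) ⟫ Σ-shift m _) (cadd c
          (resp c (Σ-cong (suc m) (λ i _ → mk λ w s → cong (λ g → tc w s (iter Xα i g)) (sym (iter-id (m ℕ.∸ i) (A i 0)))))
            (gain lX lE lid split (λ _ → ≈-refl) (λ _ → Ord 1ℤ) (λ _ → Ord-closed 1ℤ) (λ _ e → raise e)
                (λ _ _ q → q) m (λ i → A i 0)
               (λ t → h 0 t z≤n)))
          (closed-Σ c m _ (λ j _ → closed-Σ c (suc m) _ (λ i _ → iter-closed {Ord 1ℤ m} Ord-Xα i
            (Ord-weaken (ℕ.≤-trans m≤k (ℕ.≤-reflexive (sym (ℕ.+-identityʳ k))))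
                (cscal (Ord-closed 1ℤ (k ℕ.+ 0)) β (Ord-Vⁿ k (Ord-0 1ℤ _))))))))
        where
        c = Ord-closed 1ℤ m
        E : Poly → Poly
        E f = Xα f ⊕ -1ℤ · f
        lE : Linear E
        lE = l⊕ lX (l· -1ℤ lid)
        split : ∀ f → Xα f ≈ E f ⊕ f
        split f = mk λ w s → lem (tc w s (Xα f)) (tc w s f)
          where lem : ∀ x y → x ≡ (x + -1ℤ * y) + y
                lem = solve-∀
        raise : ∀ e {f} → Ord 1ℤ e f → Ord 1ℤ (suc e) (E f)
        raise e {f} q = Ord-suc (cadd (Ord-closed 1ℤ e) (Ord-Xα q) (cscal (Ord-closed 1ℤ e) -1ℤ q))
          (≅-Z (≅-+ (≅-* α1 (≅-trans (sym-iter {1ℤ} {e} {U} {1ℤ} Ord-U sym-U k q)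
              (≅-* {u = tc 1ℤ e f} (≅1-^ k ≅-refl) ≅-refl))) ≅-refl)
               (Z-resp (lem (tc 1ℤ e f)) Z-0))
          where lem : ∀ x → 1ℤ * (1ℤ * x) + -1ℤ * x ≡ 0ℤ
                lem = solve-∀

      Deg-iter : ∀ {O : Poly → Poly} → (∀ {d e f} → Deg d e f → Deg (suc d) e (O f)) → ∀ n {d e f} → Deg d e f
          → Deg (n ℕ.+ d) e (iter O n f)
      Deg-iter h zero q = q
      Deg-iter {O} h (suc n) q = h (Deg-iter {O} h n q)

      Deg-Xα : ∀ {d e f} → Deg d e f → Deg (k ℕ.+ d) e (Xα f)
      Deg-Xα {d} {e} q = cscal (Deg-closed (k ℕ.+ d) e) α (Deg-iter {U} Deg-U k q)

      Deg-Wβ : ∀ {d e f} → Deg d e f → Deg (k ℕ.+ d) e (Wβ f)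
      Deg-Wβ {d} {e} q = cscal (Deg-closed (k ℕ.+ d) e) β (Deg-iter {V} Deg-V k q)

      Deg-mul : ∀ {O : Poly → Poly} → (∀ {d e f} → Deg d e f → Deg (k ℕ.+ d) e (O f)) → ∀ n {d e f} → Deg d e f
          → Deg (n ℕ.* k ℕ.+ d) e (iter O n f)
      Deg-mul h zero q = q
      Deg-mul {O} h (suc n) {d} {e} {f} q = subst (λ x → Deg x e (iter O (suc n) f)) (sym (ℕ.+-assoc k (n ℕ.* k) d))
          (h (Deg-mul {O} h n q))

      top-U : ∀ n s f → tc 0ℤ (n ℕ.+ s) (iter U n f) ≡ tc 0ℤ s f
      top-U zero s f = refl
      top-U (suc n) s f = trans (ℤ.+-identityˡ _) (top-U n s f)

      -- The premise says that f has no coefficient beyond index `s` modulo p, so only the term -u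
      -- of each factor 1 - u contributes.
      top-V : ∀ n s {d e f} → Deg d e f → d ℕ.≤ suc s ℕ.+ e → tc 0ℤ (n ℕ.+ s) (iter V n f) ≅ -1ℤ ^ n * tc 0ℤ s f
      top-V zero s {f = f} q l = ≅-reflexive (sym (ℤ.*-identityˡ (tc 0ℤ s f)))
      top-V (suc n) s {d} {e} {f} q l = ≅-trans (≅-+ (Z→≅0 (coeff (Deg-iter {V} Deg-V n q) (suc (n ℕ.+ s)) le))
          (≅-* (≅-refl { -1ℤ}) (≅-+ (≅-refl {0ℤ}) (top-V n s q l))))
          (≅-reflexive (lem (-1ℤ ^ n) (tc 0ℤ s f)))
        where
        lem : ∀ y x → 0ℤ + -1ℤ * (0ℤ + y * x) ≡ (-1ℤ * y) * x
        lem = solve-∀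
        le : n ℕ.+ d ℕ.≤ suc (n ℕ.+ s) ℕ.+ e
        le = ℕ.≤-trans (ℕ.+-monoʳ-≤ n l) (ℕ.≤-reflexive (arith n s e))
          where arith : ∀ n s e → n ℕ.+ (suc s ℕ.+ e) ≡ suc (n ℕ.+ s) ℕ.+ e
                arith = ℕSolver.solve-∀

      Deg-Φ : ∀ m A d → (∀ i j → m ℕ.< i ℕ.+ j → A i j ≈ 𝟘) → (∀ i j → Deg d 0 (A i j)) → Deg (m ℕ.* k ℕ.+ d) 0 (Φ m A)
      Deg-Φ m A d out h = resp c (triangle-antidiagonal m (λ i j → iter Xα i (iter Wβ j (A i j)))
          (λ i j l → lcong (l∘ (liter i lX) (liter j lW)) (out i j l) ⟫ linear-𝟘 (l∘ (liter i lX) (liter j lW))))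
          (closed-Σ c (suc m) _ (λ { c′ (s≤s c≤m) → closed-Σ c (suc c′) _ (λ { i (s≤s i≤c) →
             Deg-weaken (λ s x → ℕ.≤-trans (le i c′ i≤c c≤m) x)
                 (Deg-mul {Xα} Deg-Xα i (Deg-mul {Wβ} Deg-Wβ (c′ ℕ.∸ i) (h i (c′ ℕ.∸ i)))) }) }))
        where
        c = Deg-closed (m ℕ.* k ℕ.+ d) 0
        le : ∀ i c → i ℕ.≤ c → c ℕ.≤ m → i ℕ.* k ℕ.+ ((c ℕ.∸ i) ℕ.* k ℕ.+ d) ℕ.≤ m ℕ.* k ℕ.+ d
        le i c i≤c c≤m = ℕ.≤-trans (ℕ.≤-reflexive (trans (sym (ℕ.+-assoc (i ℕ.* k) ((c ℕ.∸ i) ℕ.* k) d))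
            (cong (ℕ._+ d) (trans (sym (ℕ.*-distribʳ-+ k i (c ℕ.∸ i))) (cong (ℕ._* k) (ℕ.m+[n∸m]≡n i≤c))))))
            (ℕ.+-monoˡ-≤ d (ℕ.*-monoˡ-≤ k c≤m))

      Null-U : ∀ {f} → Null f → Null (U f)
      Null-U h w zero = Z-* w (h w 0)
      Null-U h w (suc s) = Z-+ (Z-* w (h w (suc s))) (h w s)

      Null-closed : Closed Null
      Null-closed = record
        { resp = λ e h w s → Z-resp (at e w s) (h w s)
        ; czero = λ _ _ → Z-0
        ; cadd = λ h k w s → Z-+ (h w s) (k w s)
        ; cscal = λ c h w s → Z-* c (h w s) }

      -- Because α = β(-1)ᵏ, the terms in uᵏ cancel in αuᵏ - β(1-u)ᵏ, which therefore gains one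
      -- order at infinity over either summand. The terms with i + j < m have a degree bound that is
      -- lower by at least k ≥ m.
      Φ-at-∞ : ∀ m A d → m ℕ.≤ k → α ≅ β * -1ℤ ^ k → (∀ i j → m ℕ.< i ℕ.+ j → A i j ≈ 𝟘)
        → (∀ i j → Deg d 0 (A i j)) → At∞ p pp m A d 0 → Deg (m ℕ.* k ℕ.+ d) m (Φ m A)
      Φ-at-∞ m A d m≤k αβ out hd h = resp c (triangle-antidiagonal m (λ i j → iter Xα i (iter Wβ j (A i j)))
          (λ i j l → lcong (l∘ (liter i lX) (liter j lW)) (out i j l) ⟫ linear-𝟘 (l∘ (liter i lX) (liter j lW))))
          (cadd c
            (closed-Σ c m _ (λ c′ c<m → closed-Σ c (suc c′) _ (λ { i (s≤s i≤c) →
               Deg-weaken (λ s x → le i c′ i≤c c<m s x) (Deg-mul {Xα} Deg-Xα i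
                   (Deg-mul {Wβ} Deg-Wβ (c′ ℕ.∸ i) (hd i (c′ ℕ.∸ i)))) })))
            (gain lX lE lW split comm (λ n → Deg (n ℕ.* k ℕ.+ d)) (λ n → Deg-closed (n ℕ.* k ℕ.+ d))
               (λ n e {f} q → subst (λ x → Deg x (suc e) (E f)) (sym (ℕ.+-assoc k (n ℕ.* k) d)) (raise q))
               (λ n e {f} q → subst (λ x → Deg x e (Wβ f)) (sym (ℕ.+-assoc k (n ℕ.* k) d)) (Deg-Wβ q))
               m (λ i → A i (m ℕ.∸ i)) (λ t l → h m t ℕ.≤-refl l)))
        where
        c = Deg-closed (m ℕ.* k ℕ.+ d) m
        le : ∀ i c → i ℕ.≤ c → c ℕ.< m → ∀ s → m ℕ.* k ℕ.+ d ℕ.≤ s ℕ.+ m → i ℕ.* k ℕ.+ ((c ℕ.∸ i) ℕ.* k ℕ.+ d) ℕ.≤ s ℕ.+ 0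
        le i c i≤c c<m s x = ℕ.+-cancelʳ-≤ m _ _ (ℕ.≤-trans
            (ℕ.≤-reflexive (cong (ℕ._+ m) (trans (sym (ℕ.+-assoc (i ℕ.* k) ((c ℕ.∸ i) ℕ.* k) d))
            (cong (ℕ._+ d) (trans (sym (ℕ.*-distribʳ-+ k i (c ℕ.∸ i))) (cong (ℕ._* k) (ℕ.m+[n∸m]≡n i≤c)))))))
            (ℕ.≤-trans (ℕ.+-monoʳ-≤ (c ℕ.* k ℕ.+ d) m≤k)
              (ℕ.≤-trans (ℕ.≤-reflexive (arith (c ℕ.* k) d k))
                (ℕ.≤-trans (ℕ.+-monoˡ-≤ d (ℕ.*-monoˡ-≤ k c<m))
                    (ℕ.≤-trans x (ℕ.≤-reflexive (cong (ℕ._+ m) (sym (ℕ.+-identityʳ s)))))))))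
          where arith : ∀ a b c → a ℕ.+ b ℕ.+ c ≡ c ℕ.+ a ℕ.+ b
                arith = ℕSolver.solve-∀
        E : Poly → Poly
        E f = Xα f ⊕ -1ℤ · Wβ f
        lE : Linear E
        lE = l⊕ lX (l· -1ℤ lW)
        split : ∀ f → Xα f ≈ E f ⊕ Wβ f
        split f = mk λ w s → lem (tc w s (Xα f)) (tc w s (Wβ f))
          where lem : ∀ x y → x ≡ (x + -1ℤ * y) + y
                lem = solve-∀
        comm : ∀ f → Wβ (E f) ≈ E (Wβ f)
        comm f = ladd lW _ _ ⟫ ⊕-cong (XW-comm f) (lscal lW -1ℤ (Wβ f))
        raise : ∀ {d e f} → Deg d e f → Deg (k ℕ.+ d) (suc e) (E f)
        raise {d} {e} {f} q = deg go
          where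
          go : ∀ s → k ℕ.+ d ℕ.≤ s ℕ.+ suc e → Z (tc 0ℤ s (E f))
          go s l with k ℕ.≤? s
          ... | yes k≤s = subst (λ x → Z (tc 0ℤ x (E f))) (ℕ.m+[n∸m]≡n k≤s)
              (≅-Z (≅-+ (≅-* αβ (≅-reflexive (top-U k s′ f))) (≅-* (≅-refl { -1ℤ}) (≅-* (≅-refl {β}) (top-V k s′ q le′))))
                (Z-resp (lem β (-1ℤ ^ k) (tc 0ℤ s′ f)) Z-0))
            where
            s′ = s ℕ.∸ k
            lem : ∀ b c x → b * c * x + -1ℤ * (b * (c * x)) ≡ 0ℤ
            lem = solve-∀
            le′ : d ℕ.≤ suc s′ ℕ.+ e
            le′ = ℕ.+-cancelˡ-≤ k _ _ (ℕ.≤-trans l (ℕ.≤-reflexive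
                (trans (cong (ℕ._+ suc e) (sym (ℕ.m+[n∸m]≡n k≤s))) (arith k s′ e))))
              where arith : ∀ k s e → k ℕ.+ s ℕ.+ suc e ≡ k ℕ.+ (suc s ℕ.+ e)
                    arith = ℕSolver.solve-∀
          -- For s < k the premise forces d ≤ e, which makes all coefficients of f vanish.
          ... | no k≰s = cadd Null-closed {Xα f} { -1ℤ · Wβ f} (cscal Null-closed α {iter U k f} (iter-closed {Null} {U} (λ {g} → Null-U {g}) k {f} nf))
                           (cscal Null-closed -1ℤ {Wβ f} (cscal Null-closed β {iter V k f}
                             (iter-closed {Null} {V} (λ {g} → V-closed Null-closed (λ {g} → Null-U {g}) {g}) k {f} nf))) 0ℤ s
            where
            d≤e : d ℕ.≤ e
            d≤e = ℕ.+-cancelˡ-≤ k _ _ (ℕ.≤-trans l (ℕ.≤-trans (ℕ.≤-reflexive (ℕ.+-suc s e)) (ℕ.+-monoˡ-≤ e (ℕ.≰⇒> k≰s))))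
            nf : Null f
            nf = null-coeffs f (λ s → coeff q s (ℕ.≤-trans d≤e (ℕ.m≤n+m e s)))

-- Why Φ is not zero

module NonVanishing where
  open Expressions
  open Operators
  open Localisation
  open Derivation
  open AuxiliaryPolynomial
  open import Data.Integer using (+_; _+_; _*_; -_; _-_; _^_)
  open import Data.Integer.Tactic.RingSolver using (solve-∀)

  sumL : ∀ {I : Set} → (I → ℤ) → List I → ℤ
  sumL f [] = 0ℤ
  sumL f (x ∷ xs) = f x + sumL f xs

  sumL-++ : ∀ {I : Set} (f : I → ℤ) xs ys → sumL f (xs ++ ys) ≡ sumL f xs + sumL f ys
  sumL-++ f [] ys = sym (ℤ.+-identityˡ _)
  sumL-++ f (x ∷ xs) ys = trans (cong (λ y → f x + y) (sumL-++ f xs ys)) (sym (ℤ.+-assoc (f x) (sumL f xs) (sumL f ys)))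

  row : ℕ → ℕ → List (ℕ × ℕ)
  row i zero = []
  row i (suc n) = (i , n) ∷ row i n

  rows : ℕ → ℕ → List (ℕ × ℕ)
  rows m zero = []
  rows m (suc n) = row n (suc m ℕ.∸ n) ++ rows m n

  -- The pairs (i , t) with i + t ≤ m.
  triangle : ℕ → List (ℕ × ℕ)
  triangle m = rows m (suc m)

  private
    -- The order in which the triangle is listed, decreasing; distinctness of the nodes then has to
    -- be shown for one order of each two pairs only.
    Below : ℕ × ℕ → ℕ × ℕ → Set
    Below (i , t) (i′ , t′) = (i′ ℕ.< i) ⊎ (i′ ≡ i × t′ ℕ.< t)

    row-All : ∀ {P : ℕ × ℕ → Set} i n → (∀ t → t ℕ.< n → P (i , t)) → All P (row i n)
    row-All i zero h = []
    row-All i (suc n) h = h n (ℕ.n<1+n n) ∷ row-All i n (λ t l → h t (ℕ.m<n⇒m<1+n l))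

    rows-All : ∀ {P : ℕ × ℕ → Set} m n → (∀ i t → i ℕ.< n → t ℕ.< suc m ℕ.∸ i → P (i , t)) → All P (rows m n)
    rows-All m zero h = []
    rows-All m (suc n) h = All.++⁺ (row-All n _ (λ t → h n t (ℕ.n<1+n n))) (rows-All m n (λ i t l → h i t (ℕ.m<n⇒m<1+n l)))

    row-pairs : ∀ i n → AllPairs Below (row i n)
    row-pairs i zero = []
    row-pairs i (suc n) = row-All i n (λ t l → inj₂ (refl , l)) ∷ row-pairs i n

    rows-pairs : ∀ m n → AllPairs Below (rows m n)
    rows-pairs m zero = []
    rows-pairs m (suc n) = AllPairs.++⁺ (row-pairs n _) (rows-pairs m n)
      (row-All n _ (λ t _ → rows-All m n (λ i t′ l _ → inj₁ l)))

    row-∈ : ∀ i n t → t ℕ.< n → (i , t) ∈ row i n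
    row-∈ i (suc n) t (s≤s l) with ℕ.m≤n⇒m<n∨m≡n l
    ... | inj₁ t<n = there (row-∈ i n t t<n)
    ... | inj₂ refl = here refl

    rows-∈ : ∀ m n i t → i ℕ.< n → t ℕ.< suc m ℕ.∸ i → (i , t) ∈ rows m n
    rows-∈ m (suc n) i t (s≤s l) t< with ℕ.m≤n⇒m<n∨m≡n l
    ... | inj₁ i<n = ∈-++⁺ʳ (row n (suc m ℕ.∸ n)) (rows-∈ m n i t i<n t<)
    ... | inj₂ refl = ∈-++⁺ˡ (row-∈ n _ t t<)

    AllPairs-refine : ∀ {A : Set} {P : A → Set} {R Q : A → A → Set} → (∀ {x y} → P x → P y → R x y → Q x y)
      → ∀ {xs} → All P xs → AllPairs R xs → AllPairs Q xs
    AllPairs-refine h [] [] = []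
    AllPairs-refine h (p ∷ ps) (r ∷ rs) = All.map (λ (p′ , r′) → h p p′ r′) (All.zip (ps , r)) ∷ AllPairs-refine h ps rs

  module Nonvanishing (p : ℕ) (pp : Prime p) (k : ℕ) (α β : ℤ) where
    open Local p pp
    open Family k
    open Auxiliary k α β

    -- Elimination without division: `X x` times the r-th equation minus the next one removes the
    -- head x and multiplies every other weight by `X x - X a`, which is invertible modulo p.
    Vandermonde : ∀ {I : Set} (X G : I → ℤ) xs → AllPairs (λ a b → ¬ Z (X a - X b)) xs
      → (∀ r → r ℕ.< length xs → Z (sumL (λ a → G a * X a ^ r) xs)) → All (λ a → Z (G a)) xs

    private
      deflate : ∀ {I : Set} (X G : I → ℤ) x r xs →
        sumL (λ a → (G a * (X x - X a)) * X a ^ r) xs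
          ≡ X x * sumL (λ a → G a * X a ^ r) xs - sumL (λ a → G a * X a ^ suc r) xs
      deflate X G x r [] = lem (X x)
        where lem : ∀ x → 0ℤ ≡ x * 0ℤ - 0ℤ
              lem = solve-∀
      deflate X G x r (a ∷ xs) = trans (cong (λ y → (G a * (X x - X a)) * X a ^ r + y) (deflate X G x r xs))
          (lem (G a) (X x) (X a) (X a ^ r) (sumL (λ a → G a * X a ^ r) xs) (sumL (λ a → G a * X a ^ suc r) xs))
        where lem : ∀ g x a y s t → (g * (x - a)) * y + (x * s - t) ≡ x * (g * y + s) - (g * (a * y) + t)
              lem = solve-∀

      deflate-∷ : ∀ {I : Set} (X G : I → ℤ) x r xs →
        sumL (λ a → (G a * (X x - X a)) * X a ^ r) xs
          ≡ X x * sumL (λ a → G a * X a ^ r) (x ∷ xs) - sumL (λ a → G a * X a ^ suc r) (x ∷ xs)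
      deflate-∷ X G x r xs = trans (deflate X G x r xs) (lem (G x) (X x) (X x ^ r) (sumL (λ a → G a * X a ^ r) xs)
          (sumL (λ a → G a * X a ^ suc r) xs))
        where lem : ∀ g x y s t → x * s - t ≡ x * (g * y + s) - (g * (x * y) + t)
              lem = solve-∀

      head-zero : ∀ {I : Set} (X G : I → ℤ) x xs → Z (sumL (λ a → G a * X a ^ 0) (x ∷ xs)) → All (λ a → Z (G a)) xs → Z (G x)
      head-zero X G x xs h all = Z-resp (lem (G x) (sumL (λ a → G a * X a ^ 0) xs)) (Z-- h (tail xs all))
        where
        lem : ∀ g s → g ≡ (g * 1ℤ + s) - s
        lem = solve-∀
        tail : ∀ xs → All (λ a → Z (G a)) xs → Z (sumL (λ a → G a * X a ^ 0) xs)
        tail [] [] = Z-0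
        tail (a ∷ xs) (z ∷ zs) = Z-+ (Z-*ʳ (X a ^ 0) z) (tail xs zs)

      uncancel : ∀ {I : Set} (X G : I → ℤ) x {xs} → All (λ b → ¬ Z (X x - X b)) xs
        → All (λ a → Z (G a * (X x - X a))) xs → All (λ a → Z (G a)) xs
      uncancel X G x ap zs = All.map (λ {a} (ne , z) → Z-cancel (X x - X a) ne
          (Z-resp (ℤ.*-comm (X x - X a) (G a)) z)) (All.zip (ap , zs))

    Vandermonde X G [] ap h = []
    Vandermonde X G (x ∷ xs) (a ∷ ap) h = head-zero X G x xs (h 0 (s≤s z≤n)) rest ∷ rest
      where
      rest : All (λ a → Z (G a)) xs
      rest = uncancel X G x a (Vandermonde X (λ a → G a * (X x - X a)) xs ap (λ r r< →
        Z-resp (deflate-∷ X G x r xs) (Z-- (Z-* (X x) (h r (ℕ.m<n⇒m<1+n r<))) (h (suc r) (s≤s r<)))))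

    -- The sums Σ Tʳ A i j give M equations for M + 1 weights. The missing equation is the vanishing
    -- of one weight, which Φ = 0 supplies.
    Vandermonde′ : ∀ {I : Set} (X G : I → ℤ) xs → AllPairs (λ a b → ¬ Z (X a - X b)) xs → ∀ y → y ∈ xs → Z (G y)
      → (∀ r → suc r ℕ.< length xs → Z (sumL (λ a → G a * X a ^ r) xs)) → All (λ a → Z (G a)) xs
    Vandermonde′ X G (x ∷ xs) (a ∷ ap) _ (here refl) z h = z ∷ Vandermonde X G xs ap (λ r r< →
        Z-resp (lem (G x * X x ^ r) (sumL (λ a → G a * X a ^ r) xs)) (Z-- (h r (s≤s r<)) (Z-*ʳ (X x ^ r) z)))
      where lem : ∀ g s → s ≡ (g + s) - g
            lem = solve-∀
    Vandermonde′ X G (x ∷ x′ ∷ xs) (a ∷ ap) y (there y∈) z h = head-zero X G x (x′ ∷ xs) (h 0 (s≤s (s≤s z≤n))) rest ∷ rest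
      where
      rest : All (λ a → Z (G a)) (x′ ∷ xs)
      rest = uncancel X G x a (Vandermonde′ X (λ a → G a * (X x - X a)) (x′ ∷ xs) ap y y∈ (Z-*ʳ (X x - X y) z) (λ r r< →
        Z-resp (deflate-∷ X G x r (x′ ∷ xs)) (Z-- (Z-* (X x) (h r (ℕ.m<n⇒m<1+n r<))) (h (suc r) (s≤s r<)))))

    tay-top : ∀ m B → Null (tay (suc m) B (suc m)) → Null (B (suc m))
    tay-top m B h w s = Z-resp (trans (lem (tc w s (B (suc m)))) (sym (cong₂ (λ x c → x + + c * tc w s (B (suc m)))
        (at (tay-high m B (suc m) (ℕ.n<1+n m)) w s) (nCn≡1 (suc m))))) (h w s)
      where lem : ∀ x → x ≡ 0ℤ + 1ℤ * x
            lem = solve-∀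

    -- The matrix of the numbers `j C t` is triangular with 1 on the diagonal: the last equation
    -- gives the last `B`, which is then removed from the others.
    tay-injective : ∀ m B → (∀ t → t ℕ.≤ m → Null (tay m B t)) → ∀ j → j ℕ.≤ m → Null (B j)
    tay-injective zero B h zero z≤n w s = Z-resp (lem (tc w s (B 0))) (h 0 z≤n w s)
      where lem : ∀ x → x ≡ 0ℤ + 1ℤ * x
            lem = solve-∀
    tay-injective (suc m) B h j j≤ with ℕ.m≤n⇒m<n∨m≡n j≤
    ... | inj₂ refl = tay-top m B (h (suc m) ℕ.≤-refl)
    ... | inj₁ (s≤s j≤m) = tay-injective m B (λ t l w s →
            Z-resp (lem (tc w s (tay m B t)) (+ (suc m C t)) (tc w s (B (suc m))))
              (Z-- (h t (ℕ.m≤n⇒m≤1+n l) w s) (Z-* (+ (suc m C t)) (tay-top m B (h (suc m) ℕ.≤-refl) w s)))) j j≤m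
      where
      lem : ∀ x c y → x ≡ (x + c * y) - c * y
      lem = solve-∀

    V-injective : ∀ f → Null (V f) → Null f
    V-injective f h = null-coeffs f go
      where
      go : ∀ s → Z (tc 0ℤ s f)
      go zero = Z-resp (lem (tc 0ℤ 0 f)) (h 0ℤ 0)
        where lem : ∀ x → x ≡ x + -1ℤ * (0ℤ * x)
              lem = solve-∀
      go (suc s) = Z-resp (lem (tc 0ℤ (suc s) f) (tc 0ℤ s f)) (Z-+ (h 0ℤ (suc s)) (go s))
        where lem : ∀ x y → x ≡ (x + -1ℤ * (0ℤ * x + y)) + y
              lem = solve-∀

    Vⁿ-injective : ∀ n f → Null (iter V n f) → Null f
    Vⁿ-injective zero f h = h
    Vⁿ-injective (suc n) f h = Vⁿ-injective n f (V-injective (iter V n f) h)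

    W : Poly → Poly
    W = iter V k

    lW′ : Linear W
    lW′ = liter k lV

    module _ (m : ℕ) (A : ℕ → ℕ → Poly) (out : ∀ i j → m ℕ.< i ℕ.+ j → A i j ≈ 𝟘) where

      -- Taylor coefficients at y = 1 of Σ yʲ (1-u)^(jk) A i j. In these both data can be expressed:
      -- Φ takes y = β, while the sums Σ Tʳ A i j take y = (1-u)^(-k), for which y - 1 has order at
      -- least 1 at u = 0. This is the origin of uᵗ in `G`.
      C̃ G : ℕ → ℕ → Poly
      C̃ i t = tay m (λ j → iter W j (A i j)) t
      G i t = iter U t (C̃ i t)

      -- 1 - (1-u)^k = u K
      K : Poly → Poly
      K f = Σₚ k (λ a → iter V a f)

      lK : Linear K
      lK = lΣ k (λ a → liter a lV)

      UK-comm : ∀ f → U (K f) ≈ K (U f)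
      UK-comm f = linear-Σ lU k _ ⟫ Σ-cong k (λ a _ → ≈-sym (iter-comm {V} {U} lV (λ f → ≈-sym (UV-comm f)) a f))

      E : Poly → Poly
      E f = f ⊕ -1ℤ · W f

      E-KU : ∀ f → E f ≈ K (U f)
      E-KU f = go k
        where
        go : ∀ n → f ⊕ -1ℤ · iter V n f ≈ Σₚ n (λ a → iter V a (U f))
        go zero = mk λ w s → lem (tc w s f)
          where lem : ∀ x → x + -1ℤ * x ≡ 0ℤ
                lem = solve-∀
        go (suc n) = (mk λ w s → lem (tc w s f) (tc w s (iter V n f)) (tc w s (U (iter V n f))))
            ⟫ ⊕-cong (go n) (≈-sym (iter-comm {V} {U} lV (λ f → ≈-sym (UV-comm f)) n f))
          where lem : ∀ f g u → f + -1ℤ * (g + -1ℤ * u) ≡ (f + -1ℤ * g) + u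
                lem = solve-∀

      lE : Linear E
      lE = l⊕ lid (l· -1ℤ lW′)

      Eⁿ : ∀ t f → iter E t f ≈ iter K t (iter U t f)
      Eⁿ zero f = ≈-refl
      Eⁿ (suc t) f = lcong lE (Eⁿ t f) ⟫ E-KU _ ⟫ lcong lK (≈-sym (iter-comm {K} {U} lK (λ g → ≈-sym (UK-comm g)) t (iter U t f)))

      -- The factor (1-u)^(jk) turns `Tᵢⱼ i j` into `S` with exponent ik, one operator for all j.
      -- Multiplication by Wᵐ makes the row homogeneous in 1 and W, so it can be expanded by 1 = (1
      -- - W) + W with 1 - W = uK. Moving uᵗ past `S` lowers the exponent to ik - t.
      expand-row : ∀ r i → iter W m (Σₚ (suc m) (λ j → step A r i j))
        ≈ Σₚ (suc m) (λ t → iter K t (iter W (m ℕ.∸ t) (iter (S (+ (i ℕ.* k) - + t)) r (G i t))))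
      expand-row r i = linear-Σ (liter m lW′) (suc m) _
        ⟫ Σ-cong (suc m) (λ { j (s≤s l) → split-power j l })
        ⟫ Binomial.expand lid lE lW′ sp cm m (λ j → iter (S c) r (iter W j (A i j)))
        ⟫ Σ-cong (suc m) (λ { t (s≤s l) → lcong (l∘ (liter t lE) (liter (m ℕ.∸ t) lW′))
            (≈-sym (tay-linear (liter r (lS c)) m _ t))
             ⟫ Eⁿ t _
             ⟫ lcong (liter t lK) (iter-iter-comm {U} {W} lU lW′
                 (λ f → ≈-sym (iter-comm {V} {U} lV (λ f → ≈-sym (UV-comm f)) k f)) t (m ℕ.∸ t) _
                 ⟫ lcong (liter (m ℕ.∸ t) lW′) (UⁿSʳ t c r (C̃ i t))) })
        where
        c = + (i ℕ.* k)
        sp : ∀ f → f ≈ E f ⊕ W f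
        sp f = mk λ w s → lem (tc w s f) (tc w s (W f))
          where lem : ∀ x y → x ≡ (x + -1ℤ * y) + y
                lem = solve-∀
        cm : ∀ f → W (E f) ≈ E (W f)
        cm f = ladd lW′ _ _ ⟫ ⊕-cong ≈-refl (lscal lW′ -1ℤ (W f))
        split-power : ∀ j → j ℕ.≤ m → iter W m (step A r i j) ≈ iter (λ f → f) j
            (iter W (m ℕ.∸ j) (iter (S c) r (iter W j (A i j))))
        split-power j l = (≡⇒≈ (trans (cong (λ x → iter W x (step A r i j)) (sym (ℕ.m∸n+n≡m l)))
            (iter-+ W (m ℕ.∸ j) j (step A r i j))))
          ⟫ lcong (liter (m ℕ.∸ j) lW′) ((≡⇒≈ (iter-mul V k j (step A r i j))) ⟫ VⁿTʳ (i ℕ.* k) (j ℕ.* k) r (A i j)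
              ⟫ lcong (liter r (lS c)) (≡⇒≈ (sym (iter-mul V k j (A i j)))))
          ⟫ ≡⇒≈ (sym (iter-id j _))

      outside : ∀ i t → m ℕ.< i ℕ.+ t → C̃ i t ≈ 𝟘
      outside i t l = tay-vanish m _ t (λ j t≤j →
        lcong (liter j lW′) (out i j (ℕ.<-≤-trans l (ℕ.+-monoʳ-≤ i t≤j))) ⟫ linear-𝟘 (liter j lW′))

      lead-S : ∀ {μ f} c → Ord 0ℤ μ f → Ord 0ℤ μ (S c f) × (tc 0ℤ μ (S c f) ≅ (+ μ + c) * tc 0ℤ μ f)
      lead-S {μ} {f} c q = cadd (Ord-closed 0ℤ μ) (Ord₀-θ q) (cscal (Ord-closed 0ℤ μ) c (Ord-V q))
          , ≅-trans (≅-+ (lead-θ μ q) (≅-* (≅-refl {c}) (sym-V q))) (≅-reflexive (lem (+ μ) c (tc 0ℤ μ f)))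
        where
        lem : ∀ μ c x → μ * x + c * ((1ℤ - 0ℤ) * x) ≡ (μ + c) * x
        lem = solve-∀
        lead-θ : ∀ μ {f} → Ord 0ℤ μ f → tc 0ℤ μ (θ f) ≅ + μ * tc 0ℤ μ f
        lead-θ zero q = ≅-refl
        lead-θ (suc e) {f} q = ≅-trans (≅-reflexive (ℤ.+-identityˡ (tc 0ℤ e (V (D f)))))
            (≅-trans (sym-V (Ord-D q)) (≅-reflexive (ℤ.*-identityˡ (+ suc e * tc 0ℤ (suc e) f))))

      lead-K : ∀ {μ f} → Ord 0ℤ μ f → tc 0ℤ μ (K f) ≅ + k * tc 0ℤ μ f
      lead-K {μ} {f} q = go k
        where
        go : ∀ n → tc 0ℤ μ (Σₚ n (λ a → iter V a f)) ≅ + n * tc 0ℤ μ f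
        go zero = ≅-refl
        go (suc n) = ≅-trans (≅-+ (go n) (≅-trans (sym-iter {0ℤ} {μ} {V} {1ℤ - 0ℤ} Ord-V sym-V n q)
            (≅-* {u = tc 0ℤ μ f} (≅1-^ p pp n ≅-refl) ≅-refl)))
            (≅-reflexive (lem (+ n) (tc 0ℤ μ f)))
          where lem : ∀ n x → n * x + 1ℤ * x ≡ (1ℤ + n) * x
                lem = solve-∀

      Ord-K : ∀ {μ f} → Ord 0ℤ μ f → Ord 0ℤ μ (K f)
      Ord-K {μ} q = closed-Σ (Ord-closed 0ℤ μ) k _ (λ a _ → iter-closed {Ord 0ℤ μ} Ord-V a q)

      lead-term : ∀ μ t e c r f → Ord 0ℤ μ f →
        tc 0ℤ μ (iter K t (iter W e (iter (S c) r f))) ≅ ((+ k) ^ t * tc 0ℤ μ f) * (+ μ + c) ^ r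
      lead-term μ t e c r f q =
        ≅-trans (sym-iter {0ℤ} {μ} {K} {+ k} Ord-K lead-K t (iter-closed {Ord 0ℤ μ} Ord-W e oS))
        (≅-trans (≅-* (≅-refl {(+ k) ^ t}) (≅-trans (sym-iter {0ℤ} {μ} {W} {(1ℤ - 0ℤ) ^ k} Ord-W
            (sym-iter {0ℤ} {μ} {V} {1ℤ - 0ℤ} Ord-V sym-V k) e oS)
            (≅-* {u = tc 0ℤ μ (iter (S c) r f)} (≅1-^ p pp e (≅1-^ p pp k ≅-refl))
                (sym-iter {0ℤ} {μ} {S c} {+ μ + c} (λ h → proj₁ (lead-S c h)) (λ h → proj₂ (lead-S c h)) r q))))
          (≅-reflexive (lem ((+ k) ^ t) ((+ μ + c) ^ r) (tc 0ℤ μ f))))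
        where
        Ord-W : ∀ {f} → Ord 0ℤ μ f → Ord 0ℤ μ (W f)
        Ord-W = iter-closed {Ord 0ℤ μ} Ord-V k
        oS = iter-closed {Ord 0ℤ μ} {S c} (λ h → proj₁ (lead-S c h)) r q
        lem : ∀ a b x → a * (1ℤ * (b * x)) ≡ (a * x) * b
        lem = solve-∀

      -- The factor by which `S` with exponent ik - t acts on a leading coefficient of order μ. Its
      -- r-th iterate acts by the r-th power, whence the Vandermonde system; the factors K and W act
      -- by k and 1.
      node : ℕ → ℕ × ℕ → ℤ
      node μ (i , t) = + μ + (+ (i ℕ.* k) - + t)

      weight : ℕ → ℕ × ℕ → ℤ
      weight μ (i , t) = (+ k) ^ t * tc 0ℤ μ (G i t)

      OrdG : ℕ → Set
      OrdG μ = ∀ i t → i ℕ.≤ m → t ℕ.≤ m → Ord 0ℤ μ (G i t)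

      moments : ∀ μ → OrdG μ → ∀ r → Null (F m A r) → Z (sumL (λ a → weight μ a * node μ a ^ r) (triangle m))
      moments μ oG r nF = ≅-Z (≅-sym box) (closed-W m)
        where
        val : ℕ × ℕ → ℤ
        val a = weight μ a * node μ a ^ r
        closed-W : ∀ n → Z (tc 0ℤ μ (iter W n (F m A r)))
        closed-W n = iter-closed {Null} {W} (λ {f} h → iter-closed {Null} {V}
            (λ {g} → V-closed (Null-closed p pp) (λ {g} → Null-U p pp {g}) {g}) k {f} h) n {F m A r} nF 0ℤ μ
        row-sum : ∀ i n → sumL val (row i n) ≡ ΣZ n (λ t → val (i , t))
        row-sum i zero = refl
        row-sum i (suc n) = trans (cong (λ x → val (i , n) + x) (row-sum i n)) (ℤ.+-comm (val (i , n)) _)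
        rows-sum : ∀ n → sumL val (rows m n) ≡ ΣZ n (λ i → ΣZ (suc m ℕ.∸ i) (λ t → val (i , t)))
        rows-sum zero = refl
        rows-sum (suc n) = trans (sumL-++ val (row n (suc m ℕ.∸ n)) (rows m n))
          (trans (cong₂ _+_ (row-sum n (suc m ℕ.∸ n)) (rows-sum n)) (ℤ.+-comm (ΣZ (suc m ℕ.∸ n) (λ t → val (n , t))) _))
        trunc : ∀ a n f → (∀ j → a ℕ.≤ j → j ℕ.< n → Z (f j)) → a ℕ.≤ n → ΣZ n f ≅ ΣZ a f
        trunc a n f h l with ℕ.m≤n⇒m<n∨m≡n l
        ... | inj₂ refl = ≅-refl
        trunc a (suc n) f h l | inj₁ (s≤s a≤n) = ≅-trans (≅-+ (trunc a n f (λ j x y → h j x (ℕ.m<n⇒m<1+n y)) a≤n)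
            (Z→≅0 (h n a≤n (ℕ.n<1+n n)))) (≅-reflexive (ℤ.+-identityʳ _))
        outside-val : ∀ i t → m ℕ.< i ℕ.+ t → Z (val (i , t))
        outside-val i t l = Z-*ʳ (node μ (i , t) ^ r) (Z-* ((+ k) ^ t)
            (Z-resp (at (lcong (liter t lU) (outside i t l) ⟫ linear-𝟘 (liter t lU)) 0ℤ μ) Z-0))
        box : tc 0ℤ μ (iter W m (F m A r)) ≅ sumL val (triangle m)
        box = ≅-trans (≅-reflexive (trans (at (linear-Σ (liter m lW′) (suc m) _
            ⟫ Σ-cong (suc m) (λ i _ → expand-row r i)) 0ℤ μ) (tc-Σ 0ℤ μ (suc m) _)))
          (≅-trans (ΣZ-≅ p pp (suc m) (λ { i (s≤s i≤m) →
              ≅-trans (≅-reflexive (tc-Σ 0ℤ μ (suc m) _))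
              (≅-trans (ΣZ-≅ p pp (suc m) (λ { t (s≤s t≤m) → lead-term μ t (m ℕ.∸ t) (+ (i ℕ.* k) - + t) r (G i t)
                  (oG i t i≤m t≤m) }))
                (trunc (suc m ℕ.∸ i) (suc m) (λ t → val (i , t))
                    (λ t x y → outside-val i t (ℕ.≤-trans (ℕ.m≤n+m∸n (suc m) i) (ℕ.+-monoʳ-≤ i x))) (ℕ.m∸n≤m (suc m) i))) }))
            (≅-reflexive (sym (rows-sum (suc m)))))

      expand-Φ : Φ m A ≈ Σₚ (suc m) (λ i → Σₚ (suc m) (λ t → iter Xα i (((β - 1ℤ) ^ t) · C̃ i t)))
      expand-Φ = Σ-cong (suc m) (λ i _ → ≈-sym (linear-Σ (liter i lX) (suc m) _)
          ⟫ lcong (liter i lX) (Σ-cong (suc m) (λ j _ → Wⁿ j (A i j)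
               ⟫ ·-cong (β ^ j) (≡⇒≈ (sym (iter-mul V k j (A i j))))
               ⟫ ≈-sym (iter-scaled lid β j _ ⟫ ·-cong (β ^ j)
                   (lcong lid (≡⇒≈ (trans (iter-id j _) (iter-id (m ℕ.∸ j) (iter W j (A i j))))))))
             ⟫ Binomial.expand (l· β lid) (l· (β - 1ℤ) lid) lid sp (λ _ → ≈-refl) m (λ j → iter W j (A i j))
             ⟫ Σ-cong (suc m) (λ t _ → iter-scaled lid (β - 1ℤ) t _
                 ⟫ ·-cong ((β - 1ℤ) ^ t) (≡⇒≈ (trans (iter-id t _) (iter-id (m ℕ.∸ t) _)))))
          ⟫ linear-Σ (liter i lX) (suc m) _)
        where
        sp : ∀ f → β · f ≈ (β - 1ℤ) · f ⊕ f
        sp f = mk λ w s → lem β (tc w s f)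
          where lem : ∀ b x → b * x ≡ (b - 1ℤ) * x + x
                lem = solve-∀

      Z-^ : ∀ {x} n → Z x → Z (x ^ suc n)
      Z-^ {x} n z = Z-*ʳ (x ^ n) z

      Z-^-cancel : ∀ x n {y} → ¬ Z x → Z (x ^ n * y) → Z y
      Z-^-cancel x zero {y} nx z = Z-resp (sym (ℤ.*-identityˡ y)) z
      Z-^-cancel x (suc n) {y} nx z = Z-^-cancel x n nx (Z-cancel x nx (Z-resp (sym (ℤ.*-assoc x (x ^ n) y)) z))

      raise-U : ∀ n {μ f} → Ord 0ℤ μ f → 1 ℕ.≤ n → Z (tc 0ℤ μ (iter U n f))
      raise-U (suc n) {μ} q _ = taylor (Ord-Uⁿ p pp (suc n) q) μ (s≤s (ℕ.m≤n+m μ n))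

      -- For β = 1 only the terms with t = 0 survive in the expansion of Φ in powers of β - 1, and
      -- those with i ≥ 1 carry a factor uᵏ that lifts them beyond order μ. So `C̃ 0 0` stands
      -- alone.
      special-gain : 1 ℕ.≤ k → Z (β - 1ℤ) → Null (Φ m A) → ∀ μ → OrdG μ → Z (tc 0ℤ μ (G 0 0))
      special-gain 1≤k zβ nΦ μ oG = Z-resp (sym (ℤ.*-identityˡ (tc 0ℤ μ (C̃ 0 0))))
        (isolate 0ℤ μ (suc m) (λ t → iter Xα 0 (((β - 1ℤ) ^ t) · C̃ 0 t)) 0 (s≤s z≤n) (λ t _ t≢0 → high 0 t t≢0)
          (isolate 0ℤ μ (suc m) _ 0 (s≤s z≤n) (λ { i (s≤s l) i≢0 → rows0 i l i≢0 }) (Z-resp (sym (at expand-Φ 0ℤ μ)) (nΦ 0ℤ μ))))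
        where
        high : ∀ i t → t ≢ 0 → Z (tc 0ℤ μ (iter Xα i (((β - 1ℤ) ^ t) · C̃ i t)))
        high i zero h = ⊥-elim (h refl)
        high i (suc t) h = Z-resp (at (lscal (liter i lX) ((β - 1ℤ) ^ suc t) (C̃ i (suc t))) 0ℤ μ)
            (Z-*ʳ (tc 0ℤ μ (iter Xα i (C̃ i (suc t)))) (Z-^ t zβ))
        low : ∀ i → i ℕ.≤ m → i ≢ 0 → Z (tc 0ℤ μ (iter Xα i (1ℤ · C̃ i 0)))
        low zero _ h = ⊥-elim (h refl)
        low (suc i) l h = Z-* α (raise-U k (iter-closed {Ord 0ℤ μ} (Ord-Xα p pp) i
            (cscal (Ord-closed 0ℤ μ) 1ℤ (oG (suc i) 0 l z≤n))) 1≤k)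
        rows0 : ∀ i → i ℕ.≤ m → i ≢ 0 → Z (tc 0ℤ μ (Σₚ (suc m) (λ t → iter Xα i (((β - 1ℤ) ^ t) · C̃ i t))))
        rows0 i l h = Z-resp (tc-Σ 0ℤ μ (suc m) _) (go (suc m))
          where
          each : ∀ t → Z (tc 0ℤ μ (iter Xα i (((β - 1ℤ) ^ t) · C̃ i t)))
          each zero = low i l h
          each (suc t) = high i (suc t) (λ ())
          go : ∀ n → Z (ΣZ n (λ t → tc 0ℤ μ (iter Xα i (((β - 1ℤ) ^ t) · C̃ i t))))
          go zero = Z-0
          go (suc n) = Z-+ (go n) (each n)

      -- In uᵐ Φ the pair (i , t) contributes `G i t` times a constant and u to the power m - t +
      -- ik. That exponent is 0 for (0 , m) only, whose constant (β-1)ᵐ is invertible.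
      special-nogain : 1 ℕ.≤ k → ¬ Z (β - 1ℤ) → Null (Φ m A) → ∀ μ → OrdG μ → Z (tc 0ℤ μ (G 0 m))
      special-nogain 1≤k nβ nΦ μ oG = Z-^-cancel (β - 1ℤ) m nβ
          (Z-resp (sym (at (lscal (liter m lU) ((β - 1ℤ) ^ m) (C̃ 0 m)) 0ℤ μ))
        (isolate 0ℤ μ (suc m) (term 0) m (ℕ.n<1+n m) (λ { t (s≤s l) t≢m → small 0 t z≤n l (λ _ → t≢m) })
          (isolate 0ℤ μ (suc m) (λ i → Σₚ (suc m) (term i)) 0 (s≤s z≤n) (λ { i (s≤s l) i≢0 → rows0 i l i≢0 })
            (Z-resp (sym (at (lcong (liter m lU) expand-Φ ⟫ linear-Σ (liter m lU) (suc m) _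
                ⟫ Σ-cong (suc m) (λ i _ → linear-Σ (liter m lU) (suc m) _)) 0ℤ μ))
               (iter-closed {Null} {U} (λ {g} → Null-U p pp {g}) m {Φ m A} nΦ 0ℤ μ)))))
        where
        term : ℕ → ℕ → Poly
        term i t = iter U m (iter Xα i (((β - 1ℤ) ^ t) · C̃ i t))
        gap : ∀ i t → t ℕ.≤ m → (i ≡ 0 → t ≢ m) → 1 ℕ.≤ (m ℕ.∸ t) ℕ.+ i ℕ.* k
        gap zero t l h = ℕ.≤-trans (ℕ.m<n⇒0<n∸m (ℕ.≤∧≢⇒< l (h refl))) (ℕ.m≤m+n (m ℕ.∸ t) 0)
        gap (suc i) t l h = ℕ.≤-trans 1≤k (ℕ.≤-trans (ℕ.m≤m+n k (i ℕ.* k)) (ℕ.m≤n+m _ (m ℕ.∸ t)))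
        small : ∀ i t → i ℕ.≤ m → t ℕ.≤ m → (i ≡ 0 → t ≢ m) → Z (tc 0ℤ μ (term i t))
        small i t i≤m t≤m h = Z-resp (at (lcong (liter m lU)
            (Xⁿ i _ ⟫ ·-cong (α ^ i) (lscal (liter (i ℕ.* k) lU) ((β - 1ℤ) ^ t) (C̃ i t)))
              ⟫ lscal (liter m lU) (α ^ i) _ ⟫ ·-cong (α ^ i)
                  (lscal (liter m lU) ((β - 1ℤ) ^ t) _ ⟫ ·-cong ((β - 1ℤ) ^ t) (≡⇒≈ eq))) 0ℤ μ)
            (Z-* (α ^ i) (Z-* ((β - 1ℤ) ^ t) (raise-U _ (oG i t i≤m t≤m) (gap i t t≤m h))))
          where
          eq : iter U m (iter U (i ℕ.* k) (C̃ i t)) ≡ iter U ((m ℕ.∸ t) ℕ.+ i ℕ.* k) (G i t)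
          eq = trans (sym (iter-+ U m (i ℕ.* k) (C̃ i t))) (trans
              (cong (λ x → iter U x (C̃ i t)) (trans (cong (ℕ._+ i ℕ.* k) (sym (ℕ.m∸n+n≡m t≤m))) (arith (m ℕ.∸ t) t (i ℕ.* k))))
                (iter-+ U ((m ℕ.∸ t) ℕ.+ i ℕ.* k) t (C̃ i t)))
            where arith : ∀ a t b → a ℕ.+ t ℕ.+ b ≡ a ℕ.+ b ℕ.+ t
                  arith = ℕSolver.solve-∀
        rows0 : ∀ i → i ℕ.≤ m → i ≢ 0 → Z (tc 0ℤ μ (Σₚ (suc m) (term i)))
        rows0 i l h = go (suc m) ℕ.≤-refl
          where
          go : ∀ n → n ℕ.≤ suc m → Z (tc 0ℤ μ (Σₚ n (term i)))
          go zero _ = Z-0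
          go (suc n) (s≤s l′) = Z-+ (go n (ℕ.m≤n⇒m≤1+n l′)) (small i n l l′ (λ e → ⊥-elim (h e)))

      -- A pair with i ≥ 1 has t < m ≤ k, so ik - t exceeds every node with smaller i, and for equal
      -- i the nodes differ with t. All distances are at most km + m < p, so the nodes differ modulo
      -- p too.
      nodes-apart : 1 ℕ.≤ k → m ℕ.≤ k → k ℕ.* m ℕ.+ m ℕ.< p → ∀ μ → AllPairs (λ a b → ¬ Z (node μ a - node μ b)) (triangle m)
      nodes-apart 1≤k m≤k small μ = AllPairs-refine {P = λ a → proj₁ a ℕ.+ proj₂ a ℕ.≤ m} {R = Below} apart
          (rows-All m (suc m) (λ { i t (s≤s l) x → ℕ.≤-pred (ℕ.≤-trans (ℕ.≤-reflexive (sym (ℕ.+-suc i t)))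
              (ℕ.≤-trans (ℕ.+-monoʳ-≤ i x) (ℕ.≤-reflexive (ℕ.m+[n∸m]≡n (ℕ.m≤n⇒m≤1+n l))))) }))
          (rows-pairs m (suc m))
        where
        apart : ∀ {x y : ℕ × ℕ} → proj₁ x ℕ.+ proj₂ x ℕ.≤ m → proj₁ y ℕ.+ proj₂ y ℕ.≤ m → Below x y → ¬ Z (node μ x - node μ y)
        apart {i , t} {i′ , t′} x∈ y∈ (inj₂ (refl , t′<t)) z = ¬Z-pos (t ℕ.∸ t′) (ℕ.m<n⇒0<n∸m t′<t)
            (ℕ.≤-<-trans (ℕ.≤-trans (ℕ.m∸n≤m t t′) (ℕ.≤-trans (ℕ.m≤n+m t i) (ℕ.≤-trans x∈ (ℕ.m≤n+m m (k ℕ.* m))))) small)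
            (Z-resp (trans (cong (λ x → x) (sym lem2)) (lem (+ μ) (+ (i ℕ.* k)) (+ t) (+ t′))) (Z-* -1ℤ z))
          where
          lem : ∀ μ i t t′ → t - t′ ≡ -1ℤ * ((μ + (i - t)) - (μ + (i - t′)))
          lem = solve-∀
          lem2 : + t - + t′ ≡ + (t ℕ.∸ t′)
          lem2 = trans (ℤ.m-n≡m⊖n t t′) (ℤ.⊖-≥ (ℕ.<⇒≤ t′<t))
        apart {i , t} {i′ , t′} x∈ y∈ (inj₁ i′<i) z = ¬Z-pos (N ℕ.∸ t) (ℕ.m<n⇒0<n∸m t<N)
            (ℕ.≤-<-trans (ℕ.≤-trans (ℕ.m∸n≤m N t) N≤) small)
            (Z-resp eq z)
          where
          N = (i ℕ.∸ i′) ℕ.* k ℕ.+ t′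
          t<m : t ℕ.< m
          t<m = ℕ.≤-trans (ℕ.+-monoˡ-≤ t (ℕ.≤-trans (s≤s z≤n) i′<i)) x∈
          t<N : t ℕ.< N
          t<N = ℕ.<-≤-trans (ℕ.<-≤-trans t<m m≤k) (ℕ.≤-trans
              (ℕ.≤-trans (ℕ.≤-reflexive (sym (ℕ.*-identityˡ k))) (ℕ.*-monoˡ-≤ k (ℕ.m<n⇒0<n∸m i′<i))) (ℕ.m≤m+n _ t′))
          N≤ : N ℕ.≤ k ℕ.* m ℕ.+ m
          N≤ = ℕ.+-mono-≤ (ℕ.≤-trans (ℕ.*-monoˡ-≤ k (ℕ.≤-trans (ℕ.m∸n≤m i i′) (ℕ.≤-trans (ℕ.m≤m+n i t) x∈)))
              (ℕ.≤-reflexive (ℕ.*-comm m k)))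
                 (ℕ.≤-trans (ℕ.m≤n+m t′ i′) y∈)
          lem : ∀ μ i d t t′ → (μ + ((d + i) - t)) - (μ + (i - t′)) ≡ (d + t′) - t
          lem = solve-∀
          ik : + (i ℕ.* k) ≡ + ((i ℕ.∸ i′) ℕ.* k) + + (i′ ℕ.* k)
          ik = trans (cong +_ (trans (cong (ℕ._* k) (sym (ℕ.m∸n+n≡m (ℕ.<⇒≤ i′<i)))) (ℕ.*-distribʳ-+ k (i ℕ.∸ i′) i′)))
              (ℤ.pos-+ ((i ℕ.∸ i′) ℕ.* k) (i′ ℕ.* k))
          eq : + (N ℕ.∸ t) ≡ node μ (i , t) - node μ (i′ , t′)
          eq = sym (trans (cong (λ x → (+ μ + (x - + t)) - node μ (i′ , t′)) ik)
             (trans (lem (+ μ) (+ (i′ ℕ.* k)) (+ ((i ℕ.∸ i′) ℕ.* k)) (+ t) (+ t′))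
               (trans (cong (_- + t) (sym (ℤ.pos-+ ((i ℕ.∸ i′) ℕ.* k) t′))) (trans (ℤ.m-n≡m⊖n N t) (ℤ.⊖-≥ (ℕ.<⇒≤ t<N))))))

      -- The common order of the `G i t` at u = 0 rises without end: if it is μ, their coefficients
      -- of order μ solve the Vandermonde system, with one of them known to vanish from Φ = 0, so
      -- all vanish. Hence every `C̃ i t` is zero, then every (1-u)^(jk) A i j, and multiplication
      -- by 1 - u is injective.
      Φ-nonzero : ∀ M → length (triangle m) ≡ suc M → 1 ℕ.≤ k → k ℕ.< p → m ℕ.≤ k → k ℕ.* m ℕ.+ m ℕ.< p
        → (∀ r → r ℕ.< M → Null (F m A r)) → Null (Φ m A) → ∀ i j → i ℕ.≤ m → j ℕ.≤ m → Null (A i j)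
      Φ-nonzero M len 1≤k k<p m≤k small hF nΦ i j i≤m j≤m =
        Vⁿ-injective (j ℕ.* k) (A i j) (λ w s → Z-resp (cong (tc w s) (sym (iter-mul V k j (A i j)))) (C-null w s))
        where
        nk : ¬ Z (+ k)
        nk = ¬Z-pos k 1≤k k<p
        all-order : ∀ μ → OrdG μ
        all-order zero = λ i t _ _ → Ord-0 p pp 0ℤ (G i t)
        all-order (suc μ) = λ i t i≤m t≤m → Ord-suc (oG i t i≤m t≤m) (coef i t i≤m t≤m)
          where
          oG = all-order μ
          moms : ∀ r → suc r ℕ.< length (triangle m) → Z (sumL (λ a → weight μ a * node μ a ^ r) (triangle m))
          moms r l = moments μ oG r (hF r (ℕ.≤-pred (subst (suc r ℕ.<_) len l)))
          weights : All (λ a → Z (weight μ a)) (triangle m)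
          weights with Z? (β - 1ℤ)
          ... | yes zβ = Vandermonde′ (node μ) (weight μ) (triangle m) (nodes-apart 1≤k m≤k small μ) (0 , 0)
                  (rows-∈ m (suc m) 0 0 (s≤s z≤n) (s≤s z≤n)) (Z-* ((+ k) ^ 0) (special-gain 1≤k zβ nΦ μ oG)) moms
          ... | no nβ = Vandermonde′ (node μ) (weight μ) (triangle m) (nodes-apart 1≤k m≤k small μ) (0 , m)
                  (rows-∈ m (suc m) 0 m (s≤s z≤n) (ℕ.n<1+n m)) (Z-* ((+ k) ^ m) (special-nogain 1≤k nβ nΦ μ oG)) moms
          coef : ∀ i t → i ℕ.≤ m → t ℕ.≤ m → Z (tc 0ℤ μ (G i t))
          coef i t i≤m t≤m with m ℕ.<? i ℕ.+ t
          ... | yes l = Z-resp (at (lcong (liter t lU) (outside i t l) ⟫ linear-𝟘 (liter t lU)) 0ℤ μ) Z-0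
          ... | no l = Z-^-cancel (+ k) t nk (All.lookup weights (rows-∈ m (suc m) i t (s≤s i≤m)
                 (ℕ.+-cancelˡ-< i _ _ (ℕ.<-≤-trans (s≤s (ℕ.≮⇒≥ l)) (ℕ.≤-reflexive (sym (ℕ.m+[n∸m]≡n (ℕ.m≤n⇒m≤1+n i≤m))))))))
        C-null : Null (iter W j (A i j))
        C-null = tay-injective m (λ j → iter W j (A i j)) (λ t t≤m → null-coeffs (C̃ i t) (λ s →
            Z-resp (sym (top-U p pp t s (C̃ i t))) (taylor (all-order (suc (t ℕ.+ s)) i t i≤m t≤m) (t ℕ.+ s) (ℕ.n<1+n _)))) j j≤m

-- Homogeneous linear systems modulo p

module LinearSystems where
  open Expressions
  open Operators
  open Localisation
  open Derivation
  open AuxiliaryPolynomial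
  open NonVanishing
  open import Data.Integer using (+_; _+_; _*_; -_; _-_)
  open import Data.Integer.Tactic.RingSolver using (solve-∀)

  record LinFun (φ : (ℕ → ℤ) → ℤ) : Set where
    field
      fcong : ∀ {x y} → (∀ q → x q ≡ y q) → φ x ≡ φ y
      fadd  : ∀ x y → φ (λ q → x q + y q) ≡ φ x + φ y
      fscal : ∀ c x → φ (λ q → c * x q) ≡ c * φ x
  open LinFun public

  record LinMap (Ψ : (ℕ → ℤ) → Poly) : Set where
    field
      mcong : ∀ {x y} → (∀ q → x q ≡ y q) → Ψ x ≈ Ψ y
      madd  : ∀ x y → Ψ (λ q → x q + y q) ≈ Ψ x ⊕ Ψ y
      mscal : ∀ c x → Ψ (λ q → c * x q) ≈ c · Ψ x
  open LinMap public

  lm-tc : ∀ w s {Ψ} → LinMap Ψ → LinFun (λ x → tc w s (Ψ x))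
  lm-tc w s l = record
    { fcong = λ h → at (mcong l h) w s ; fadd = λ x y → at (madd l x y) w s ; fscal = λ c x → at (mscal l c x) w s }

  lm-∘ : ∀ {O Ψ} → Linear O → LinMap Ψ → LinMap (λ x → O (Ψ x))
  lm-∘ o l = record
    { mcong = λ h → lcong o (mcong l h)
    ; madd = λ x y → lcong o (madd l x y) ⟫ ladd o _ _
    ; mscal = λ c x → lcong o (mscal l c x) ⟫ lscal o c _ }

  lm-Σ : ∀ n {Ψ : ℕ → (ℕ → ℤ) → Poly} → (∀ i → LinMap (Ψ i)) → LinMap (λ x → Σₚ n (λ i → Ψ i x))
  lm-Σ n l = record
    { mcong = λ h → Σ-cong n (λ i _ → mcong (l i) h)
    ; madd = λ x y → Σ-cong n (λ i _ → madd (l i) x y) ⟫ Σ-⊕ n _ _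
    ; mscal = λ c x → Σ-cong n (λ i _ → mscal (l i) c x) ⟫ ≈-sym (linear-Σ (l· c lid) n _) }

  unit : ℕ → ℕ → ℤ
  unit r q with r ℕ.≟ q
  ... | yes _ = 1ℤ
  ... | no _ = 0ℤ

  -- Vectors of unknowns are infinite sequences, so that conditions carry no length. Written as a
  -- sum of unit vectors, the truncation lets linearity reduce a functional to the finite row of its
  -- values on these.
  clip : ℕ → (ℕ → ℤ) → ℕ → ℤ
  clip N x q = ΣZ N (λ r → x r * unit r q)

  clip-functional : ∀ {φ} → LinFun φ → ∀ N x → φ (clip N x) ≡ ΣZ N (λ r → x r * φ (unit r))
  clip-functional {φ} l zero x = trans (fcong l (λ q → sym (ℤ.*-zeroʳ 0ℤ)))
      (trans (fscal l 0ℤ (λ _ → 0ℤ)) (ℤ.*-zeroˡ (φ (λ _ → 0ℤ))))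
  clip-functional l (suc N) x = trans (fadd l _ _) (cong₂ _+_ (clip-functional l N x) (fscal l (x N) (unit N)))

  clip-above : ∀ N x q → N ℕ.≤ q → clip N x q ≡ 0ℤ
  clip-above zero x q l = refl
  clip-above (suc N) x q l with N ℕ.≟ q
  ... | yes refl = ⊥-elim (ℕ.<-irrefl refl l)
  ... | no _ = trans (cong₂ _+_ (clip-above N x q (ℕ.<⇒≤ l)) (ℤ.*-zeroʳ (x N))) refl

  clip-below : ∀ N x q → q ℕ.< N → clip N x q ≡ x q
  clip-below (suc N) x q (s≤s l) with N ℕ.≟ q
  ... | yes refl = trans (cong₂ _+_ (clip-above N x N ℕ.≤-refl) (ℤ.*-identityʳ (x N))) (ℤ.+-identityˡ (x N))
  ... | no N≢q = trans (cong₂ _+_ (clip-below N x q (ℕ.≤∧≢⇒< l (λ e → N≢q (sym e)))) (ℤ.*-zeroʳ (x N))) (ℤ.+-identityʳ (x q))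

  module Kernel (p : ℕ) (pp : Prime p) where
    open Local p pp

    private
      dot : ℕ → (ℕ → ℤ) → (ℕ → ℤ) → ℤ
      dot N x ρ = ΣZ N (λ q → x q * ρ q)

      -- Search for a pivot in column `n`. The last component undoes the change of order that taking
      -- out the pivot row causes.
      pick : (n : ℕ) (rs : List (ℕ → ℤ)) → All (λ ρ → Z (ρ n)) rs
        ⊎ (Σ[ ρ ∈ (ℕ → ℤ) ] Σ[ rest ∈ List (ℕ → ℤ) ] ¬ Z (ρ n) × length rs ≡ suc (length rest)
            × (∀ {P : (ℕ → ℤ) → Set} → P ρ → All P rest → All P rs))
      pick n [] = inj₁ []
      pick n (ρ ∷ rs) with Z? (ρ n)
      ... | no nz = inj₂ (ρ , rs , nz , refl , _∷_)
      ... | yes z with pick n rs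
      ...   | inj₁ all = inj₁ (z ∷ all)
      ...   | inj₂ (ρ′ , rest , nz , len , back) = inj₂ (ρ′ , ρ ∷ rest , nz , cong suc len , λ { h (a ∷ as) → a ∷ back h as })

      override : ℕ → (ℕ → ℤ) → ℤ → ℕ → ℤ
      override N x v q with q ℕ.<? N
      ... | yes _ = x q
      ... | no _ = v

      override-< : ∀ N x v q → q ℕ.< N → override N x v q ≡ x q
      override-< N x v q l with q ℕ.<? N
      ... | yes _ = refl
      ... | no h = ⊥-elim (h l)

      override-≡ : ∀ N x v → override N x v N ≡ v
      override-≡ N x v with N ℕ.<? N
      ... | yes l = ⊥-elim (ℕ.<-irrefl refl l)
      ... | no _ = refl

      dot-override : ∀ N x v ρ → dot (suc N) (override N x v) ρ ≡ dot N x ρ + v * ρ N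
      dot-override N x v ρ = cong₂ _+_ (ΣZ-cong N (λ q l → cong (_* ρ q) (override-< N x v q l)))
          (cong (_* ρ N) (override-≡ N x v))

      dot-zero : ∀ N ρ → dot N (λ _ → 0ℤ) ρ ≡ 0ℤ
      dot-zero zero ρ = refl
      dot-zero (suc N) ρ = trans (cong₂ _+_ (dot-zero N ρ) (ℤ.*-zeroˡ (ρ N))) refl

      dot-eliminate : ∀ N x a b ρ σ → dot N x (λ q → a * ρ q - b * σ q) ≡ dot N (λ q → a * x q) ρ - b * dot N x σ
      dot-eliminate zero x a b ρ σ = sym (trans (ℤ.+-identityˡ _) (cong -_ (ℤ.*-zeroʳ b)))
      dot-eliminate (suc N) x a b ρ σ = trans (cong (_+ x N * (a * ρ N - b * σ N)) (dot-eliminate N x a b ρ σ))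
          (lem (x N) a b (ρ N) (σ N) (dot N (λ q → a * x q) ρ) (dot N x σ))
        where lem : ∀ x a b r s u v → (u - b * v) + x * (a * r - b * s) ≡ (u + (a * x) * r) - b * (v + x * s)
              lem = solve-∀

      dot-scale : ∀ N a x ρ → dot N (λ q → a * x q) ρ ≡ a * dot N x ρ
      dot-scale zero a x ρ = sym (ℤ.*-zeroʳ a)
      dot-scale (suc N) a x ρ = trans (cong (_+ (a * x N) * ρ N) (dot-scale N a x ρ)) (lem a (dot N x ρ) (x N) (ρ N))
        where lem : ∀ a d x r → a * d + (a * x) * r ≡ a * (d + x * r)
              lem = solve-∀

    -- Elimination in the last coordinate without division: every other row ρ becomes σ N · ρ - ρ N
    -- · σ for the pivot σ, a solution of these is scaled by σ N, and the last coordinate is chosen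
    -- to satisfy the pivot row. Without a pivot the last unit vector is a solution.
    nontrivial-solution : ∀ N (rs : List (ℕ → ℤ)) → length rs ℕ.< N →
      Σ[ x ∈ (ℕ → ℤ) ] (Σ[ q ∈ ℕ ] q ℕ.< N × ¬ Z (x q)) × All (λ ρ → Z (ΣZ N (λ q → x q * ρ q))) rs
    nontrivial-solution (suc N) rs l with pick N rs
    ... | inj₁ all = override N (λ _ → 0ℤ) 1ℤ , (N , ℕ.n<1+n N , λ z → ¬Z-1 (Z-resp (sym (override-≡ N (λ _ → 0ℤ) 1ℤ)) z))
          , All.map (λ {ρ} z → Z-resp (trans (dot-override N (λ _ → 0ℤ) 1ℤ ρ)
              (trans (cong₂ _+_ (dot-zero N ρ) (ℤ.*-identityˡ (ρ N))) (ℤ.+-identityˡ (ρ N)))) z) all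
    ... | inj₂ (σ , rest , nz , len , back)
        with nontrivial-solution N (map (λ ρ q → σ N * ρ q - ρ N * σ q) rest)
               (subst (ℕ._< N) (sym (List.length-map _ rest)) (ℕ.≤-pred (subst (ℕ._< suc N) len l)))
    ...   | x , (q , q<N , xq) , sols = y , (q , ℕ.m<n⇒m<1+n q<N , λ z → xq (Z-cancel (σ N) nz (Z-resp (sym (override-< N x′ v q q<N)) z)))
          , back pivot (All.map others (All.map⁻ sols))
      where
      x′ = λ q → σ N * x q
      v = - dot N x σ
      y = override N x′ v
      pivot : Z (dot (suc N) y σ)
      pivot = Z-resp (trans (dot-override N x′ v σ) (trans (cong (_+ v * σ N) (dot-scale N (σ N) x σ))
          (lem (σ N) (dot N x σ)))) Z-0
        where lem : ∀ s d → s * d + (- d) * s ≡ 0ℤ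
              lem = solve-∀
      others : ∀ {ρ : ℕ → ℤ} → Z (dot N x (λ q → σ N * ρ q - ρ N * σ q)) → Z (dot (suc N) y ρ)
      others {ρ} z = Z-resp (trans (dot-override N x′ v ρ) (trans (lem (dot N x′ ρ) (dot N x σ) (ρ N))
          (sym (dot-eliminate N x (σ N) (ρ N) ρ σ)))) z
        where lem : ∀ u d r → u + (- d) * r ≡ u - r * d
              lem = solve-∀

    common-zero : ∀ N (φs : List ((ℕ → ℤ) → ℤ)) → All LinFun φs → length φs ℕ.< N →
      Σ[ x ∈ (ℕ → ℤ) ] (Σ[ q ∈ ℕ ] q ℕ.< N × ¬ Z (x q)) × All (λ φ → Z (φ x)) φs
    common-zero N φs lin l with nontrivial-solution N (map (λ φ r → φ (unit r)) φs)
        (subst (ℕ._< N) (sym (List.length-map _ φs)) l)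
    ... | x , (q , q<N , nz) , sols = clip N x , (q , q<N , λ z → nz (Z-resp (sym (clip-below N x q q<N)) z))
        , All.map (λ { {φ} (lf , z) → Z-resp (clip-functional lf N x) z }) (All.zip (lin , All.map⁻ sols))

  gather : ∀ {X : Set} → ℕ → (ℕ → List X) → List X
  gather zero g = []
  gather (suc n) g = gather n g ++ g n

  ΣN : ℕ → (ℕ → ℕ) → ℕ
  ΣN zero f = 0
  ΣN (suc n) f = ΣN n f ℕ.+ f n

  length-gather : ∀ {X : Set} n (g : ℕ → List X) → length (gather n g) ≡ ΣN n (λ i → length (g i))
  length-gather zero g = refl
  length-gather (suc n) g = trans (List.length-++ (gather n g)) (cong (ℕ._+ length (g n)) (length-gather n g))

  gather-All⁺ : ∀ {X : Set} {P : X → Set} n (g : ℕ → List X) → (∀ i → i ℕ.< n → All P (g i)) → All P (gather n g)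
  gather-All⁺ zero g h = []
  gather-All⁺ (suc n) g h = All.++⁺ (gather-All⁺ n g (λ i l → h i (ℕ.m<n⇒m<1+n l))) (h n (ℕ.n<1+n n))

  gather-All⁻ : ∀ {X : Set} {P : X → Set} n (g : ℕ → List X) → All P (gather n g) → ∀ i → i ℕ.< n → All P (g i)
  gather-All⁻ (suc n) g h i (s≤s l) with ℕ.m≤n⇒m<n∨m≡n l
  ... | inj₁ i<n = gather-All⁻ n g (All.++⁻ˡ (gather n g) h) i i<n
  ... | inj₂ refl = All.++⁻ʳ (gather n g) h

  each : ∀ {X : Set} → ℕ → (ℕ → X) → List X
  each n f = gather n (λ i → f i ∷ [])

  each-All⁺ : ∀ {X : Set} {P : X → Set} n (f : ℕ → X) → (∀ i → i ℕ.< n → P (f i)) → All P (each n f)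
  each-All⁺ n f h = gather-All⁺ n _ (λ i l → h i l ∷ [])

  each-All⁻ : ∀ {X : Set} {P : X → Set} n (f : ℕ → X) → All P (each n f) → ∀ i → i ℕ.< n → P (f i)
  each-All⁻ n f h i l with gather-All⁻ n _ h i l
  ... | z ∷ [] = z

  ΣN-const : ∀ n c → ΣN n (λ _ → c) ≡ n ℕ.* c
  ΣN-const zero c = refl
  ΣN-const (suc n) c = trans (cong (ℕ._+ c) (ΣN-const n c)) (ℕ.+-comm (n ℕ.* c) c)

  ΣN-cong : ∀ n {f g} → (∀ i → i ℕ.< n → f i ≡ g i) → ΣN n f ≡ ΣN n g
  ΣN-cong zero h = refl
  ΣN-cong (suc n) h = cong₂ ℕ._+_ (ΣN-cong n (λ i l → h i (ℕ.m<n⇒m<1+n l))) (h n (ℕ.n<1+n n))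

  length-each : ∀ {X : Set} n (f : ℕ → X) → length (each n f) ≡ n
  length-each n f = trans (length-gather n _) (trans (ΣN-const n 1) (ℕ.*-identityʳ n))

  poly : (ℕ → ℤ) → ℕ → Poly
  poly g zero = 𝟘
  poly g (suc n) = g 0 · 𝟙 ⊕ U (poly (λ s → g (suc s)) n)

  tc-poly : ∀ g n s → s ℕ.< n → tc 0ℤ s (poly g n) ≡ g s
  tc-poly g (suc n) zero l = lem (g 0) (tc 0ℤ 0 (poly (λ s → g (suc s)) n))
    where lem : ∀ a x → a * 1ℤ + 0ℤ * x ≡ a
          lem = solve-∀
  tc-poly g (suc n) (suc s) (s≤s l) = trans (lem (g 0) (tc 0ℤ (suc s) (poly (λ s → g (suc s)) n))
      (tc 0ℤ s (poly (λ s → g (suc s)) n))) (tc-poly (λ s → g (suc s)) n s l)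
    where lem : ∀ a x y → a * 0ℤ + (0ℤ * x + y) ≡ y
          lem = solve-∀

  tc-poly-high : ∀ g n s → n ℕ.≤ s → tc 0ℤ s (poly g n) ≡ 0ℤ
  tc-poly-high g zero s l = refl
  tc-poly-high g (suc n) (suc s) (s≤s l) = trans (lem (g 0) (tc 0ℤ (suc s) (poly (λ s → g (suc s)) n))
      (tc 0ℤ s (poly (λ s → g (suc s)) n))) (tc-poly-high (λ s → g (suc s)) n s l)
    where lem : ∀ a x y → a * 0ℤ + (0ℤ * x + y) ≡ y
          lem = solve-∀

  poly-linear : ∀ (ι : ℕ → ℕ) n → LinMap (λ x → poly (λ s → x (ι s)) n)
  poly-linear ι zero = record { mcong = λ _ → ≈-refl ; madd = λ _ _ → mk (λ _ _ → refl) ; mscal = λ c _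
      → mk (λ _ _ → sym (ℤ.*-zeroʳ c)) }
  poly-linear ι (suc n) = record
    { mcong = λ h → ⊕-cong (mk λ w s → cong (_* tc w s 𝟙) (h (ι 0))) (lcong lU (mcong rec h))
    ; madd = λ x y → ⊕-cong (mk λ w s → ℤ.*-distribʳ-+ (tc w s 𝟙) (x (ι 0)) (y (ι 0)))
        (lcong lU (madd rec x y) ⟫ ladd lU _ _) ⟫ ⊕-interchange _ _ _ _
    ; mscal = λ c x → ⊕-cong (mk λ w s → ℤ.*-assoc c (x (ι 0)) (tc w s 𝟙)) (lcong lU (mscal rec c x) ⟫ lscal lU c _)
        ⟫ ≈-sym (·-⊕ c _ _) }
    where rec = poly-linear (λ s → ι (suc s)) n

  -- Position of the pair (i , j) with i + j = c is offset c + j.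
  offset : ℕ → ℕ
  offset zero = 0
  offset (suc c) = offset c ℕ.+ suc c

  offset-mono : ∀ {a b} → a ℕ.≤ b → offset a ℕ.≤ offset b
  offset-mono {b = zero} z≤n = z≤n
  offset-mono {a} {suc b} l with ℕ.m≤n⇒m<n∨m≡n l
  ... | inj₁ (s≤s a≤b) = ℕ.≤-trans (offset-mono a≤b) (ℕ.m≤m+n _ (suc b))
  ... | inj₂ refl = ℕ.≤-refl

  decode : ∀ P → Σ[ c ∈ ℕ ] Σ[ j ∈ ℕ ] j ℕ.≤ c × P ≡ offset c ℕ.+ j
  decode zero = 0 , 0 , z≤n , refl
  decode (suc P) with decode P
  ... | c , j , j≤c , eq with ℕ.m≤n⇒m<n∨m≡n j≤c
  ...   | inj₁ j<c = c , suc j , j<c , trans (cong suc eq) (sym (ℕ.+-suc (offset c) j))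
  ...   | inj₂ refl = suc c , 0 , z≤n , trans (cong suc eq) (trans (sym (ℕ.+-suc (offset c) c)) (sym (ℕ.+-identityʳ _)))

-- Existence of the A i j: unknowns against conditions

module Construction where
  open Expressions
  open Operators
  open Localisation
  open Derivation
  open AuxiliaryPolynomial
  open NonVanishing
  open LinearSystems
  open import Data.Nat using (_+_; _*_; _∸_; _≤_; _<_; _≤?_; _<?_)
  open import Data.Nat.DivMod using (_/_; _%_)
  open import Data.Nat.Tactic.RingSolver using (solve-∀)
  open import Data.Integer using (+_)

  -- The number of pairs (i , j) with i + j ≤ m is suc (order m).
  order : ℕ → ℕ
  order m = offset m + m

  -- This is (m⁴ + 2m³ - 5m² + 10m)/8, the value at which, for m ≥ 1, the unknowns outnumber the
  -- conditions by exactly one. The recursion avoids division and subtraction.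
  degree : ℕ → ℕ
  degree zero = 0
  degree (suc m) = suc (degree m + m * order m)

  private
    offset-closed : ∀ c → 2 * offset c ≡ c * suc c
    offset-closed zero = refl
    offset-closed (suc c) = trans (ℕ.*-distribˡ-+ 2 (offset c) (suc c)) (trans (cong (_+ 2 * suc c) (offset-closed c)) (lem c))
      where lem : ∀ c → c * suc c + 2 * suc c ≡ suc c * suc (suc c)
            lem = solve-∀

  order-closed : ∀ m → 2 * order m ≡ m * (m + 3)
  order-closed m = trans (ℕ.*-distribˡ-+ 2 (offset m) m) (trans (cong (_+ 2 * m) (offset-closed m)) (lem m))
    where lem : ∀ c → c * suc c + 2 * c ≡ c * (c + 3)
          lem = solve-∀

  degree-closed : ∀ m → 8 * degree m + 5 * (m * m) ≡ m * m * m * m + 2 * (m * m * m) + 10 * m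
  degree-closed zero = refl
  degree-closed (suc m) = ℕ.+-cancelʳ-≡ (5 * (m * m)) _ _ (begin
      8 * suc (degree m + m * order m) + 5 * (suc m * suc m) + 5 * (m * m)
        ≡⟨ l1 (degree m) (order m) m ⟩
      8 * degree m + 5 * (m * m) + (4 * m * (2 * order m) + 8 + 5 * (suc m * suc m))
        ≡⟨ cong₂ (λ x y → x + (4 * m * y + 8 + 5 * (suc m * suc m))) (degree-closed m) (order-closed m) ⟩
      m * m * m * m + 2 * (m * m * m) + 10 * m + (4 * m * (m * (m + 3)) + 8 + 5 * (suc m * suc m))
        ≡⟨ l2 m ⟩
      suc m * suc m * suc m * suc m + 2 * (suc m * suc m * suc m) + 10 * suc m + 5 * (m * m) ∎)
    where
    open ≡-Reasoning
    l1 : ∀ d o m → 8 * suc (d + m * o) + 5 * (suc m * suc m) + 5 * (m * m)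
        ≡ 8 * d + 5 * (m * m) + (4 * m * (2 * o) + 8 + 5 * (suc m * suc m))
    l1 = solve-∀
    l2 : ∀ m → m * m * m * m + 2 * (m * m * m) + 10 * m + (4 * m * (m * (m + 3)) + 8 + 5 * (suc m * suc m))
        ≡ suc m * suc m * suc m * suc m + 2 * (suc m * suc m * suc m) + 10 * suc m + 5 * (m * m)
    l2 = solve-∀

  -- It keeps the subtraction of 3m in the count of conditions exact.
  degree-large : ∀ m → 3 * suc m ≤ degree (suc m) + 2
  degree-large zero = ℕ.≤-refl
  degree-large (suc m) = ℕ.≤-trans (ℕ.≤-reflexive (lem₁ m)) (ℕ.≤-trans (ℕ.+-mono-≤ (degree-large m) three)
      (ℕ.≤-reflexive (lem₂ (degree (suc m)) (suc m * order (suc m)))))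
    where
    lem₁ : ∀ m → 3 * suc (suc m) ≡ 3 * suc m + 3
    lem₁ = solve-∀
    lem₂ : ∀ d x → d + 2 + suc x ≡ suc (d + x) + 2
    lem₂ = solve-∀
    two : 2 ≤ order (suc m)
    two = ℕ.≤-trans (s≤s (s≤s z≤n)) (ℕ.≤-trans (ℕ.≤-reflexive (lem₃ m)) (ℕ.+-monoˡ-≤ (suc m) (ℕ.m≤n+m (suc m) (offset m))))
      where lem₃ : ∀ m → 2 + (m + m) ≡ suc m + suc m
            lem₃ = solve-∀
    three : 3 ≤ suc (suc m * order (suc m))
    three = s≤s (ℕ.≤-trans two (ℕ.m≤m+n _ (m * order (suc m))))

  private
    -- The number of conditions on one row at one place: order m - t for every t ≤ c.
    block : ℕ → ℕ → ℕ
    block m c = ΣN (suc c) (λ t → m ∸ t)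

    ΣN-shift : ∀ n f → ΣN (suc n) f ≡ f 0 + ΣN n (λ i → f (suc i))
    ΣN-shift zero f = ℕ.+-comm 0 (f 0)
    ΣN-shift (suc n) f = trans (cong (_+ f (suc n)) (ΣN-shift n f)) (ℕ.+-assoc (f 0) _ (f (suc n)))

    block-closed : ∀ m c → c ≤ m → 2 * block m c + c * suc c ≡ 2 * m * suc c
    block-closed m zero l = lem m
      where lem : ∀ m → 2 * m + 0 ≡ 2 * m * 1
            lem = solve-∀
    block-closed m (suc c) l = trans (l1 (block m c) c (m ∸ suc c))
        (trans (cong₂ (λ x y → x + 2 * y) (block-closed m c (ℕ.<⇒≤ l)) (ℕ.m∸n+n≡m l)) (l2 m c))
      where
      l1 : ∀ b c x → 2 * (b + x) + suc c * suc (suc c) ≡ (2 * b + c * suc c) + 2 * (x + suc c)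
      l1 = solve-∀
      l2 : ∀ m c → 2 * m * suc c + 2 * m ≡ 2 * m * suc (suc c)
      l2 = solve-∀

    blocks-closed : ∀ m n → n ≤ m → 6 * ΣN (suc n) (block m) + n * suc n * suc (suc n) ≡ 3 * m * suc n * suc (suc n)
    blocks-closed m zero l = lem m
      where lem : ∀ m → 6 * m + 0 ≡ 3 * m * 1 * 2
            lem = solve-∀
    blocks-closed m (suc n) l = trans (l1 (ΣN (suc n) (block m)) (block m (suc n)) n)
        (trans (cong₂ (λ x y → x + 3 * y) (blocks-closed m n (ℕ.<⇒≤ l)) (block-closed m (suc n) l)) (l2 m n))
      where
      l1 : ∀ s b n → 6 * (s + b) + suc n * suc (suc n) * suc (suc (suc n))
         ≡ (6 * s + n * suc n * suc (suc n)) + 3 * (2 * b + suc n * suc (suc n))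
      l1 = solve-∀
      l2 : ∀ m n → 3 * m * suc n * suc (suc n) + 3 * (2 * m * suc (suc n)) ≡ 3 * m * suc (suc n) * suc (suc (suc n))
      l2 = solve-∀

    ramp : ∀ n g → 2 * ΣN n (λ r → g + r) + n ≡ 2 * n * g + n * n
    ramp zero g = refl
    ramp (suc n) g = trans (l1 (ΣN n (λ r → g + r)) n g) (trans (cong (λ x → x + (2 * g + 2 * n + 1)) (ramp n g)) (l2 n g))
      where
      l1 : ∀ s n g → 2 * (s + (g + n)) + suc n ≡ (2 * s + n) + (2 * g + 2 * n + 1)
      l1 = solve-∀
      l2 : ∀ n g → (2 * n * g + n * n) + (2 * g + 2 * n + 1) ≡ 2 * suc n * g + suc n * suc n
      l2 = solve-∀

    -- Eight times the claim is a combination of the hypotheses with polynomial coefficients. Each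
    -- hypothesis is added in the direction that avoids subtraction, and the rest is an identity of
    -- polynomials.
    count-identity : ∀ n m M d g S
      → 6 * (n + m) + m * suc m * suc (suc m) ≡ 3 * m * suc m * suc (suc m)
      → 2 * suc M ≡ m * (m + 3)
      → 8 * d + 5 * (m * m) ≡ m * m * m * m + 2 * (m * m * m) + 10 * m
      → d + 2 ≡ g + 3 * m
      → 2 * S + M ≡ 2 * M * g + M * M
      → suc (n + n + n + suc d + S) ≡ suc (suc M) * suc d
    count-identity n m M d g S e1 e2 e3 e4 e5 = ℕ.*-cancelˡ-≡ _ _ 8 (ℕ.+-cancelʳ-≡ _ _ _
        (trans (cong (λ z → 8 * suc (n + n + n + suc d + S) + z) both) (lem n m M d g S)))
      where
      both = cong₂ _+_ (cong₂ _+_ (cong₂ _+_ (cong₂ _+_ (cong₂ _+_ (cong (4 *_) e1) (cong (4 *_) e5))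
               (cong (λ z → 8 * M * z) (sym e4))) (sym e3)) (cong (λ z → (2 * M + m * m) * z) e2))
                   (cong (λ z → 9 * m * z) (sym e2))
      lem : ∀ n m M d g S →
        8 * suc (n + n + n + suc d + S)
          + (4 * (3 * m * suc m * suc (suc m)) + 4 * (2 * M * g + M * M) + 8 * M * (d + 2)
              + (8 * d + 5 * (m * m)) + (2 * M + m * m) * (m * (m + 3)) + 9 * m * (2 * suc M))
        ≡ 8 * (suc (suc M) * suc d)
          + (4 * (6 * (n + m) + m * suc m * suc (suc m)) + 4 * (2 * S + M) + 8 * M * (g + 3 * m)
              + (m * m * m * m + 2 * (m * m * m) + 10 * m) + (2 * M + m * m) * (2 * suc M) + 9 * m * (m * (m + 3)))
      lem = solve-∀

  module Conditions (p : ℕ) (pp : Prime p) (k m d M′ : ℕ)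
      (d-large : 3 * m ≤ d + 2)
      (pairs≡ : offset (suc m) ≡ suc (suc M′))
      (M-closed : 2 * suc M′ ≡ m * (m + 3))
      (d-closed : 8 * d + 5 * (m * m) ≡ m * m * m * m + 2 * (m * m * m) + 10 * m) where
    open Local p pp
    open Kernel p pp
    open Family k

    M width : ℕ
    M = suc M′
    width = suc d

    N : ℕ
    N = offset (suc m) * width

    fam : ℕ → ℕ → (ℕ → ℤ) → Poly
    fam i j x with i + j ≤? m
    ... | yes _ = poly (λ s → x (s + (offset (i + j) + j) * width)) width
    ... | no _ = 𝟘

    fam-linear : ∀ i j → LinMap (fam i j)
    fam-linear i j with i + j ≤? m
    ... | yes _ = poly-linear (λ s → s + (offset (i + j) + j) * width) width
    ... | no _ = record { mcong = λ _ → ≈-refl ; madd = λ x y → mk (λ _ _ → refl) ; mscal = λ c x → mk (λ _ _ → sym (ℤ.*-zeroʳ c)) }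

    fam-outside : ∀ x i j → m < i + j → fam i j x ≈ 𝟘
    fam-outside x i j l with i + j ≤? m
    ... | yes h = ⊥-elim (ℕ.<⇒≱ l h)
    ... | no _ = ≈-refl

    fam-degree : ∀ x i j → Deg width 0 (fam i j x)
    fam-degree x i j with i + j ≤? m
    ... | yes _ = deg λ s l → Z-resp (tc-poly-high (λ s → x (s + (offset (i + j) + j) * width)) width s (subst (width ≤_) (ℕ.+-identityʳ s) l)) Z-0
    ... | no _ = czero (Deg-closed width 0)

    fam-coefficient : ∀ x i j s → i + j ≤ m → s < width → tc 0ℤ s (fam i j x) ≡ x (s + (offset (i + j) + j) * width)
    fam-coefficient x i j s h l with i + j ≤? m
    ... | yes _ = tc-poly (λ s → x (s + (offset (i + j) + j) * width)) width s l
    ... | no n = ⊥-elim (n h)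

    tay-fam : ∀ b t (f : ℕ → ℕ → ℕ × ℕ) c → LinMap (λ x → tay b (λ j → fam (proj₁ (f c j)) (proj₂ (f c j)) x) t)
    tay-fam b t f c = lm-Σ (suc b) (λ j → lm-∘ (l· _ lid) (fam-linear (proj₁ (f c j)) (proj₂ (f c j))))

    F-linear : ∀ r → LinMap (λ x → F m (λ i j → fam i j x) r)
    F-linear r = lm-Σ (suc m) (λ i → lm-Σ (suc m) (λ j → lm-∘ (liter r (lT (i * k) (j * k))) (fam-linear i j)))

    -- At 0 and 1 the rows are numbered by c = m - i and c = m - j. As A i j = 0 for i + j > m, the
    -- Taylor coefficients with t > c vanish by themselves, so t ≤ c suffices. At infinity c is i +
    -- j, and coefficients are counted down from degree d.
    cond₀ cond₁ cond∞ : ℕ → ℕ → ℕ → (ℕ → ℤ) → ℤ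
    cond₀ c t s x = tc 0ℤ s (tay m (λ j → fam (m ∸ c) j x) t)
    cond₁ c t s x = tc 1ℤ s (tay m (λ i → fam i (m ∸ c) x) t)
    cond∞ c t r x = tc 0ℤ (d ∸ r) (tay c (λ i → fam i (c ∸ i) x) t)

    -- The local conditions for c = m, t = 0 are left out: they follow from the others and Σ A i j = 0.
    finite : (ℕ → ℕ → ℕ → (ℕ → ℤ) → ℤ) → List ((ℕ → ℤ) → ℤ)
    finite φ = gather m (λ c → gather (suc c) (λ t → each (m ∸ t) (φ c t)))
            ++ gather m (λ t → each (m ∸ suc t) (φ m (suc t)))

    -- Here the row left out is c = 0, that of `A 0 0`, and again it follows from Σ A i j = 0. All
    -- three places then contribute the same number of conditions.
    infinite : List ((ℕ → ℤ) → ℤ)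
    infinite = gather m (λ c → gather (suc (suc c)) (λ t → each (m ∸ t) (cond∞ (suc c) t)))

    -- The sum with exponent r + 1 has d + 2 + r coefficients; the order m that it already has at 0,
    -- 1 and ∞ saves 3m of them.
    excess : ℕ → ℕ
    excess r = (d + 2 + r) ∸ 3 * m

    sums : List ((ℕ → ℤ) → ℤ)
    sums = each width (λ s x → tc 0ℤ s (F m (λ i j → fam i j x) 0))
        ++ gather M′ (λ r → each (excess r) (λ s x → tc 0ℤ (m + s) (F m (λ i j → fam i j x) (suc r))))

    conditions : List ((ℕ → ℤ) → ℤ)
    conditions = finite cond₀ ++ (finite cond₁ ++ (infinite ++ sums))

    private
      finite-linear : ∀ φ → (∀ c t s → LinFun (φ c t s)) → All LinFun (finite φ)
      finite-linear φ h = All.++⁺ (gather-All⁺ m _ (λ c _ → gather-All⁺ (suc c) _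
          (λ t _ → each-All⁺ (m ∸ t) _ (λ s _ → h c t s))))
        (gather-All⁺ m _ (λ t _ → each-All⁺ (m ∸ suc t) _ (λ s _ → h m (suc t) s)))

      conditions-linear : All LinFun conditions
      conditions-linear =
        All.++⁺ (finite-linear cond₀ (λ c t s → lm-tc 0ℤ s (tay-fam m t (λ c j → m ∸ c , j) c)))
        (All.++⁺ (finite-linear cond₁ (λ c t s → lm-tc 1ℤ s (tay-fam m t (λ c i → i , m ∸ c) c)))
        (All.++⁺ (gather-All⁺ m _ (λ c _ → gather-All⁺ (suc (suc c)) _ (λ t _ → each-All⁺ (m ∸ t) _ (λ r _ →
                    lm-tc 0ℤ (d ∸ r) (tay-fam (suc c) t (λ c i → i , c ∸ i) (suc c))))))
        (All.++⁺ (each-All⁺ width _ (λ s _ → lm-tc 0ℤ s (F-linear 0)))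
                 (gather-All⁺ M′ _ (λ r _ → each-All⁺ (excess r) _ (λ s _ → lm-tc 0ℤ (m + s) (F-linear (suc r))))))))

      n₀ : ℕ
      n₀ = ΣN m (block m) + ΣN m (λ t → m ∸ suc t)

      n₀+m : n₀ + m ≡ ΣN (suc m) (block m)
      n₀+m = trans (ℕ.+-assoc (ΣN m (block m)) _ m) (cong (λ z → ΣN m (block m) + z)
         (trans (ℕ.+-comm _ m) (sym (ΣN-shift m (λ t → m ∸ t)))))

      length-blocks : ∀ {X : Set} n (φ : ℕ → ℕ → ℕ → X) (ι : ℕ → ℕ)
          → length (gather n (λ c → gather (suc (ι c)) (λ t → each (m ∸ t) (φ c t))))
        ≡ ΣN n (λ c → block m (ι c))
      length-blocks n φ ι = trans (length-gather n _) (ΣN-cong n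
          (λ c _ → trans (length-gather (suc (ι c)) _) (ΣN-cong (suc (ι c)) (λ t _ → length-each (m ∸ t) (φ c t)))))

      length-finite : ∀ φ → length (finite φ) ≡ n₀
      length-finite φ = trans (List.length-++ (gather m (λ c → gather (suc c) (λ t → each (m ∸ t) (φ c t)))))
        (cong₂ _+_ (length-blocks m φ (λ c → c)) (trans (length-gather m _)
            (ΣN-cong m (λ t _ → length-each (m ∸ suc t) (φ m (suc t))))))

      length-infinite : length infinite ≡ n₀
      length-infinite = trans (length-blocks m (λ c → cond∞ (suc c)) suc) (ℕ.+-cancelʳ-≡ m _ _
          (trans (ℕ.+-comm _ m) (trans (sym (ΣN-shift m (block m))) (sym n₀+m))))

      g = (d + 2) ∸ 3 * m

      length-sums : length sums ≡ width + ΣN M′ (λ r → g + r)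
      length-sums = trans (List.length-++ (each width (λ s x → tc 0ℤ s (F m (λ i j → fam i j x) 0))))
        (cong₂ _+_ (length-each width _) (trans (length-gather M′ _)
            (ΣN-cong M′ (λ r _ → trans (length-each (excess r) _) (ℕ.+-∸-comm r d-large)))))

      few : length conditions < N
      few = ℕ.≤-reflexive (trans (cong suc total-length) (trans
          (count-identity n₀ m M′ d g (ΣN M′ (λ r → g + r))
            (trans (cong (λ x → 6 * x + m * suc m * suc (suc m)) n₀+m) (blocks-closed m m ℕ.≤-refl))
            M-closed d-closed
            (sym (ℕ.m∸n+n≡m d-large)) (ramp M′ g))
          (cong (_* width) (sym pairs≡))))
        where
        total-length : length conditions ≡ n₀ + n₀ + n₀ + suc d + ΣN M′ (λ r → g + r)
        total-length = trans (List.length-++ (finite cond₀)) (trans (cong₂ _+_ (length-finite cond₀)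
            (trans (List.length-++ (finite cond₁)) (cong₂ _+_ (length-finite cond₁)
                (trans (List.length-++ infinite) (cong₂ _+_ length-infinite length-sums)))))
          (lem n₀ width (ΣN M′ (λ r → g + r))))
          where lem : ∀ a b c → a + (a + (a + (b + c))) ≡ a + a + a + b + c
                lem = solve-∀

    record Solution : Set where
      field
        A : ℕ → ℕ → Poly
        A-outside : ∀ i j → m < i + j → A i j ≈ 𝟘
        A-degree : ∀ i j → Deg width 0 (A i j)
        A-nonzero : Σ[ i ∈ ℕ ] Σ[ j ∈ ℕ ] i ≤ m × j ≤ m × ¬ Null (A i j)
        A-at-0 : At0 p pp m A 0
        A-at-1 : At1 p pp m A 0
        A-at-∞ : At∞ p pp m A width 0
        A-sums : ∀ r → r < M → Null (F m A r)

    private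
      module Extract (x : ℕ → ℤ) (zs : All (λ φ → Z (φ x)) conditions) where
        A : ℕ → ℕ → Poly
        A i j = fam i j x

        zs₁ = All.++⁻ʳ (finite cond₀) zs
        zs∞ = All.++⁻ʳ (finite cond₁) zs₁
        zsF = All.++⁻ʳ infinite zs∞

        finite-Z : ∀ φ → All (λ φ → Z (φ x)) (finite φ) → ∀ c t s → c ≤ m → t ≤ c → s < m ∸ t → ¬ (c ≡ m × t ≡ 0) → Z (φ c t s x)
        finite-Z φ h c t s c≤m t≤c s< ne with ℕ.m≤n⇒m<n∨m≡n c≤m
        ... | inj₁ c<m = each-All⁻ (m ∸ t) (φ c t) (gather-All⁻ (suc c) _ (gather-All⁻ m (λ c → gather (suc c) (λ t → each (m ∸ t) (φ c t))) (All.++⁻ˡ _ h) c c<m) t (s≤s t≤c)) s s<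
        finite-Z φ h c zero s c≤m t≤c s< ne | inj₂ refl = ⊥-elim (ne (refl , refl))
        finite-Z φ h c (suc t) s c≤m t≤c s< ne | inj₂ refl =
          each-All⁻ (m ∸ suc t) (φ m (suc t)) (gather-All⁻ m (λ t → each (m ∸ suc t) (φ m (suc t)))
            (All.++⁻ʳ (gather m (λ c → gather (suc c) (λ t → each (m ∸ t) (φ c t)))) h) t t≤c) s s<

        F₀ : Null (F m A 0)
        F₀ = null-coeffs (F m A 0) go
          where
          go : ∀ s → Z (tc 0ℤ s (F m A 0))
          go s with s <? width
          ... | yes l = each-All⁻ width _ (All.++⁻ˡ (each width (λ s x → tc 0ℤ s (F m (λ i j → fam i j x) 0))) zsF) s l
          ... | no h = coeff (closed-Σ (Deg-closed width 0) (suc m) _ (λ i _ → closed-Σ (Deg-closed width 0) (suc m) _ (λ j _ → fam-degree x i j)))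
                         s (ℕ.≤-trans (ℕ.≮⇒≥ h) (ℕ.m≤m+n s 0))

        partial₀ : ∀ i t s → i ≤ m → t ≤ m → s < m ∸ t → ¬ (i ≡ 0 × t ≡ 0) → Z (tc 0ℤ s (tay m (A i) t))
        partial₀ i t s i≤m t≤m s< ne with i + t ≤? m
        ... | no h = Z-resp (at (tay-vanish m (A i) t (λ j t≤j → fam-outside x i j (ℕ.<-≤-trans (ℕ.≰⇒> h) (ℕ.+-monoʳ-≤ i t≤j)))) 0ℤ s) Z-0
        ... | yes h = subst (λ i → Z (tc 0ℤ s (tay m (A i) t))) (ℕ.m∸[m∸n]≡n i≤m)
            (finite-Z cond₀ (All.++⁻ˡ (finite cond₀) zs) (m ∸ i) t s (ℕ.m∸n≤m m i)
                (ℕ.m+n≤o⇒m≤o∸n t (subst (_≤ m) (ℕ.+-comm i t) h)) s<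
               (λ (e , e′) → ne (ℕ.∸-cancelˡ-≡ {o = 0} i≤m z≤n e , e′)))

        partial₁ : ∀ j t s → j ≤ m → t ≤ m → s < m ∸ t → ¬ (j ≡ 0 × t ≡ 0) → Z (tc 1ℤ s (tay m (λ i → A i j) t))
        partial₁ j t s j≤m t≤m s< ne with t + j ≤? m
        ... | no h = Z-resp (at (tay-vanish m (λ i → A i j) t (λ i t≤i → fam-outside x i j (ℕ.<-≤-trans (ℕ.≰⇒> h) (ℕ.+-monoˡ-≤ j t≤i)))) 1ℤ s) Z-0
        ... | yes h = subst (λ j → Z (tc 1ℤ s (tay m (λ i → A i j) t))) (ℕ.m∸[m∸n]≡n j≤m)
            (finite-Z cond₁ (All.++⁻ˡ (finite cond₁) zs₁) (m ∸ j) t s (ℕ.m∸n≤m m j) (ℕ.m+n≤o⇒m≤o∸n t h) s<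
               (λ (e , e′) → ne (ℕ.∸-cancelˡ-≡ {o = 0} j≤m z≤n e , e′)))

        partial∞ : ∀ c t s → 1 ≤ c → c ≤ m → t ≤ c → width ≤ s + (m ∸ t) → Z (tc 0ℤ s (tay c (λ i → A i (c ∸ i)) t))
        partial∞ c@(suc c′) t s _ c≤m t≤c l with s <? width
        ... | no h = coeff (closed-Σ (Deg-closed width 0) (suc c) _ (λ i _ → cscal (Deg-closed width 0) _ (fam-degree x i (c ∸ i)))) s (ℕ.≤-trans (ℕ.≮⇒≥ h) (ℕ.m≤m+n s 0))
        ... | yes (s≤s s≤d) = subst (λ s → Z (tc 0ℤ s (tay c (λ i → A i (c ∸ i)) t))) (ℕ.m∸[m∸n]≡n s≤d)
            (each-All⁻ (m ∸ t) (cond∞ c t) (gather-All⁻ (suc c) (λ t → each (m ∸ t) (cond∞ c t))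
                (gather-All⁻ m (λ c → gather (suc (suc c)) (λ t → each (m ∸ t) (cond∞ (suc c) t)))
                    (All.++⁻ˡ infinite zs∞) c′ c≤m) t (s≤s t≤c))
              (d ∸ s) (ℕ.+-cancelˡ-≤ s _ _ (ℕ.≤-trans (ℕ.≤-reflexive
                  (trans (ℕ.+-suc s (d ∸ s)) (cong suc (ℕ.m+[n∸m]≡n s≤d)))) l)))

        at-0 : At0 p pp m A 0
        at-0 zero zero _ _ = ord λ s s< → Z-resp (at (tay-0 m (A 0)) 0ℤ s)
          (isolate 0ℤ s (suc m) (λ i → Σₚ (suc m) (A i)) 0 (s≤s z≤n)
            (λ { i (s≤s l) i≢0 → Z-resp (sym (at (tay-0 m (A i)) 0ℤ s))
                (partial₀ i 0 s l z≤n s< (λ (e , _) → i≢0 e)) }) (F₀ 0ℤ s))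
        at-0 zero (suc t) i≤m t≤m = ord λ s s< → partial₀ zero (suc t) s i≤m t≤m s< λ { (_ , ()) }
        at-0 (suc i) t i≤m t≤m = ord λ s s< → partial₀ (suc i) t s i≤m t≤m s< λ { (() , _) }

        at-1 : At1 p pp m A 0
        at-1 zero zero _ _ = ord λ s s< → Z-resp (at (tay-0 m (λ i → A i 0)) 1ℤ s)
          (isolate 1ℤ s (suc m) (λ j → Σₚ (suc m) (λ i → A i j)) 0 (s≤s z≤n)
            (λ { j (s≤s l) j≢0 → Z-resp (sym (at (tay-0 m (λ i → A i j)) 1ℤ s)) (partial₁ j 0 s l z≤n s< (λ (e , _) → j≢0 e)) })
            (Z-resp (sym (at (Σ-swap (suc m) (suc m) A) 1ℤ s)) (F₀ 1ℤ s)))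
        at-1 zero (suc t) i≤m t≤m = ord λ s s< → partial₁ zero (suc t) s i≤m t≤m s< λ { (_ , ()) }
        at-1 (suc i) t i≤m t≤m = ord λ s s< → partial₁ (suc i) t s i≤m t≤m s< λ { (() , _) }

        at-∞ : At∞ p pp m A width 0
        at-∞ zero zero _ _ = deg λ s l → Z-resp (at (tay-0 0 (λ i → A i 0)) 0ℤ s)
          (isolate 0ℤ s (suc m) (λ c → Σₚ (suc c) (λ i → A i (c ∸ i))) 0 (s≤s z≤n)
            (λ { zero _ c≢0 → ⊥-elim (c≢0 refl)
               ; (suc c) (s≤s c≤m) _ → Z-resp (sym (at (tay-0 (suc c) (λ i → A i (suc c ∸ i))) 0ℤ s))
                   (partial∞ (suc c) 0 s (s≤s z≤n) c≤m z≤n l) })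
            (Z-resp (sym (at (triangle-antidiagonal m A (fam-outside x)) 0ℤ s)) (F₀ 0ℤ s)))
        at-∞ (suc c) t c≤m t≤c = deg λ s l → partial∞ (suc c) t s (s≤s z≤n) c≤m t≤c l

        iterate : ∀ {P : ℕ → Set} → (∀ r → P r → P (suc r)) → P 0 → ∀ r → P r
        iterate h z zero = z
        iterate h z (suc r) = h r (iterate h z r)

        -- The orders at 0, 1 and ∞ are preserved by T. At 0 the prescribed coefficients raise the
        -- order to m + `excess r`, and then the zeros exhaust the degree bound.
        null-sums : ∀ r → r < M → Null (F m A r)
        null-sums zero _ = F₀
        null-sums (suc r) r<M = too-many-roots (suc r + width) m ((0ℤ , m + excess r) ∷ (1ℤ , m) ∷ []) (F m A (suc r))
            (((λ z → ¬Z-1 (Z-* -1ℤ z)) ∷ []) ∷ [] ∷ []) (F-at∞ p pp m A (fam-outside x) width (suc r)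
                (iterate {At∞ p pp m A width} (at∞-step p pp m A width) at-∞ (suc r)))
            (ord high ∷ F-at1 p pp m A (suc r) (iterate (at1-step p pp m A) at-1 (suc r)) ∷ []) enough
          where
          o₀ : Ord 0ℤ m (F m A (suc r))
          o₀ = F-at0 p pp m A (suc r) (iterate (at0-step p pp m A) at-0 (suc r))
          high : ∀ s → s < m + excess r → Z (tc 0ℤ s (F m A (suc r)))
          high s l with s <? m
          ... | yes s<m = taylor o₀ s s<m
          ... | no s≮m = subst (λ s → Z (tc 0ℤ s (F m A (suc r)))) (ℕ.m+[n∸m]≡n (ℕ.≮⇒≥ s≮m))
              (each-All⁻ (excess r) _ (gather-All⁻ M′ (λ r → each (excess r)
                  (λ s x → tc 0ℤ (m + s) (F m (λ i j → fam i j x) (suc r))))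
                 (All.++⁻ʳ (each width (λ s x → tc 0ℤ s (F m (λ i j → fam i j x) 0))) zsF) r (ℕ.≤-pred r<M))
                (s ∸ m) (ℕ.+-cancelˡ-< m _ _ (subst (_< m + excess r) (sym (ℕ.m+[n∸m]≡n (ℕ.≮⇒≥ s≮m))) l)))
          enough : suc r + width ≤ total ((0ℤ , m + excess r) ∷ (1ℤ , m) ∷ []) + m
          enough = ℕ.≤-trans (ℕ.≤-reflexive (lem₁ r d)) (ℕ.≤-trans (ℕ.m≤n+m∸n (d + 2 + r) (3 * m))
              (ℕ.≤-reflexive (lem₂ m (excess r))))
            where
            lem₁ : ∀ r d → suc r + suc d ≡ d + 2 + r
            lem₁ = solve-∀
            lem₂ : ∀ m e → 3 * m + e ≡ m + e + (m + 0) + m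
            lem₂ = solve-∀

        nonzero : ∀ q → q < N → ¬ Z (x q) → Σ[ i ∈ ℕ ] Σ[ j ∈ ℕ ] i ≤ m × j ≤ m × ¬ Null (A i j)
        nonzero q q<N nz with decode (q / width)
        ... | c , j , j≤c , eq = c ∸ j , j , ℕ.≤-trans (ℕ.m∸n≤m c j) c≤m , ℕ.≤-trans j≤c c≤m , λ null → nz
              (Z-resp (sym (trans (fam-coefficient x (c ∸ j) j (q % width) (subst (_≤ m) (sym c≡) c≤m) (ℕ.m%n<n q width))
                 (cong x (trans (cong (λ y → q % width + y * width) (trans (cong (λ y → offset y + j) c≡) (sym eq)))
                     (sym (ℕ.m≡m%n+[m/n]*n q width)))))) (null 0ℤ (q % width)))
          where
          c≡ : c ∸ j + j ≡ c
          c≡ = ℕ.m∸n+n≡m j≤c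
          c≤m : c ≤ m
          c≤m with c ≤? m
          ... | yes l = l
          ... | no h = ⊥-elim (ℕ.<⇒≱ (ℕ.m<n*o⇒m/o<n {q} {offset (suc m)} {width} q<N)
                 (ℕ.≤-trans (offset-mono (ℕ.≰⇒> h)) (ℕ.≤-trans (ℕ.m≤m+n (offset c) j) (ℕ.≤-reflexive (sym eq)))))

    solution : Solution
    solution = build (common-zero N conditions conditions-linear few)
      where
      build : Σ[ x ∈ (ℕ → ℤ) ] (Σ[ q ∈ ℕ ] q < N × ¬ Z (x q)) × All (λ φ → Z (φ x)) conditions → Solution
      build (x , (q , q<N , nz) , zs) = record
        { A = Extract.A x zs ; A-outside = fam-outside x ; A-degree = fam-degree x ; A-nonzero = Extract.nonzero x zs q q<N nz
        ; A-at-0 = Extract.at-0 x zs ; A-at-1 = Extract.at-1 x zs ; A-at-∞ = Extract.at-∞ x zs ; A-sums = Extract.null-sums x zs }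

-- The bound for the number of w

module PointBound where
  open Expressions
  open Operators
  open Localisation
  open Derivation
  open AuxiliaryPolynomial
  open NonVanishing
  open LinearSystems
  open Construction
  open import Data.Nat using (_+_; _*_; _∸_; _≤_; _<_)
  open import Data.Nat.Tactic.RingSolver using (solve-∀)

  length-row : ∀ i n → length (row i n) ≡ n
  length-row i zero = refl
  length-row i (suc n) = cong suc (length-row i n)

  length-rows : ∀ m n → n ≤ suc m → length (rows m n) + offset (suc m ∸ n) ≡ offset (suc m)
  length-rows m zero _ = refl
  length-rows m (suc n) (s≤s l) = trans (cong (_+ offset (m ∸ n))
      (trans (List.length-++ (row n (suc m ∸ n))) (cong (_+ length (rows m n)) (length-row n _))))
      (trans (arith (suc m ∸ n) (length (rows m n)) (offset (m ∸ n)))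
        (trans (cong (λ z → length (rows m n) + z) peel) (length-rows m n (ℕ.m≤n⇒m≤1+n l))))
    where
    arith : ∀ a b c → a + b + c ≡ b + (c + a)
    arith = solve-∀
    peel : offset (m ∸ n) + (suc m ∸ n) ≡ offset (suc m ∸ n)
    peel rewrite ℕ.+-∸-assoc 1 l = refl

  length-triangle : ∀ m → length (triangle m) ≡ suc (order m)
  length-triangle m = trans (sym (ℕ.+-identityʳ _)) (trans (cong (λ x → length (triangle m) + offset x) (sym (ℕ.n∸n≡0 m)))
      (trans (length-rows m (suc m) ℕ.≤-refl) (ℕ.+-suc (offset m) m)))

  indicator : ∀ {P : Set} → Dec P → ℕ
  indicator (yes _) = 1
  indicator (no _) = 0

  module Bound (p : ℕ) (pp : Prime p) (k m : ℕ) (α β : ℤ) where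
    open Local p pp
    open Family k
    open Auxiliary k α β

    Point : ℤ → Set
    Point w = ¬ Z w × ¬ Z (1ℤ ℤ.- w) × α ℤ.* w ℤ.^ k ≅ 1ℤ × β ℤ.* (1ℤ ℤ.- w) ℤ.^ k ≅ 1ℤ

    -- For α = a⁻ᵏ and β = b⁻ᵏ the conditions say that 1/b, 1/a and -b/a are n-th powers modulo p,
    -- that is, that the curve has points with x = 0, y = 0 and z = 0.
    τ : ℕ
    τ = indicator (Z? (β ℤ.- 1ℤ)) + indicator (Z? (α ℤ.- 1ℤ)) + indicator (Z? (α ℤ.- β ℤ.* -1ℤ ℤ.^ k))

    module _ (1≤k : 1 ≤ k) (k<p : k < p) (1≤m : 1 ≤ m) (m≤k : m ≤ k) (small : k * m + m < p) (M≤p : order m ≤ p)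
      (ws : List ℤ) (distinct : AllPairs (λ v w → ¬ Z (v ℤ.- w)) ws) (points : All Point ws) where

      private
        -- A place without points of the curve stays in the list of zeros with multiplicity 0, so
        -- one list serves for all eight cases.
        scaled : ∀ {P : Set} → Dec P → ℕ
        scaled P? = m * indicator P?

        e₀ = scaled (Z? (β ℤ.- 1ℤ))
        e₁ = scaled (Z? (α ℤ.- 1ℤ))
        e∞ = scaled (Z? (α ℤ.- β ℤ.* -1ℤ ℤ.^ k))

        zeros : List (ℤ × ℕ)
        zeros = (0ℤ , e₀) ∷ (1ℤ , e₁) ∷ map (λ w → w , order m) ws

        total-map : ∀ e (ws : List ℤ) → total (map (λ w → w , e) ws) ≡ e * length ws
        total-map e [] = sym (ℕ.*-zeroʳ e)
        total-map e (w ∷ ws) = trans (cong (e +_) (total-map e ws)) (sym (ℕ.*-suc e (length ws)))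

        Z-minus0 : ∀ w → Z (0ℤ ℤ.- w) → Z w
        Z-minus0 w z = ≅-Z {w} {0ℤ} (≅-sym (mk≅ {0ℤ} {w} z)) Z-0

        apart : AllPairs Apart zeros
        apart = ((λ z → ¬Z-1 (Z-* -1ℤ z)) ∷ All.map⁺ (All.map (λ {w} (nw , _) z → nw (Z-minus0 w z)) points))
              ∷ All.map⁺ (All.map (λ (_ , nv , _) → nv) points)
              ∷ AllPairs.map⁺ distinct

        module Contradiction (A : ℕ → ℕ → Poly) (d : ℕ)
            (outside : ∀ i j → m < i + j → A i j ≈ 𝟘)
            (A-degree : ∀ i j → Deg (suc d) 0 (A i j))
            (nonzero : Σ[ i ∈ ℕ ] Σ[ j ∈ ℕ ] i ≤ m × j ≤ m × ¬ Null (A i j))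
            (at-0 : At0 p pp m A 0) (at-1 : At1 p pp m A 0) (at-∞ : At∞ p pp m A (suc d) 0)
            (sums : ∀ r → r < order m → Null (F m A r))
            (large : d + m * k < total zeros + e∞) where

          ord₀ : (dec : Dec (Z (β ℤ.- 1ℤ))) → Ord 0ℤ (scaled dec) (Φ m A)
          ord₀ (yes z) = Ord-weaken (ℕ.≤-reflexive (ℕ.*-identityʳ m)) (Φ-at-0 p pp m A m≤k (mk≅ z) at-0)
          ord₀ (no _) = Ord-weaken (ℕ.≤-reflexive (ℕ.*-zeroʳ m)) (Ord-0 p pp 0ℤ _)

          ord₁ : (dec : Dec (Z (α ℤ.- 1ℤ))) → Ord 1ℤ (scaled dec) (Φ m A)
          ord₁ (yes z) = Ord-weaken (ℕ.≤-reflexive (ℕ.*-identityʳ m)) (Φ-at-1 p pp m A m≤k (mk≅ z) at-1)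
          ord₁ (no _) = Ord-weaken (ℕ.≤-reflexive (ℕ.*-zeroʳ m)) (Ord-0 p pp 1ℤ _)

          deg∞ : (dec : Dec (Z (α ℤ.- β ℤ.* -1ℤ ℤ.^ k))) → Deg (m * k + suc d) (scaled dec) (Φ m A)
          deg∞ (yes z) = Deg-weaken (λ s l → ℕ.≤-trans l (ℕ.≤-reflexive (cong (s +_) (ℕ.*-identityʳ m))))
              (Φ-at-∞ p pp m A (suc d) m≤k (mk≅ z) outside A-degree at-∞)
          deg∞ (no _) = Deg-weaken (λ s l → ℕ.≤-trans l (ℕ.≤-reflexive (cong (s +_) (ℕ.*-zeroʳ m))))
              (Deg-Φ p pp m A (suc d) outside A-degree)

          null-Φ : Null (Φ m A)
          null-Φ = too-many-roots (m * k + suc d) e∞ zeros (Φ m A) apart (deg∞ (Z? _))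
            (ord₀ (Z? _) ∷ ord₁ (Z? _) ∷ All.map⁺ (All.map (λ (nw , nv , αw , βv) →
                Φ-at-point p pp m A nw nv αw βv (order m) M≤p (λ r r<M → sums r r<M _ 0)) points))
            (ℕ.≤-trans (ℕ.≤-reflexive (trans (ℕ.+-suc (m * k) d) (cong suc (ℕ.+-comm (m * k) d)))) large)

          contradiction : ⊥
          contradiction = let (i , j , i≤m , j≤m , nn) = nonzero in
            nn (Nonvanishing.Φ-nonzero p pp k α β m A outside (order m)
                (length-triangle m) 1≤k k<p m≤k small sums null-Φ i j i≤m j≤m)

        from-solution : ∀ M′ → order m ≡ suc M′ → degree m + m * k < total zeros + e∞ → 3 * m ≤ degree m + 2 → ⊥
        from-solution M′ eq large d-large = Contradiction.contradiction A
            (degree m) A-outside A-degree A-nonzero A-at-0 A-at-1 A-at-∞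
            (λ r l → A-sums r (subst (r <_) eq l)) large
          where
          open Conditions.Solution (Conditions.solution p pp k m (degree m) M′ d-large
            (trans (ℕ.+-suc (offset m) m) (cong suc eq)) (trans (cong (2 *_) (sym eq)) (order-closed m)) (degree-closed m))

        main : ∀ m′ → m ≡ suc m′ → ¬ (degree m + m * k < total zeros + e∞)
        main m′ eq l = from-solution (offset m + m′) (trans (cong (offset m +_) eq) (ℕ.+-suc (offset m) m′)) l
            (subst (λ m → 3 * m ≤ degree m + 2) (sym eq) (degree-large m′))

      weighted-count : order m * length ws + m * τ ≤ degree m + m * k
      weighted-count = ℕ.≤-trans (ℕ.≤-reflexive (trans (lem m (order m * length ws) (indicator (Z? (β ℤ.- 1ℤ)))
          (indicator (Z? (α ℤ.- 1ℤ))) (indicator (Z? (α ℤ.- β ℤ.* -1ℤ ℤ.^ k))))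
            (cong (λ x → e₀ + (e₁ + x) + e∞) (sym (total-map (order m) ws)))))
          (ℕ.≮⇒≥ (main (ℕ.pred m) (sym (ℕ.suc-pred m ⦃ ℕ.>-nonZero 1≤m ⦄))))
        where lem : ∀ m a x y z → a + m * (x + y + z) ≡ m * x + (m * y + a) + m * z
              lem = solve-∀

      -- With the closed forms inserted, eight times the weighted count has a factor m throughout,
      -- which cancels. The term 5m stands on the left to avoid a subtraction.
      cleared-count : 4 * (m + 3) * length ws + 8 * τ + 5 * m ≤ 8 * k + 10 + m * m * m + 2 * (m * m)
      cleared-count = ℕ.*-cancelˡ-≤ m ⦃ ℕ.>-nonZero 1≤m ⦄ (begin
          m * (4 * (m + 3) * W + 8 * τ + 5 * m)
            ≡⟨ l1 m W τ ⟩
          4 * (m * (m + 3)) * W + 8 * (m * τ) + 5 * (m * m)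
            ≡⟨ cong (λ x → 4 * x * W + 8 * (m * τ) + 5 * (m * m)) (sym (order-closed m)) ⟩
          4 * (2 * order m) * W + 8 * (m * τ) + 5 * (m * m)
            ≡⟨ l2 (order m) W (m * τ) (5 * (m * m)) ⟩
          8 * (order m * W + m * τ) + 5 * (m * m)
            ≤⟨ ℕ.+-monoˡ-≤ (5 * (m * m)) (ℕ.*-monoʳ-≤ 8 weighted-count) ⟩
          8 * (degree m + m * k) + 5 * (m * m)
            ≡⟨ l3 (degree m) (m * k) (5 * (m * m)) ⟩
          (8 * degree m + 5 * (m * m)) + 8 * (m * k)
            ≡⟨ cong (_+ 8 * (m * k)) (degree-closed m) ⟩
          m * m * m * m + 2 * (m * m * m) + 10 * m + 8 * (m * k)
            ≡⟨ l4 m k ⟩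
          m * (8 * k + 10 + m * m * m + 2 * (m * m)) ∎)
        where
        open ℕ.≤-Reasoning
        W = length ws
        l1 : ∀ m W τ → m * (4 * (m + 3) * W + 8 * τ + 5 * m) ≡ 4 * (m * (m + 3)) * W + 8 * (m * τ) + 5 * (m * m)
        l1 = solve-∀
        l2 : ∀ M W τ x → 4 * (2 * M) * W + 8 * τ + x ≡ 8 * (M * W + τ) + x
        l2 = solve-∀
        l3 : ∀ d e x → 8 * (d + e) + x ≡ (8 * d + x) + 8 * e
        l3 = solve-∀
        l4 : ∀ m k → m * m * m * m + 2 * (m * m * m) + 10 * m + 8 * (m * k)
           ≡ m * (8 * k + 10 + m * m * m + 2 * (m * m))
        l4 = solve-∀

-- Counting in lists, Fermat's little theorem, roots of b yⁿ = c

module Counting where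
  open Expressions
  open Operators
  open Localisation
  open AuxiliaryPolynomial
  open PointBound
  open import Data.Integer using (+_; _+_; _*_; -_; _-_; _^_)
  open import Data.Integer.Tactic.RingSolver using (solve-∀)

  count : ∀ {A : Set} {P : A → Set} → Decidable P → List A → ℕ
  count P? xs = length (filter P? xs)

  sumOver : ∀ {A : Set} → (A → ℕ) → List A → ℕ
  sumOver f xs = sum (map f xs)

  count≡sum : ∀ {A : Set} {P : A → Set} (P? : Decidable P) xs → count P? xs ≡ sumOver (λ x → indicator (P? x)) xs
  count≡sum P? [] = refl
  count≡sum P? (x ∷ xs) with P? x
  ... | yes _ = cong suc (count≡sum P? xs)
  ... | no _ = count≡sum P? xs

  sum-mono : ∀ {A : Set} (f g : A → ℕ) {xs} → All (λ x → f x ℕ.≤ g x) xs → sumOver f xs ℕ.≤ sumOver g xs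
  sum-mono f g [] = z≤n
  sum-mono f g (h ∷ hs) = ℕ.+-mono-≤ h (sum-mono f g hs)

  sum-add : ∀ {A : Set} (f g : A → ℕ) xs → sumOver (λ x → f x ℕ.+ g x) xs ≡ sumOver f xs ℕ.+ sumOver g xs
  sum-add f g [] = refl
  sum-add f g (x ∷ xs) = trans (cong (f x ℕ.+ g x ℕ.+_) (sum-add f g xs)) (lem (f x) (g x) _ _)
    where lem : ∀ a b c d → a ℕ.+ b ℕ.+ (c ℕ.+ d) ≡ a ℕ.+ c ℕ.+ (b ℕ.+ d)
          lem = ℕSolver.solve-∀

  sum-scale : ∀ {A : Set} c (f : A → ℕ) xs → sumOver (λ x → c ℕ.* f x) xs ≡ c ℕ.* sumOver f xs
  sum-scale c f [] = sym (ℕ.*-zeroʳ c)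
  sum-scale c f (x ∷ xs) = trans (cong (c ℕ.* f x ℕ.+_) (sum-scale c f xs)) (sym (ℕ.*-distribˡ-+ c (f x) _))

  sum-zero : ∀ {A : Set} (xs : List A) → sumOver (λ _ → 0) xs ≡ 0
  sum-zero [] = refl
  sum-zero (x ∷ xs) = sum-zero xs

  sum-bounded : ∀ {A : Set} c (f : A → ℕ) {xs} → All (λ x → f x ℕ.≤ c) xs → sumOver f xs ℕ.≤ c ℕ.* length xs
  sum-bounded c f [] = z≤n
  sum-bounded c f {x ∷ xs} (h ∷ hs) = ℕ.≤-trans (ℕ.+-mono-≤ h (sum-bounded c f hs)) (ℕ.≤-reflexive (sym (ℕ.*-suc c (length xs))))

  sum-swap : ∀ {A B : Set} (f : A → B → ℕ) xs ys → sumOver (λ x → sumOver (f x) ys) xs ≡ sumOver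
      (λ y → sumOver (λ x → f x y) xs) ys
  sum-swap f [] ys = sym (sum-zero ys)
  sum-swap f (x ∷ xs) ys = trans (cong (sumOver (f x) ys ℕ.+_) (sum-swap f xs ys)) (sym (sum-add (f x) _ ys))

  indicator-mono : ∀ {P Q : Set} (P? : Dec P) (Q? : Dec Q) → (P → Q) → indicator P? ℕ.≤ indicator Q?
  indicator-mono (no _) _ h = z≤n
  indicator-mono (yes p) (yes _) h = s≤s z≤n
  indicator-mono (yes p) (no nq) h = ⊥-elim (nq (h p))

  indicator-yes : ∀ {P : Set} (P? : Dec P) → P → indicator P? ≡ 1
  indicator-yes (yes _) _ = refl
  indicator-yes (no n) p = ⊥-elim (n p)

  count-++ : ∀ {A : Set} {P : A → Set} (P? : Decidable P) xs ys → count P? (xs ++ ys) ≡ count P? xs ℕ.+ count P? ys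
  count-++ P? xs ys = trans (cong length (List.filter-++ P? xs ys)) (List.length-++ (filter P? xs))

  count-map : ∀ {A B : Set} {P : B → Set} (P? : Decidable P) (f : A → B) xs → count P? (map f xs) ≡ count (λ x → P? (f x)) xs
  count-map P? f [] = refl
  count-map P? f (x ∷ xs) with P? (f x)
  ... | yes _ = cong suc (count-map P? f xs)
  ... | no _ = count-map P? f xs

  count-concatMap : ∀ {A B : Set} {P : B → Set} (P? : Decidable P) (f : A → List B) xs
      → count P? (concatMap f xs) ≡ sumOver (λ x → count P? (f x)) xs
  count-concatMap P? f [] = refl
  count-concatMap P? f (x ∷ xs) = trans (count-++ P? (f x) (concatMap f xs))
      (cong (count P? (f x) ℕ.+_) (count-concatMap P? f xs))

  count-split : ∀ {A : Set} {P Q R : A → Set} (P? : Decidable P) (Q? : Decidable Q) (R? : Decidable R) {xs}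
    → All (λ x → P x → Q x ⊎ R x) xs → count P? xs ℕ.≤ count Q? xs ℕ.+ count R? xs
  count-split P? Q? R? {xs} h rewrite count≡sum P? xs | count≡sum Q? xs | count≡sum R? xs =
    ℕ.≤-trans (sum-mono _ (λ x → indicator (Q? x) ℕ.+ indicator (R? x))
        (All.map (λ {x} → cases (P? x) (Q? x) (R? x)) h)) (ℕ.≤-reflexive (sum-add _ _ xs))
    where
    cases : ∀ {P Q R : Set} (P? : Dec P) (Q? : Dec Q) (R? : Dec R) → (P → Q ⊎ R) → indicator P? ℕ.≤ indicator Q? ℕ.+ indicator R?
    cases (no _) _ _ h = z≤n
    cases (yes p) (yes _) _ h = s≤s z≤n
    cases (yes p) (no nq) R? h with h p
    ... | inj₁ q = ⊥-elim (nq q)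
    ... | inj₂ r = ℕ.≤-reflexive (sym (indicator-yes R? r))

  count-none : ∀ {A : Set} {P : A → Set} (P? : Decidable P) {xs} → All (λ x → ¬ P x) xs → count P? xs ≡ 0
  count-none P? h = cong length (List.filter-none P? h)

  -- A single point on a coordinate line already forces the condition that τ registers; if the
  -- condition fails, the line is empty.
  count-conditional : ∀ {A : Set} {P : A → Set} {C : Set} (P? : Decidable P) (C? : Dec C) n {xs}
    → All (λ x → P x → C) xs → count P? xs ℕ.≤ n → count P? xs ℕ.≤ n ℕ.* indicator C?
  count-conditional P? (yes _) n h l = ℕ.≤-trans l (ℕ.≤-reflexive (sym (ℕ.*-identityʳ n)))
  count-conditional P? (no nc) n h l = ℕ.≤-trans (ℕ.≤-reflexive (count-none P? (All.map (λ f p → nc (f p)) h))) z≤n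

  count-∷ : ∀ {A : Set} {P : A → Set} (P? : Decidable P) x xs → count P? (x ∷ xs) ≡ indicator (P? x) ℕ.+ count P? xs
  count-∷ P? x xs with P? x
  ... | yes _ = refl
  ... | no _ = refl

  count-unique : ∀ v {xs : List ℕ} → Unique xs → count (ℕ._≟ v) xs ℕ.≤ 1
  count-unique v [] = z≤n
  count-unique v (_∷_ {x} {xs} a u) = ℕ.≤-trans (ℕ.≤-reflexive (count-∷ (ℕ._≟ v) x xs)) (cases (x ℕ.≟ v))
    where
    cases : (x≟v : Dec (x ≡ v)) → indicator x≟v ℕ.+ count (ℕ._≟ v) xs ℕ.≤ 1
    cases (yes refl) = s≤s (ℕ.≤-reflexive (count-none (ℕ._≟ v) (All.map (λ ne e → ne (sym e)) a)))
    cases (no _) = count-unique v u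

  pos-^ : ∀ x n → + (x ℕ.^ n) ≡ (+ x) ^ n
  pos-^ x zero = refl
  pos-^ x (suc n) = trans (ℤ.pos-* x (x ℕ.^ n)) (cong (+ x *_) (pos-^ x n))

  module Fermat (p : ℕ) (pp : Prime p) where
    open Local p pp

    Z-p : Z (+ p)
    Z-p = divides 1ℤ (sym (ℤ.*-identityˡ (+ p)))

    -- Modulo p, the relation t C(p,t) + (t+1) C(p,t+1) = p C(p,t) gives t C(p,t) = 0 for all t.
    p∣tC : ∀ t → Z (+ (t ℕ.* (p C t)))
    p∣tC zero = Z-0
    p∣tC (suc t) = Z-resp (trans (lem (+ (t ℕ.* (p C t))) (+ (suc t ℕ.* (p C suc t)))) (cong (_- + (t ℕ.* (p C t)))
        (trans (sym (ℤ.pos-+ (t ℕ.* (p C t)) (suc t ℕ.* (p C suc t))))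
            (trans (cong +_ (sym (C-absorb p t))) (ℤ.pos-* p (p C t))))))
        (Z-- (Z-*ʳ (+ (p C t)) Z-p) (p∣tC t))
      where
      lem : ∀ x y → y ≡ (x + y) - x
      lem = solve-∀

    p∣C : ∀ t → 0 ℕ.< t → t ℕ.< p → Z (+ (p C t))
    p∣C t 0<t t<p = Z-cancel (+ t) (¬Z-pos t 0<t t<p) (Z-resp (sym (ℤ.pos-* t (p C t))) (p∣tC t))

    ΣZ-first : ∀ n f → (∀ t → 0 ℕ.< t → t ℕ.< suc n → Z (f t)) → ΣZ (suc n) f ≅ f 0
    ΣZ-first zero f h = ≅-reflexive (ℤ.+-identityˡ (f 0))
    ΣZ-first (suc n) f h = ≅-trans (≅-+ (ΣZ-first n f (λ t x y → h t x (ℕ.m<n⇒m<1+n y)))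
        (Z→≅0 (h (suc n) (s≤s z≤n) (ℕ.n<1+n (suc n)))))
      (≅-reflexive (ℤ.+-identityʳ (f 0)))

    1≤p : 1 ℕ.≤ p
    1≤p = ℕ.<⇒≤ 1<p

    -- The binomial theorem is `power` for the scalar operators x + 1, x and 1 applied to `𝟙`;
    -- modulo p its inner terms vanish.
    freshman : ∀ x → (x + 1ℤ) ^ p ≅ x ^ p + 1ℤ
    freshman x = ≅-trans (≅-reflexive expansion)
        (≅-trans (≅-+ first (≅-reflexive (trans (cong (λ c → + c * x ^ p) (nCn≡1 p)) (ℤ.*-identityˡ (x ^ p)))))
            (≅-reflexive (ℤ.+-comm 1ℤ (x ^ p))))
      where
      scale : ∀ c n → tc 0ℤ 0 (iter (c ·_) n 𝟙) ≡ c ^ n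
      scale c zero = refl
      scale c (suc n) = cong (c *_) (scale c n)
      distrib : ∀ x y → (x + 1ℤ) * y ≡ x * y + y
      distrib = solve-∀
      open Binomial {λ f → (x + 1ℤ) · f} {λ f → x · f} {λ f → f} (l· (x + 1ℤ) lid) (l· x lid) lid
        (λ f → mk λ w s → distrib x (tc w s f)) (λ _ → ≈-refl)
      value : ∀ t → tc 0ℤ 0 (term p t 𝟙) ≡ x ^ t
      value t = trans (cong (λ f → tc 0ℤ 0 (iter (x ·_) t f)) (iter-id (p ℕ.∸ t) 𝟙)) (scale x t)
      summand : ℕ → ℤ
      summand t = + (p C t) * x ^ t
      expansion : (x + 1ℤ) ^ p ≡ ΣZ (suc p) summand
      expansion = trans (sym (scale (x + 1ℤ) p)) (trans (at (power p p 0 𝟙 (ℕ.+-identityʳ p)) 0ℤ 0)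
        (trans (tc-Σ 0ℤ 0 (suc p) (λ t → + (p C t) · term p t 𝟙)) (ΣZ-cong (suc p) (λ t _ → cong (+ (p C t) *_) (value t)))))
      first : ΣZ p summand ≅ 1ℤ
      first = subst (λ q → ΣZ q summand ≅ 1ℤ) (ℕ.suc-pred p ⦃ ℕ.>-nonZero 1≤p ⦄)
        (ΣZ-first (ℕ.pred p) summand (λ t 0<t t<p → Z-*ʳ (x ^ t)
            (p∣C t 0<t (subst (t ℕ.<_) (ℕ.suc-pred p ⦃ ℕ.>-nonZero 1≤p ⦄) t<p))))

    x^p≅x : ∀ x → (+ x) ^ p ≅ + x
    x^p≅x zero = subst (λ q → 0ℤ ^ q ≅ 0ℤ) (ℕ.suc-pred p ⦃ ℕ.>-nonZero 1≤p ⦄) ≅-refl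
    x^p≅x (suc x) = ≅-trans (≅-reflexive (cong (_^ p) (ℤ.+-comm 1ℤ (+ x))))
        (≅-trans (freshman (+ x)) (≅-trans (≅-+ (x^p≅x x) (≅-refl {1ℤ})) (≅-reflexive (ℤ.+-comm (+ x) 1ℤ))))

    little : ∀ x → ¬ Z (+ x) → (+ x) ^ (p ℕ.∸ 1) ≅ 1ℤ
    little x nz = mk≅ (Z-cancel (+ x) nz (Z-resp (lem (+ x) ((+ x) ^ (p ℕ.∸ 1)))
        (difference (subst (λ q → (+ x) ^ q ≅ + x) (sym (ℕ.m+[n∸m]≡n 1≤p)) (x^p≅x x)))))
      where lem : ∀ x y → x * (y - 1ℤ) ≡ x * y - x
            lem = solve-∀

    distinct-residues : ∀ {x y} → x ℕ.< p → y ℕ.< p → Z (+ x - + y) → x ≡ y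
    distinct-residues {x} {y} x<p y<p z with ℕ.<-cmp x y
    ... | tri≈ _ e _ = e
    ... | tri> _ _ y<x = ⊥-elim (¬Z-pos (x ℕ.∸ y) (ℕ.m<n⇒0<n∸m y<x) (ℕ.≤-<-trans (ℕ.m∸n≤m x y) x<p)
            (Z-resp (sym (trans (ℤ.m-n≡m⊖n x y) (ℤ.⊖-≥ (ℕ.<⇒≤ y<x)))) z))
    ... | tri< x<y _ _ = ⊥-elim (¬Z-pos (y ℕ.∸ x) (ℕ.m<n⇒0<n∸m x<y) (ℕ.≤-<-trans (ℕ.m∸n≤m y x) y<p)
            (Z-resp (sym (trans (ℤ.m-n≡m⊖n y x) (ℤ.⊖-≥ (ℕ.<⇒≤ x<y)))) (difference (≅-sym (mk≅ {+ x} {+ y} z)))))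

    -- More than n solutions would make b uⁿ - c zero modulo p, yet its coefficient at uⁿ is b.
    few-power-roots : ∀ n → 1 ℕ.≤ n → ∀ b c → ¬ Z b → {P : ℕ → Set} (P? : Decidable P)
      → (∀ y → y ℕ.< p → P y → b * (+ y) ^ n ≅ c) → count P? (upTo p) ℕ.≤ n
    few-power-roots n 1≤n b c nb {P} P? h = ℕ.≮⇒≥ λ l → nb (Z-resp top (too-many-roots (suc n) 0 zs f
        (AllPairs.map⁺ apart) degree-f (All.map⁺ (All.map root members))
            (ℕ.≤-trans l (ℕ.≤-reflexive (sym (trans (ℕ.+-identityʳ _) (total-ones ys))))) 0ℤ n))
      where
      ys = filter P? (upTo p)
      zs = map (λ y → + y , 1) ys
      f = (b · iter U n 𝟙) ⊕ ((- c) · 𝟙)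
      members : All (λ y → y ℕ.< p × P y) ys
      members = All.zip (All.filter⁺ P? (All.all-upTo p) , All.all-filter P? (upTo p))
      total-ones : ∀ ys → total (map (λ y → + y , 1) ys) ≡ length ys
      total-ones [] = refl
      total-ones (y ∷ ys) = cong suc (total-ones ys)
      apart : AllPairs (λ y y′ → Apart (+ y , 1) (+ y′ , 1)) ys
      apart = go members (Unique.filter⁺ P? (Unique.upTo⁺ p))
        where
        go : ∀ {ys} → All (λ y → y ℕ.< p × P y) ys → Unique ys → AllPairs (λ y y′ → Apart (+ y , 1) (+ y′ , 1)) ys
        go [] [] = []
        go ((y<p , _) ∷ ms) (ne ∷ u) = All.map (λ (ne , (y′<p , _)) z → ne (distinct-residues y<p y′<p z))
            (All.zip (ne , ms)) ∷ go ms u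
      tc-power : ∀ s → tc 0ℤ (n ℕ.+ s) (iter U n 𝟙) ≡ tc 0ℤ s 𝟙
      tc-power s = top-U p pp n s 𝟙
        -- Placeholder parameters: `top-U` mentions neither k nor α nor β.
        where open Auxiliary 0 0ℤ 0ℤ using (top-U)
      constant : ∀ s → 1 ℕ.≤ s → tc 0ℤ s 𝟙 ≡ 0ℤ
      constant (suc s) _ = refl
      top : b ≡ tc 0ℤ n f
      top = sym (trans (cong₂ (λ x y → b * x + (- c) * y) (trans
          (cong (λ s → tc 0ℤ s (iter U n 𝟙)) (sym (ℕ.+-identityʳ n))) (tc-power 0)) (constant n 1≤n)) (lem b c))
        where lem : ∀ b c → b * 1ℤ + (- c) * 0ℤ ≡ b
              lem = solve-∀
      degree-f : Deg (suc n) 0 f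
      degree-f = deg λ s l → Z-resp (trans (cong₂ (λ x y → b * x + (- c) * y)
          (trans (cong (λ s → tc 0ℤ s (iter U n 𝟙)) (sym (ℕ.m+[n∸m]≡n (n≤ s l))))
              (trans (tc-power (s ℕ.∸ n)) (constant (s ℕ.∸ n) (ℕ.m<n⇒0<n∸m (n< s l)))))
          (constant s (ℕ.≤-trans (s≤s z≤n) (n< s l)))) (lem b c)) Z-0
        where
        lem : ∀ b c → b * 0ℤ + (- c) * 0ℤ ≡ 0ℤ
        lem = solve-∀
        n< : ∀ s → suc n ℕ.≤ s ℕ.+ 0 → n ℕ.< s
        n< s l = subst (n ℕ.<_) (ℕ.+-identityʳ s) l
        n≤ : ∀ s → suc n ℕ.≤ s ℕ.+ 0 → n ℕ.≤ s
        n≤ s l = ℕ.<⇒≤ (n< s l)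
      root : ∀ {y} → y ℕ.< p × P y → Ord (+ y) 1 f
      root {y} (y<p , Py) = ord λ { zero _ → Z-resp (trans (cong (λ x → b * x + (- c) * 1ℤ) (tc-Uⁿ (+ y) n 𝟙))
          (lem b ((+ y) ^ n) c)) (difference (h y y<p Py)) ; (suc s) (s≤s ()) }
        where lem : ∀ b x c → b * (x * 1ℤ) + (- c) * 1ℤ ≡ b * x - c
              lem = solve-∀

-- From points of the Fermat curve to the residues w

module FermatCurve where
  open Expressions
  open Localisation
  open PointBound
  open Counting
  open import Data.Integer using (+_; _+_; _*_; -_; _-_; _^_)
  open import Data.Integer.Tactic.RingSolver using (solve-∀)

  *-^ : ∀ x y n → (x * y) ^ n ≡ x ^ n * y ^ n
  *-^ x y zero = refl
  *-^ x y (suc n) = trans (cong (x * y *_) (*-^ x y n)) (lem x y (x ^ n) (y ^ n))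
    where lem : ∀ x y u v → x * y * (u * v) ≡ x * u * (y * v)
          lem = solve-∀

  indicator-∈ : ∀ v {xs : List ℕ} → v ∈ xs → 1 ℕ.≤ sumOver (λ w → indicator (v ℕ.≟ w)) xs
  indicator-∈ v {x ∷ xs} (here refl) = ℕ.≤-trans (ℕ.≤-reflexive (sym (indicator-yes (x ℕ.≟ x) refl))) (ℕ.m≤m+n _ _)
  indicator-∈ v {x ∷ xs} (there v∈) = ℕ.≤-trans (indicator-∈ v v∈) (ℕ.m≤n+m _ _)

  module Curve (p : ℕ) .⦃ _ : NonZero p ⦄ (pp : Prime p) (a b : ℕ) (0<a : 0 ℕ.< a) (a<p : a ℕ.< p) (0<b : 0 ℕ.< b) (b<p : b ℕ.< p)
      (n k : ℕ) (1≤n : 1 ℕ.≤ n) (kn : k ℕ.* n ≡ p ℕ.∸ 1) (m : ℕ) where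
    open Local p pp
    open Fermat p pp

    n′ : ℕ
    n′ = ℕ.pred n

    n≡ : suc n′ ≡ n
    n≡ = ℕ.suc-pred n ⦃ ℕ.>-nonZero 1≤n ⦄

    -- Since (aᵏ)ⁿ = aᵖ⁻¹ = 1 modulo p, the power of aᵏ with exponent n - 1 is its inverse; likewise
    -- for b.
    α β : ℤ
    α = ((+ a) ^ k) ^ n′
    β = ((+ b) ^ k) ^ n′

    open Bound p pp k m α β

    na : ¬ Z (+ a)
    na = ¬Z-pos a 0<a a<p

    nb : ¬ Z (+ b)
    nb = ¬Z-pos b 0<b b<p

    residue : ∀ u → + (u ℕ.% p) ≅ + u
    residue u = mk≅ (divides (- (+ (u ℕ./ p))) (trans (cong (λ v → + (u ℕ.% p) - + v) (ℕ.m≡m%n+[m/n]*n u p))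
        (trans (cong (λ v → + (u ℕ.% p) - v) (trans (ℤ.pos-+ (u ℕ.% p) _)
            (cong (λ v → + (u ℕ.% p) + v) (ℤ.pos-* (u ℕ./ p) p)))) (lem (+ (u ℕ.% p)) (+ (u ℕ./ p)) (+ p)))))
      where lem : ∀ r q p → r - (r + q * p) ≡ (- q) * p
            lem = solve-∀

    on-curve : ∀ x y z → OnFermat n a b p (x , y , z) → + a * (+ x) ^ n + + b * (+ y) ^ n ≅ (+ z) ^ n
    on-curve x y z e = ≅-trans (≅-reflexive (sym (trans (ℤ.pos-+ (a ℕ.* x ℕ.^ n) (b ℕ.* y ℕ.^ n))
          (cong₂ _+_ (trans (ℤ.pos-* a (x ℕ.^ n)) (cong (+ a *_) (pos-^ x n)))
              (trans (ℤ.pos-* b (y ℕ.^ n)) (cong (+ b *_) (pos-^ y n)))))))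
        (≅-trans (≅-sym (residue _)) (≅-trans (≅-reflexive (cong +_ e)) (≅-trans (residue (z ℕ.^ n)) (≅-reflexive (pos-^ z n)))))

    power-unit : ∀ x → ¬ Z (+ x) → ((+ x) ^ n) ^ k ≅ 1ℤ
    power-unit x nx = ≅-trans (≅-reflexive (trans (ℤ.^-*-assoc (+ x) n k)
        (cong ((+ x) ^_) (trans (ℕ.*-comm n k) kn)))) (little x nx)

    scale-unit : ∀ c → ¬ Z (+ c) → ((+ c) ^ k) ^ n′ * (+ c) ^ k ≅ 1ℤ
    scale-unit c nc = ≅-trans (≅-reflexive (trans (ℤ.*-comm (((+ c) ^ k) ^ n′) ((+ c) ^ k))
        (trans (cong (((+ c) ^ k) ^_) n≡) (trans (ℤ.^-*-assoc (+ c) k n) (cong ((+ c) ^_) kn))))) (little c nc)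

    -- The k-th power of xⁿ is xᵖ⁻¹ = 1, so vᵏ = cᵏ whatever x is.
    value-unit : ∀ c x v → ¬ Z (+ c) → ¬ Z (+ x) → + c * (+ x) ^ n ≅ v → ((+ c) ^ k) ^ n′ * v ^ k ≅ 1ℤ
    value-unit c x v nc nx h = ≅-trans (≅-* (≅-refl {((+ c) ^ k) ^ n′})
        (≅-trans (≅-^ k (≅-sym h)) (≅-trans (≅-reflexive (*-^ (+ c) ((+ x) ^ n) k))
            (≅-* (≅-refl {(+ c) ^ k}) (power-unit x nx)))))
        (≅-trans (≅-reflexive (cong (((+ c) ^ k) ^ n′ *_) (ℤ.*-identityʳ ((+ c) ^ k)))) (scale-unit c nc))

    nonzero-* : ∀ x y → ¬ Z x → ¬ Z y → ¬ Z (x * y)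
    nonzero-* x y nx ny z = ny (Z-cancel x nx z)

    nonzero-^ : ∀ x j → ¬ Z x → ¬ Z (x ^ j)
    nonzero-^ x zero nx = ¬Z-1
    nonzero-^ x (suc j) nx = nonzero-* x (x ^ j) nx (nonzero-^ x j nx)

    zero-power : 0ℤ ^ n ≡ 0ℤ
    zero-power = trans (cong (0ℤ ^_) (sym n≡)) (ℤ.*-zeroˡ (0ℤ ^ n′))

    infix 4 _≅?_
    _≅?_ : ∀ x y → Dec (x ≅ y)
    x ≅? y = map′ mk≅ difference (Z? (x - y))

    Point? : ∀ w → Dec (Point w)
    Point? w = ¬? (Z? w) ×-dec (¬? (Z? (1ℤ - w)) ×-dec ((α * w ^ k ≅? 1ℤ) ×-dec (β * (1ℤ - w) ^ k ≅? 1ℤ)))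

    W : List ℕ
    W = filter (λ w → Point? (+ w)) (upTo p)

    ws : List ℤ
    ws = map +_ W

    ws-points : All Point ws
    ws-points = All.map⁺ (All.all-filter (λ w → Point? (+ w)) (upTo p))

    ws-distinct : AllPairs (λ v w → ¬ Z (v - w)) ws
    ws-distinct = AllPairs.map⁺ (go (All.filter⁺ (λ w → Point? (+ w)) (All.all-upTo p))
        (Unique.filter⁺ (λ w → Point? (+ w)) (Unique.upTo⁺ p)))
      where
      go : ∀ {xs} → All (ℕ._< p) xs → Unique xs → AllPairs (λ v w → ¬ Z (+ v - + w)) xs
      go [] [] = []
      go (x<p ∷ xs<p) (ne ∷ u) = All.map (λ (ne , y<p) z → ne (distinct-residues x<p y<p z)) (All.zip (ne , xs<p)) ∷ go xs<p u

    i₀ i₁ i∞ : ℕ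
    i₀ = indicator (Z? (β - 1ℤ))
    i₁ = indicator (Z? (α - 1ℤ))
    i∞ = indicator (Z? (α - β * -1ℤ ^ k))

    on? : ∀ t → Dec (OnFermat n a b p t)
    on? = onFermat? n a b p

    u : ℕ → ℕ
    u x = (a ℕ.* x ℕ.^ n) ℕ.% p

    u≅ : ∀ x → + u x ≅ + a * (+ x) ^ n
    u≅ x = ≅-trans (residue _) (≅-reflexive (trans (ℤ.pos-* a (x ℕ.^ n)) (cong (+ a *_) (pos-^ x n))))

    private
      upto-All : ∀ {P : ℕ → Set} → (∀ x → x ℕ.< p → P x) → All P (upTo p)
      upto-All h = All.map (λ {x} → h x) (All.all-upTo p)

      x-zero : ∀ y → OnFermat n a b p (0 , y , 1) → + b * (+ y) ^ n ≅ 1ℤ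
      x-zero y e = ≅-trans (≅-reflexive (sym (trans (cong (λ z → + a * z + + b * (+ y) ^ n) zero-power)
          (lem (+ a) (+ b * (+ y) ^ n)))))
          (≅-trans (on-curve 0 y 1 e) (≅-reflexive (ℤ.^-zeroˡ n)))
        where lem : ∀ a y → a * 0ℤ + y ≡ y
              lem = solve-∀

      y-zero : ∀ x → OnFermat n a b p (x , 0 , 1) → + a * (+ x) ^ n ≅ 1ℤ
      y-zero x e = ≅-trans (≅-reflexive (sym (trans (cong (λ z → + a * (+ x) ^ n + + b * z) zero-power)
          (lem (+ b) (+ a * (+ x) ^ n)))))
          (≅-trans (on-curve x 0 1 e) (≅-reflexive (ℤ.^-zeroˡ n)))
        where lem : ∀ b x → x + b * 0ℤ ≡ x
              lem = solve-∀

      z-zero : ∀ x → OnFermat n a b p (x , 1 , 0) → + a * (+ x) ^ n ≅ - + b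
      z-zero x e = mk≅ (Z-resp (trans (lem (+ a * (+ x) ^ n) (+ b))
          (sym (cong₂ (λ u v → + a * (+ x) ^ n + + b * u - v) (ℤ.^-zeroˡ n) zero-power)))
          (difference (on-curve x 1 0 e)))
        where lem : ∀ x b → x - (- b) ≡ x + b * 1ℤ - 0ℤ
              lem = solve-∀

      base-nonzero : ∀ c x v → ¬ Z v → + c * (+ x) ^ n ≅ v → ¬ Z (+ x)
      base-nonzero c x v nv h z = nv (≅-Z (≅-sym h) (Z-* (+ c) (subst (λ j → Z ((+ x) ^ j)) n≡ (Z-*ʳ ((+ x) ^ n′) z))))

      unit-one : ∀ c x → ¬ Z (+ c) → + c * (+ x) ^ n ≅ 1ℤ → Z (((+ c) ^ k) ^ n′ - 1ℤ)
      unit-one c x nc h = difference (≅-trans (≅-reflexive (sym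
          (trans (cong (((+ c) ^ k) ^ n′ *_) (ℤ.^-zeroˡ k)) (ℤ.*-identityʳ (((+ c) ^ k) ^ n′)))))
          (value-unit c x 1ℤ nc (base-nonzero c x 1ℤ ¬Z-1 h) h))

      sign-square : ∀ j → -1ℤ ^ j * -1ℤ ^ j ≡ 1ℤ
      sign-square j = trans (sym (*-^ -1ℤ -1ℤ j)) (ℤ.^-zeroˡ j)

      -- From α(-b)ᵏ = 1 = βbᵏ the factor bᵏ cancels, and (-1)ᵏ, being its own inverse, changes
      -- sides.
      unit-∞ : ∀ x → + a * (+ x) ^ n ≅ - + b → Z (α - β * -1ℤ ^ k)
      unit-∞ x h = difference (≅-trans (≅-reflexive (trans (lem₁ α)
          (trans (cong (α *_) (sym (sign-square k))) (lem₂ α (-1ℤ ^ k))))) (≅-* flip (≅-refl { -1ℤ ^ k})))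
        where
        lem₁ : ∀ x → x ≡ x * 1ℤ
        lem₁ = solve-∀
        lem₂ : ∀ x s → x * (s * s) ≡ (x * s) * s
        lem₂ = solve-∀
        nnb : ¬ Z (- + b)
        nnb z = nb (Z-resp (lem (+ b)) (Z-* -1ℤ z))
          where lem : ∀ b → b ≡ -1ℤ * (- b)
                lem = solve-∀
        B = (+ b) ^ k
        minus-power : (- + b) ^ k ≡ -1ℤ ^ k * B
        minus-power = trans (cong (_^ k) (lem (+ b))) (*-^ -1ℤ (+ b) k)
          where lem : ∀ b → - b ≡ -1ℤ * b
                lem = solve-∀
        both : (α * -1ℤ ^ k) * B ≅ β * B
        both = ≅-trans (≅-reflexive (trans (ℤ.*-assoc α (-1ℤ ^ k) B) (cong (α *_) (sym minus-power))))
            (≅-trans (value-unit a x (- + b) na (base-nonzero a x (- + b) nnb h) h) (≅-sym (scale-unit b nb)))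
        flip : α * -1ℤ ^ k ≅ β
        flip = mk≅ (Z-cancel B (nonzero-^ (+ b) k nb) (Z-resp (lem B (α * -1ℤ ^ k) β) (difference both)))
          where lem : ∀ B x y → B * (x - y) ≡ x * B - y * B
                lem = solve-∀

      u-point : ∀ x y → ¬ Z (+ x) → ¬ Z (+ y) → OnFermat n a b p (x , y , 1) → Point (+ u x)
      u-point x y nx ny e = (λ z → nonzero-* (+ a) ((+ x) ^ n) na (nonzero-^ (+ x) n nx) (≅-Z (≅-sym (u≅ x)) z))
          , (λ z → nonzero-* (+ b) ((+ y) ^ n) nb (nonzero-^ (+ y) n ny) (≅-Z by≅ z))
          , value-unit a x (+ u x) na nx (≅-sym (u≅ x))
          , value-unit b y (1ℤ - + u x) nb ny by≅
        where
        by≅ : + b * (+ y) ^ n ≅ 1ℤ - + u x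
        by≅ = mk≅ (Z-resp (lem (+ a * (+ x) ^ n) (+ b * (+ y) ^ n) (+ u x))
            (Z-+ (difference (≅-trans (on-curve x y 1 e) (≅-reflexive (ℤ.^-zeroˡ n)))) (difference (u≅ x))))
          where lem : ∀ x y u → y - (1ℤ - u) ≡ ((x + y) - 1ℤ) + (u - x)
                lem = solve-∀

      Z-0<p : ∀ {x} → x ≢ 0 → x ℕ.< p → ¬ Z (+ x)
      Z-0<p {x} x≢0 = ¬Z-pos x (ℕ.n≢0⇒n>0 x≢0)

      -- For x ≠ 0 the point with y = 0 is kept as an indicator and not bounded by 1: summed over x,
      -- these indicators count the points on the line y = 0, at most n. For the other y, the power
      -- yⁿ is determined by x.
      fibre : ∀ x → x ℕ.< p → count (λ y → on? (x , y , 1)) (upTo p)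
        ℕ.≤ n ℕ.* i₀ ℕ.* indicator (x ℕ.≟ 0) ℕ.+ (indicator (on? (x , 0 , 1)) ℕ.+ n ℕ.* indicator (Point? (+ u x)))
      fibre x x<p = cases (x ℕ.≟ 0)
        where
        cases : (d : Dec (x ≡ 0)) → count (λ y → on? (x , y , 1)) (upTo p)
          ℕ.≤ n ℕ.* i₀ ℕ.* indicator d ℕ.+ (indicator (on? (x , 0 , 1)) ℕ.+ n ℕ.* indicator (Point? (+ u x)))
        cases (yes refl) = ℕ.≤-trans (count-conditional (λ y → on? (0 , y , 1)) (Z? (β - 1ℤ)) n
            (upto-All (λ y _ e → unit-one b y nb (x-zero y e)))
            (few-power-roots n 1≤n (+ b) 1ℤ nb (λ y → on? (0 , y , 1)) (λ y _ e → x-zero y e)))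
            (ℕ.≤-trans (ℕ.≤-reflexive (sym (ℕ.*-identityʳ (n ℕ.* i₀)))) (ℕ.m≤m+n _ _))
        cases (no x≢0) = ℕ.≤-trans (ℕ.≤-trans
          (count-split (λ y → on? (x , y , 1)) Q? R? (upto-All (λ y _ e → split y e)))
          (ℕ.+-mono-≤
            (ℕ.≤-trans (count-conditional Q? (on? (x , 0 , 1)) 1 (upto-All (λ y _ → proj₂))
                (ℕ.≤-trans countQ (count-unique 0 (Unique.upTo⁺ p)))) (ℕ.≤-reflexive (ℕ.*-identityˡ _)))
            (count-conditional R? (Point? (+ u x)) n (upto-All
                (λ y y<p (y≢0 , e) → u-point x y (Z-0<p x≢0 x<p) (Z-0<p y≢0 y<p) e))
              (few-power-roots n 1≤n (+ b) (1ℤ - + a * (+ x) ^ n) nb R? (λ y _ (_ , e) → solve-y y e)))))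
          (ℕ.m≤n+m (indicator (on? (x , 0 , 1)) ℕ.+ n ℕ.* indicator (Point? (+ u x))) (n ℕ.* i₀ ℕ.* 0))
          where
          Q? : Decidable (λ y → y ≡ 0 × OnFermat n a b p (x , 0 , 1))
          Q? y = (y ℕ.≟ 0) ×-dec on? (x , 0 , 1)
          R? : Decidable (λ y → y ≢ 0 × OnFermat n a b p (x , y , 1))
          R? y = ¬? (y ℕ.≟ 0) ×-dec on? (x , y , 1)
          split : ∀ y → OnFermat n a b p (x , y , 1) → (y ≡ 0 × OnFermat n a b p (x , 0 , 1)) ⊎
              (y ≢ 0 × OnFermat n a b p (x , y , 1))
          split y e with y ℕ.≟ 0
          ... | yes refl = inj₁ (refl , e)
          ... | no y≢0 = inj₂ (y≢0 , e)
          countQ : count Q? (upTo p) ℕ.≤ count (ℕ._≟ 0) (upTo p)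
          countQ rewrite count≡sum Q? (upTo p) | count≡sum (ℕ._≟ 0) (upTo p) = sum-mono _ _
              (upto-All (λ y _ → indicator-mono (Q? y) (y ℕ.≟ 0) proj₁))
          solve-y : ∀ y → OnFermat n a b p (x , y , 1) → + b * (+ y) ^ n ≅ 1ℤ - + a * (+ x) ^ n
          solve-y y e = mk≅ (Z-resp (lem (+ a * (+ x) ^ n) (+ b * (+ y) ^ n))
              (difference (≅-trans (on-curve x y 1 e) (≅-reflexive (ℤ.^-zeroˡ n)))))
            where lem : ∀ x y → y - (1ℤ - x) ≡ (x + y) - 1ℤ
                  lem = solve-∀

      -- Exchanging the sums: each w is a xⁿ for at most n residues x. With at most n values y for
      -- each x, this gives the n² points over w.
      good-abscissas : sumOver (λ x → indicator (Point? (+ u x))) (upTo p) ℕ.≤ n ℕ.* length W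
      good-abscissas = ℕ.≤-trans (sum-mono _ (λ x → sumOver (λ w → indicator (u x ℕ.≟ w)) W)
          (upto-All (λ x _ → at-most x (Point? (+ u x)))))
        (ℕ.≤-trans (ℕ.≤-reflexive (sum-swap (λ x w → indicator (u x ℕ.≟ w)) (upTo p) W))
          (sum-bounded n _ (All.universal (λ w → ℕ.≤-trans (ℕ.≤-reflexive (sym (count≡sum (λ x → u x ℕ.≟ w) (upTo p))))
              (few-power-roots n 1≤n (+ a) (+ w) na (λ x → u x ℕ.≟ w)
                  (λ x _ e → ≅-trans (≅-sym (u≅ x)) (≅-reflexive (cong +_ e))))) W)))
        where
        at-most : ∀ x → (d : Dec (Point (+ u x))) → indicator d ℕ.≤ sumOver (λ w → indicator (u x ℕ.≟ w)) W
        at-most x (no _) = z≤n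
        at-most x (yes P) = indicator-∈ (u x) (∈-filter⁺ (λ w → Point? (+ w)) (∈-upTo⁺ (ℕ.m%n<n _ p)) P)

      affine : count on? (concatMap (λ x → map (λ y → (x , y , 1)) (upTo p)) (upTo p)) ℕ.≤ n ℕ.* i₀ ℕ.+
          (n ℕ.* i₁ ℕ.+ n ℕ.* (n ℕ.* length W))
      affine = ℕ.≤-trans (ℕ.≤-reflexive (count-concatMap on? (λ x → map (λ y → (x , y , 1)) (upTo p)) (upTo p)))
        (ℕ.≤-trans (sum-mono _ _ (upto-All (λ x x<p → ℕ.≤-trans
            (ℕ.≤-reflexive (count-map on? (λ y → (x , y , 1)) (upTo p))) (fibre x x<p))))
        (ℕ.≤-trans (ℕ.≤-reflexive (trans (sum-add _ _ (upTo p)) (cong₂ ℕ._+_ (sum-scale (n ℕ.* i₀) _ (upTo p))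
              (trans (sum-add _ _ (upTo p)) (cong₂ ℕ._+_ (sym (count≡sum (λ x → on? (x , 0 , 1)) (upTo p)))
                  (sum-scale n _ (upTo p)))))))
          (ℕ.+-mono-≤ (ℕ.≤-trans (ℕ.*-monoʳ-≤ (n ℕ.* i₀) (ℕ.≤-trans
              (ℕ.≤-reflexive (sym (count≡sum (ℕ._≟ 0) (upTo p)))) (count-unique 0 (Unique.upTo⁺ p))))
                  (ℕ.≤-reflexive (ℕ.*-identityʳ (n ℕ.* i₀))))
            (ℕ.+-mono-≤
              (count-conditional (λ x → on? (x , 0 , 1)) (Z? (α - 1ℤ)) n (upto-All (λ x _ e → unit-one a x na (y-zero x e)))
                 (few-power-roots n 1≤n (+ a) 1ℤ na (λ x → on? (x , 0 , 1)) (λ x _ e → y-zero x e)))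
              (ℕ.*-monoʳ-≤ n good-abscissas)))))

      line : count on? (map (λ x → (x , 1 , 0)) (upTo p)) ℕ.≤ n ℕ.* i∞
      line = ℕ.≤-trans (ℕ.≤-reflexive (count-map on? (λ x → (x , 1 , 0)) (upTo p)))
        (count-conditional (λ x → on? (x , 1 , 0)) (Z? (α - β * -1ℤ ^ k)) n (upto-All (λ x _ e → unit-∞ x (z-zero x e)))
          (few-power-roots n 1≤n (+ a) (- + b) na (λ x → on? (x , 1 , 0)) (λ x _ e → z-zero x e)))

      corner : count on? ((1 , 0 , 0) ∷ []) ≡ 0
      corner = count-none on? ((λ e → na (Z-resp (trans (lem (+ a) (+ b))
          (sym (cong₂ (λ u v → + a * u + + b * v - v) (ℤ.^-zeroˡ n) zero-power))) (difference (on-curve 1 0 0 e)))) ∷ [])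
        where lem : ∀ a b → a ≡ a * 1ℤ + b * 0ℤ - 0ℤ
              lem = solve-∀

    points-bound : Npts n a b p ℕ.≤ n ℕ.* (n ℕ.* length ws) ℕ.+ n ℕ.* τ
    points-bound = ℕ.≤-trans (ℕ.≤-reflexive (trans (count-++ on? (concatMap (λ x → map (λ y → (x , y , 1)) (upTo p)) (upTo p)) _)
          (cong (count on? (concatMap (λ x → map (λ y → (x , y , 1)) (upTo p)) (upTo p)) ℕ.+_)
              (trans (count-++ on? (map (λ x → (x , 1 , 0)) (upTo p)) _)
             (trans (cong (count on? (map (λ x → (x , 1 , 0)) (upTo p)) ℕ.+_) corner) (ℕ.+-identityʳ _))))))
        (ℕ.≤-trans (ℕ.+-mono-≤ affine line) (ℕ.≤-reflexive (trans (lem n i₀ i₁ i∞ (n ℕ.* length W))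
            (cong (λ l → n ℕ.* (n ℕ.* l) ℕ.+ n ℕ.* τ) (sym (List.length-map +_ W))))))
      where lem : ∀ n x y z w → n ℕ.* x ℕ.+ (n ℕ.* y ℕ.+ n ℕ.* w) ℕ.+ n ℕ.* z ≡ n ℕ.* w ℕ.+ n ℕ.* (x ℕ.+ y ℕ.+ z)
            lem = ℕSolver.solve-∀

-- The choice of m and s

module Numerics where
  open import Data.Nat
  open import Data.Nat.Properties
  open import Data.Nat.DivMod
  open import Data.Nat.Tactic.RingSolver using (solve-∀)
  open import Data.Bool using (if_then_else_)
  open import Relation.Binary.PropositionalEquality

  -- The field below says that (8k + 10 + m³ + 2m² - 5m) / (4(m+3)) < 3s² - 7/2 s + 25/12 for s = j/q.
  record Good (k m q j : ℕ) : Set where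
    constructor good
    field
      1≤m : 1 ≤ m
      m≤k : m ≤ k
      m³≤4k : m * m * m ≤ 4 * k
      s≥7/12 : 7 * q ≤ 12 * j
      s³≤k/2 : 2 * (j * j * j) ≤ k * (q * q * q)
      below : 3 * (8 * k + 10 + m * m * m + 2 * (m * m)) * (q * q) + 42 * (m + 3) * j * q
                < 36 * (m + 3) * (j * j) + 25 * (m + 3) * (q * q) + 15 * m * (q * q)

  good? : ∀ k m q j → Dec (Good k m q j)
  good? k m q j with (1 ≤? m) ×-dec ((m ≤? k) ×-dec ((m * m * m ≤? 4 * k) ×-dec
      ((7 * q ≤? 12 * j) ×-dec ((2 * (j * j * j) ≤? k * (q * q * q)) ×-dec
    (3 * (8 * k + 10 + m * m * m + 2 * (m * m)) * (q * q) + 42 * (m + 3) * j * q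
                <? 36 * (m + 3) * (j * j) + 25 * (m + 3) * (q * q) + 15 * m * (q * q))))))
  ... | yes (a , b , c , d , e , f) = yes (good a b c d e f)
  ... | no h = no λ (good a b c d e f) → h (a , b , c , d , e , f)

  -- Binary search for the largest j with 2j³ ≤ K. The j that it returns is certified afterwards by
  -- `good?`.
  root-search : ℕ → ℕ → ℕ → ℕ
  root-search zero K j = j
  root-search (suc bits) K j = root-search bits K (if 2 * (t * t * t) ≤ᵇ K then t else j)
    where t = j + 2 ^ bits

  small-q : ℕ
  small-q = 100000

  small-root : ℕ → ℕ
  small-root k = root-search 20 (k * (small-q * small-q * small-q)) 0

  -- The values 1 to 309 of k, decided by evaluation with m ≤ 10. Twenty bits hold j, since 10⁵
  -- times the cube root of 309/2 is below 2²⁰.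
  small-case : All (λ k → Any (λ m → Good (suc k) m small-q (small-root (suc k))) (upTo 11)) (upTo 309)
  small-case = toWitness {a? = all? (λ k → any? (λ m → good? (suc k) m small-q (small-root (suc k))) (upTo 11)) (upTo 309)} _

  root-exists : ∀ K → ∃ λ j → 2 * (j * j * j) ≤ K × K < 2 * (suc j * suc j * suc j)
  root-exists zero = 0 , z≤n , s≤s z≤n
  root-exists (suc K) with root-exists K
  ... | j , lo , hi with 2 * (suc j * suc j * suc j) ≤? suc K
  ...   | no h = j , m≤n⇒m≤1+n lo , ≰⇒> h
  ...   | yes h = suc j , h , <-≤-trans (s≤s hi) (*-monoʳ-< 2 (*-mono-< (*-mono-< (n<1+n (suc j)) (n<1+n (suc j))) (n<1+n (suc j))))

  cube-mono : ∀ {a b} → a ≤ b → a * a * a ≤ b * b * b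
  cube-mono h = *-mono-≤ (*-mono-≤ h h) h

  cube-cancel : ∀ {a b} → a * a * a ≤ b * b * b → a ≤ b
  cube-cancel {a} {b} h = ≮⇒≥ λ b<a → <⇒≱ (*-mono-< (*-mono-< b<a b<a) b<a) h

  private
    -- The difference of the two sides is f g = (3e - 2q)(5q - 3e).
    quadratic : ∀ q e f g → 3 * e ≡ 2 * q + f → 5 * q ≡ 3 * e + g → 9 * (e * e) + 10 * (q * q) ≤ 21 * (e * q)
    quadratic q e f g h₁ h₂ = ≤-trans (m≤m+n _ (f * g)) (≤-reflexive (sym (begin
        21 * (e * q) ≡⟨ l₁ e q ⟩
        3 * e * (5 * q) + 6 * (e * q) ≡⟨ cong₂ (λ x y → x * y + 6 * (e * q)) h₁ h₂ ⟩
        (2 * q + f) * (3 * e + g) + 6 * (e * q) ≡⟨ l₂ e q f g ⟩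
        3 * e * (2 * q + f) + 2 * q * (3 * e + g) + f * g ≡⟨ cong₂ (λ x y → 3 * e * x + 2 * q * y + f * g) (sym h₁) (sym h₂) ⟩
        3 * e * (3 * e) + 2 * q * (5 * q) + f * g ≡⟨ l₃ e q f g ⟩
        9 * (e * e) + 10 * (q * q) + f * g ∎)))
      where
      open ≡-Reasoning
      l₁ : ∀ e q → 21 * (e * q) ≡ 3 * e * (5 * q) + 6 * (e * q)
      l₁ = solve-∀
      l₂ : ∀ e q f g → (2 * q + f) * (3 * e + g) + 6 * (e * q) ≡ 3 * e * (2 * q + f) + 2 * q * (3 * e + g) + f * g
      l₂ = solve-∀
      l₃ : ∀ e q f g → 3 * e * (3 * e) + 2 * q * (5 * q) + f * g ≡ 9 * (e * e) + 10 * (q * q) + f * g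
      l₃ = solve-∀

    -- With X = q(m+3) and e = X - 2j, the term 6e³ has the favourable sign and is dropped.
    -- `quadratic` settles the main part with 5q²X to spare, and the second hypothesis bounds the
    -- errors by that amount.
    cubic : ∀ q j e X → X ≡ 2 * j + e → 9 * (e * e) + 10 * (q * q) ≤ 21 * (e * q)
      → 48 * (q * q * q) + 36 * (2 * j * (2 * j)) + 72 * (2 * j) + 48 ≤ 5 * (q * q) * X
      → 48 * (suc j * suc j * suc j) + 48 * (q * q * q) + 3 * (X * X * X) + 5 * (q * q) * X + 42 * q * j * X
          ≤ 36 * (j * j) * X + 21 * q * (X * X)
    cubic q j e X refl h₁ h₂ = +-cancelʳ-≤ (21 * (e * q) * X + 5 * (q * q) * X) _ _ (begin
        48 * (suc j * suc j * suc j) + 48 * (q * q * q) + 3 * (X * X * X) + 5 * (q * q) * X + 42 * q * j * X +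
            (21 * (e * q) * X + 5 * (q * q) * X)
          ≤⟨ m≤m+n _ (6 * (e * e * e)) ⟩
        48 * (suc j * suc j * suc j) + 48 * (q * q * q) + 3 * (X * X * X) + 5 * (q * q) * X + 42 * q * j * X +
            (21 * (e * q) * X + 5 * (q * q) * X) + 6 * (e * e * e)
          ≡⟨ l q j e ⟩
        36 * (j * j) * X + 21 * q * (X * X) + ((9 * (e * e) + 10 * (q * q)) * X +
            (48 * (q * q * q) + 36 * (2 * j * (2 * j)) + 72 * (2 * j) + 48))
          ≤⟨ +-monoʳ-≤ (36 * (j * j) * X + 21 * q * (X * X)) (+-mono-≤ (*-monoˡ-≤ X h₁) h₂) ⟩
        36 * (j * j) * X + 21 * q * (X * X) + (21 * (e * q) * X + 5 * (q * q) * X) ∎)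
      where
      open ≤-Reasoning
      l : ∀ q j e →
        48 * (suc j * suc j * suc j) + 48 * (q * q * q) + 3 * ((2 * j + e) * (2 * j + e) * (2 * j + e)) + 5 *
            (q * q) * (2 * j + e) + 42 * q * j * (2 * j + e) +
                (21 * (e * q) * (2 * j + e) + 5 * (q * q) * (2 * j + e)) + 6 * (e * e * e)
        ≡ 36 * (j * j) * (2 * j + e) + 21 * q * ((2 * j + e) * (2 * j + e)) +
            ((9 * (e * e) + 10 * (q * q)) * (2 * j + e) + (48 * (q * q * q) + 36 * (2 * j * (2 * j)) + 72 * (2 * j) + 48))
      l = solve-∀

    -- Of the five parts available, the term 48q³ takes at most four because x ≥ 12. The other
    -- terms, 48((j+1)³ - j³) from rounding s down to j/q, take at most the fifth because q ≥ 40x.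
    error-term : ∀ q x X j → X ≡ q * x → 2 * j ≤ X → 12 ≤ x → 40 * x ≤ q
      → 48 * (q * q * q) + 36 * (2 * j * (2 * j)) + 72 * (2 * j) + 48 ≤ 5 * (q * q) * X
    error-term q x X j refl 2j≤X 12≤x 40x≤q = begin
        48 * (q * q * q) + 36 * (2 * j * (2 * j)) + 72 * (2 * j) + 48
          ≤⟨ +-monoˡ-≤ 48 (+-mono-≤ (+-monoʳ-≤ (48 * (q * q * q)) (*-monoʳ-≤ 36 (*-mono-≤ 2j≤X 2j≤X))) (*-monoʳ-≤ 72 2j≤X)) ⟩
        48 * (q * q * q) + 36 * (X * X) + 72 * X + 48
          ≤⟨ +-monoʳ-≤ (48 * (q * q * q) + 36 * (X * X) + 72 * X) (*-monoʳ-≤ 48 1≤X) ⟩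
        48 * (q * q * q) + 36 * (X * X) + 72 * X + 48 * X
          ≡⟨ l₁ q X ⟩
        4 * (q * q * (q * 12)) + 36 * (X * X) + 120 * X
          ≤⟨ +-mono-≤ (+-monoˡ-≤ (36 * (X * X)) (*-monoʳ-≤ 4 (*-monoʳ-≤ (q * q) (*-monoʳ-≤ q 12≤x))))
              (≤-trans (≤-reflexive (l₂ X)) (*-monoʳ-≤ 4 (*-monoˡ-≤ X 30≤X))) ⟩
        4 * (q * q * X) + 36 * (X * X) + 4 * (X * X)
          ≡⟨ l₃ q x ⟩
        4 * (q * q * X) + 40 * x * (q * X)
          ≤⟨ +-monoʳ-≤ (4 * (q * q * X)) (*-monoˡ-≤ (q * X) 40x≤q) ⟩
        4 * (q * q * X) + q * (q * X)
          ≡⟨ l₄ q X ⟩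
        5 * (q * q) * X ∎
      where
      open ≤-Reasoning
      480≤q : 480 ≤ q
      480≤q = ≤-trans (*-monoʳ-≤ 40 12≤x) 40x≤q
      30≤X : 30 ≤ q * x
      30≤X = ≤-trans (toWitness {a? = 30 ≤? 5760} _) (*-mono-≤ 480≤q 12≤x)
      1≤X : 1 ≤ q * x
      1≤X = ≤-trans (s≤s z≤n) 30≤X
      l₁ : ∀ q X → 48 * (q * q * q) + 36 * (X * X) + 72 * X + 48 * X ≡ 4 * (q * q * (q * 12)) + 36 * (X * X) + 120 * X
      l₁ = solve-∀
      l₂ : ∀ X → 120 * X ≡ 4 * (30 * X)
      l₂ = solve-∀
      l₃ : ∀ q x → 4 * (q * q * (q * x)) + 36 * (q * x * (q * x)) + 4 * (q * x * (q * x)) ≡ 4 *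
          (q * q * (q * x)) + 40 * x * (q * (q * x))
      l₃ = solve-∀
      l₄ : ∀ q X → 4 * (q * q * X) + q * (q * X) ≡ 5 * (q * q) * X
      l₄ = solve-∀

    -- The inequality `below` times q, after kq³ has been replaced by its upper bound 2(j+1)³ from
    -- the rounding of s; this replacement makes it strict.
    strict : ∀ k m q j → .⦃ _ : NonZero q ⦄ → k * (q * q * q) < 2 * (suc j * suc j * suc j)
      → 48 * (suc j * suc j * suc j) + 48 * (q * q * q) + 3 * (q * (m + 3) * (q * (m + 3)) * (q * (m + 3))) + 5 *
          (q * q) * (q * (m + 3)) + 42 * q * j * (q * (m + 3))
          ≤ 36 * (j * j) * (q * (m + 3)) + 21 * q * (q * (m + 3) * (q * (m + 3)))
      → 3 * (8 * k + 10 + m * m * m + 2 * (m * m)) * (q * q) + 42 * (m + 3) * j * q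
          < 36 * (m + 3) * (j * j) + 25 * (m + 3) * (q * q) + 15 * m * (q * q)
    strict k m q j hk h = *-cancelʳ-< q _ _ (+-cancelʳ-< (36 * (j * j) * (q * (m + 3)) + 21 * q *
        (q * (m + 3) * (q * (m + 3)))) _ _ (begin-strict
        (3 * (8 * k + 10 + m * m * m + 2 * (m * m)) * (q * q) + 42 * (m + 3) * j * q) * q + R
          ≡⟨ l₁ k m q j R ⟩
        24 * (k * (q * q * q)) + (3 * (10 + m * m * m + 2 * (m * m)) * (q * q * q) + 42 * (m + 3) * j * (q * q) + R)
          <⟨ +-monoˡ-< (3 * (10 + m * m * m + 2 * (m * m)) * (q * q * q) + 42 * (m + 3) * j * (q * q) + R) (*-monoʳ-< 24 hk) ⟩
        24 * (2 * (suc j * suc j * suc j)) + (3 * (10 + m * m * m + 2 * (m * m)) * (q * q * q) + 42 * (m + 3) * j * (q * q) + R)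
          ≡⟨ l₂ m q j ⟩
        (36 * (m + 3) * (j * j) + 25 * (m + 3) * (q * q) + 15 * m * (q * q)) * q +
          (48 * (suc j * suc j * suc j) + 48 * (q * q * q) + 3 * (q * (m + 3) * (q * (m + 3)) * (q * (m + 3))) + 5 *
              (q * q) * (q * (m + 3)) + 42 * q * j * (q * (m + 3)))
          ≤⟨ +-monoʳ-≤ ((36 * (m + 3) * (j * j) + 25 * (m + 3) * (q * q) + 15 * m * (q * q)) * q) h ⟩
        (36 * (m + 3) * (j * j) + 25 * (m + 3) * (q * q) + 15 * m * (q * q)) * q + R ∎))
      where
      open ≤-Reasoning
      R = 36 * (j * j) * (q * (m + 3)) + 21 * q * (q * (m + 3) * (q * (m + 3)))
      l₁ : ∀ k m q j R → (3 * (8 * k + 10 + m * m * m + 2 * (m * m)) * (q * q) + 42 * (m + 3) * j * q) * q + R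
         ≡ 24 * (k * (q * q * q)) + (3 * (10 + m * m * m + 2 * (m * m)) * (q * q * q) + 42 * (m + 3) * j * (q * q) + R)
      l₁ = solve-∀
      l₂ : ∀ m q j →
        24 * (2 * (suc j * suc j * suc j)) + (3 * (10 + m * m * m + 2 * (m * m)) * (q * q * q) + 42 * (m + 3) * j *
            (q * q) + (36 * (j * j) * (q * (m + 3)) + 21 * q * (q * (m + 3) * (q * (m + 3)))))
        ≡ (36 * (m + 3) * (j * j) + 25 * (m + 3) * (q * q) + 15 * m * (q * q)) * q +
          (48 * (suc j * suc j * suc j) + 48 * (q * q * q) + 3 * (q * (m + 3) * (q * (m + 3)) * (q * (m + 3))) + 5 *
              (q * q) * (q * (m + 3)) + 42 * q * j * (q * (m + 3)))
      l₂ = solve-∀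

  -- Let x = m + 3 = 2s + ε. For k = 2s³ the bound on #{w} for τ = 0 is 3s² - (7/2)s + (3/4)ε² -
  -- (7/4)ε + 5/2, apart from 4/x and a negative term in ε³. It is best at ε = 7/6, and the integer
  -- part of 2s + 5/3 puts ε into the interval from 2/3 to 5/3 centred there. On it the constant is
  -- at most 5/3, which leaves 5/12 below 25/12 for the errors.
  large-case : ∀ k q → .⦃ _ : NonZero q ⦄ → 310 ≤ k → 40 * k ≤ q → ∃ λ m → ∃ λ j → Good k m q j
  large-case k q 310≤k 40k≤q = m , j , good (m+n≤o⇒m≤o∸n 1 (≤-trans (toWitness {a? = 4 ≤? 12} _) 12≤x)) m≤k m³≤4k
      (≤-trans (*-monoˡ-≤ q (toWitness {a? = 7 ≤? 62} _)) (≤-trans (≤-reflexive (two q))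
          (≤-trans (*-monoʳ-≤ 2 31q≤6j) (≤-reflexive (two′ j))))) lo
      (strict k m q j hi (subst (λ x → 48 * (suc j * suc j * suc j) + 48 * (q * q * q) + 3 *
          (q * x * (q * x) * (q * x)) + 5 * (q * q) * (q * x) + 42 * q * j * (q * x)
          ≤ 36 * (j * j) * (q * x) + 21 * q * (q * x * (q * x))) (sym m+3≡x)
        (cubic q j e (q * x) X≡ (quadratic q e (3 * e ∸ 2 * q) (5 * q ∸ 3 * e) (sym (m+[n∸m]≡n 2q≤3e)) (sym (m+[n∸m]≡n 3e≤5q)))
          (error-term q x (q * x) j refl 2j≤X 12≤x (≤-trans (*-monoʳ-≤ 40 x≤k) 40k≤q)))))
    where
    root = root-exists (k * (q * q * q))
    j = proj₁ root
    lo = proj₁ (proj₂ root)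
    hi = proj₂ (proj₂ root)
    instance
      3q≢0 : NonZero (3 * q)
      3q≢0 = m*n≢0 3 q
    x = (6 * j + 5 * q) / (3 * q)
    m = x ∸ 3
    two : ∀ q → 62 * q ≡ 2 * (31 * q)
    two = solve-∀
    two′ : ∀ j → 2 * (6 * j) ≡ 12 * j
    two′ = solve-∀

    floor≤ : 3 * (q * x) ≤ 6 * j + 5 * q
    floor≤ = ≤-trans (≤-reflexive (lem q x)) (m/n*n≤m (6 * j + 5 * q) (3 * q))
      where lem : ∀ q x → 3 * (q * x) ≡ x * (3 * q)
            lem = solve-∀

    <ceil : 6 * j + 2 * q < 3 * (q * x)
    <ceil = +-cancelʳ-< (3 * q) _ _ (begin-strict
        6 * j + 2 * q + 3 * q ≡⟨ l₁ j q ⟩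
        6 * j + 5 * q ≡⟨ m≡m%n+[m/n]*n (6 * j + 5 * q) (3 * q) ⟩
        (6 * j + 5 * q) % (3 * q) + x * (3 * q) <⟨ +-monoˡ-< (x * (3 * q)) (m%n<n (6 * j + 5 * q) (3 * q)) ⟩
        3 * q + x * (3 * q) ≡⟨ l₂ q x ⟩
        3 * (q * x) + 3 * q ∎)
      where
      open ≤-Reasoning
      l₁ : ∀ j q → 6 * j + 2 * q + 3 * q ≡ 6 * j + 5 * q
      l₁ = solve-∀
      l₂ : ∀ q x → 3 * q + x * (3 * q) ≡ 3 * (q * x) + 3 * q
      l₂ = solve-∀

    1≤q³ : 1 ≤ q * q * q
    1≤q³ = >-nonZero⁻¹ (q * q * q) ⦃ m*n≢0 (q * q) q ⦃ m*n≢0 q q ⦄ ⦄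

    -- The source of the threshold 310. The bound s ≥ 31/6 is what makes 2s + 2/3 ≥ 11, hence x ≥
    -- 12. If it failed, then 6(j+1) ≤ 32q, the difference q covering the rounding, and 216k < 2 ·
    -- 32³ = 65536 < 216 · 310.
    31q≤6j : 31 * q ≤ 6 * j
    31q≤6j = ≮⇒≥ λ 6j<31q → <-irrefl refl (begin-strict
        216 * (k * (q * q * q)) <⟨ *-monoʳ-< 216 hi ⟩
        216 * (2 * (suc j * suc j * suc j)) ≡⟨ l₁ j ⟩
        2 * ((6 * suc j) * (6 * suc j) * (6 * suc j)) ≤⟨ *-monoʳ-≤ 2 (cube-mono (upper 6j<31q)) ⟩
        2 * ((32 * q) * (32 * q) * (32 * q)) ≡⟨ l₂ q ⟩
        65536 * (q * q * q) ≤⟨ *-monoˡ-≤ (q * q * q) (toWitness {a? = 65536 ≤? 66960} _) ⟩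
        66960 * (q * q * q) ≡⟨ l₃ (q * q * q) ⟩
        216 * (310 * (q * q * q)) ≤⟨ *-monoʳ-≤ 216 (*-monoˡ-≤ (q * q * q) 310≤k) ⟩
        216 * (k * (q * q * q)) ∎)
      where
      open ≤-Reasoning
      5≤q : 5 ≤ q
      5≤q = ≤-trans (toWitness {a? = 5 ≤? 12400} _) (≤-trans (*-monoʳ-≤ 40 310≤k) 40k≤q)
      upper : 6 * j < 31 * q → 6 * suc j ≤ 32 * q
      upper h = ≤-trans (≤-reflexive (l₄ j)) (≤-trans (+-mono-≤ h 5≤q) (≤-reflexive (l₅ q)))
        where
        l₄ : ∀ j → 6 * suc j ≡ suc (6 * j) + 5
        l₄ = solve-∀
        l₅ : ∀ q → 31 * q + q ≡ 32 * q
        l₅ = solve-∀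
      l₁ : ∀ j → 216 * (2 * (suc j * suc j * suc j)) ≡ 2 * ((6 * suc j) * (6 * suc j) * (6 * suc j))
      l₁ = solve-∀
      l₂ : ∀ q → 2 * ((32 * q) * (32 * q) * (32 * q)) ≡ 65536 * (q * q * q)
      l₂ = solve-∀
      l₃ : ∀ c → 66960 * c ≡ 216 * (310 * c)
      l₃ = solve-∀

    12≤x : 12 ≤ x
    12≤x = ≮⇒≥ λ x<12 → <-irrefl refl (begin-strict
        33 * q ≡⟨ l₁ q ⟩
        31 * q + 2 * q ≤⟨ +-monoˡ-≤ (2 * q) 31q≤6j ⟩
        6 * j + 2 * q <⟨ <ceil ⟩
        3 * (q * x) ≤⟨ *-monoʳ-≤ 3 (*-monoʳ-≤ q (≤-pred x<12)) ⟩
        3 * (q * 11) ≡⟨ l₂ q ⟩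
        33 * q ∎)
      where
      open ≤-Reasoning
      l₁ : ∀ q → 33 * q ≡ 31 * q + 2 * q
      l₁ = solve-∀
      l₂ : ∀ q → 3 * (q * 11) ≡ 33 * q
      l₂ = solve-∀

    4j≤kq : 4 * j ≤ k * q
    4j≤kq = cube-cancel (begin
        4 * j * (4 * j) * (4 * j) ≡⟨ l₁ j ⟩
        32 * (2 * (j * j * j)) ≤⟨ *-monoʳ-≤ 32 lo ⟩
        32 * (k * (q * q * q)) ≤⟨ *-monoˡ-≤ (k * (q * q * q)) 32≤kk ⟩
        k * k * (k * (q * q * q)) ≡⟨ l₂ k q ⟩
        k * q * (k * q) * (k * q) ∎)
      where
      open ≤-Reasoning
      32≤kk : 32 ≤ k * k
      32≤kk = ≤-trans (toWitness {a? = 32 ≤? 96100} _) (*-mono-≤ 310≤k 310≤k)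
      l₁ : ∀ j → 4 * j * (4 * j) * (4 * j) ≡ 32 * (2 * (j * j * j))
      l₁ = solve-∀
      l₂ : ∀ k q → k * k * (k * (q * q * q)) ≡ k * q * (k * q) * (k * q)
      l₂ = solve-∀

    x≤k : x ≤ k
    x≤k = *-cancelˡ-≤ q (*-cancelˡ-≤ 6 (begin
        6 * (q * x) ≡⟨ l₁ (q * x) ⟩
        2 * (3 * (q * x)) ≤⟨ *-monoʳ-≤ 2 floor≤ ⟩
        2 * (6 * j + 5 * q) ≡⟨ l₂ j q ⟩
        3 * (4 * j) + 10 * q ≤⟨ +-mono-≤ (*-monoʳ-≤ 3 4j≤kq)
            (*-monoˡ-≤ q (≤-trans (toWitness {a? = 10 ≤? 930} _) (*-monoʳ-≤ 3 310≤k))) ⟩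
        3 * (k * q) + 3 * k * q ≡⟨ l₃ k q ⟩
        6 * (q * k) ∎))
      where
      open ≤-Reasoning
      l₁ : ∀ X → 6 * X ≡ 2 * (3 * X)
      l₁ = solve-∀
      l₂ : ∀ j q → 2 * (6 * j + 5 * q) ≡ 3 * (4 * j) + 10 * q
      l₂ = solve-∀
      l₃ : ∀ k q → 3 * (k * q) + 3 * k * q ≡ 6 * (q * k)
      l₃ = solve-∀

    m+3≡x : m + 3 ≡ x
    m+3≡x = m∸n+n≡m (≤-trans (toWitness {a? = 3 ≤? 12} _) 12≤x)

    m≤k : m ≤ k
    m≤k = ≤-trans (m∸n≤m x 3) x≤k

    qm≤2j : q * m ≤ 2 * j
    qm≤2j = *-cancelˡ-≤ 3 (+-cancelʳ-≤ (5 * q) _ _ (begin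
        3 * (q * m) + 5 * q ≤⟨ +-monoʳ-≤ (3 * (q * m)) (*-monoˡ-≤ q (toWitness {a? = 5 ≤? 9} _)) ⟩
        3 * (q * m) + 9 * q ≡⟨ l₁ q m ⟩
        3 * (q * (m + 3)) ≡⟨ cong (λ x → 3 * (q * x)) m+3≡x ⟩
        3 * (q * x) ≤⟨ floor≤ ⟩
        6 * j + 5 * q ≡⟨ l₂ j q ⟩
        3 * (2 * j) + 5 * q ∎))
      where
      open ≤-Reasoning
      l₁ : ∀ q m → 3 * (q * m) + 9 * q ≡ 3 * (q * (m + 3))
      l₁ = solve-∀
      l₂ : ∀ j q → 6 * j + 5 * q ≡ 3 * (2 * j) + 5 * q
      l₂ = solve-∀

    -- Here m ≤ 2s, because x ≤ 2s + 5/3 and m = x - 3, and 8s³ ≤ 4k. Against 4k < n³ this will give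
    -- m < n.
    m³≤4k : m * m * m ≤ 4 * k
    m³≤4k = *-cancelˡ-≤ (q * q * q) ⦃ >-nonZero 1≤q³ ⦄ (begin
        q * q * q * (m * m * m) ≡⟨ l₁ q m ⟩
        q * m * (q * m) * (q * m) ≤⟨ cube-mono qm≤2j ⟩
        2 * j * (2 * j) * (2 * j) ≡⟨ l₂ j ⟩
        4 * (2 * (j * j * j)) ≤⟨ *-monoʳ-≤ 4 lo ⟩
        4 * (k * (q * q * q)) ≡⟨ l₃ k (q * q * q) ⟩
        q * q * q * (4 * k) ∎)
      where
      open ≤-Reasoning
      l₁ : ∀ q m → q * q * q * (m * m * m) ≡ q * m * (q * m) * (q * m)
      l₁ = solve-∀
      l₂ : ∀ j → 2 * j * (2 * j) * (2 * j) ≡ 4 * (2 * (j * j * j))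
      l₂ = solve-∀
      l₃ : ∀ k c → 4 * (k * c) ≡ c * (4 * k)
      l₃ = solve-∀

    e = q * x ∸ 2 * j

    2j≤X : 2 * j ≤ q * x
    2j≤X = *-cancelˡ-≤ 3 (≤-trans (≤-trans (≤-reflexive (lem j)) (m≤m+n (6 * j) (2 * q))) (<⇒≤ <ceil))
      where lem : ∀ j → 3 * (2 * j) ≡ 6 * j
            lem = solve-∀

    X≡ : q * x ≡ 2 * j + e
    X≡ = sym (m+[n∸m]≡n 2j≤X)

    3X≡ : 3 * (q * x) ≡ 6 * j + 3 * e
    3X≡ = trans (cong (3 *_) X≡) (lem j e)
      where lem : ∀ j e → 3 * (2 * j + e) ≡ 6 * j + 3 * e
            lem = solve-∀

    2q≤3e : 2 * q ≤ 3 * e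
    2q≤3e = +-cancelˡ-≤ (6 * j) _ _ (≤-trans (<⇒≤ <ceil) (≤-reflexive 3X≡))

    3e≤5q : 3 * e ≤ 5 * q
    3e≤5q = +-cancelˡ-≤ (6 * j) _ _ (≤-trans (≤-reflexive (sym 3X≡)) floor≤)

  good-choice : ∀ k → 1 ≤ k → ∃ λ m → ∃ λ q → ∃ λ j → NonZero q × Good k m q j
  good-choice (suc k) _ with k <? 309
  ... | yes k<309 = let (m , g) = satisfied (All.lookup small-case (∈-upTo⁺ k<309)) in m , small-q , small-root (suc k) , _ , g
  ... | no k≮309 = let (m , j , g) = large-case (suc k) (40 * suc k) (s≤s (≮⇒≥ k≮309)) ≤-refl in m , 40 * suc k , j , _ , g

  clear-denominators : ∀ N n k m q j W τ → 0 < n → m + 3 ≤ 2 * n → 0 < q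
    → N ≤ n * (n * W) + n * τ
    → 4 * (m + 3) * W + 8 * τ + 5 * m ≤ 8 * k + 10 + m * m * m + 2 * (m * m)
    → Good k m q j
    → N * (12 * (q * q)) + (n * n) * (42 * (j * q)) < (n * n) * (36 * (j * j) + 25 * (q * q))
  clear-denominators N n k m q j W τ 0<n x≤2n 0<q N≤ C G = *-cancelˡ-< x _ _
      (+-cancelʳ-< (15 * m * (q * q) * (n * n)) _ _ (begin-strict
      x * (N * (12 * (q * q)) + (n * n) * (42 * (j * q))) + 15 * m * (q * q) * (n * n)
        ≡⟨ l₁ x N n m q j ⟩
      12 * x * (q * q) * N + (42 * x * j * q * (n * n) + 15 * m * (q * q) * (n * n))
        ≤⟨ +-monoˡ-≤ _ (*-monoʳ-≤ (12 * x * (q * q)) N≤) ⟩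
      12 * x * (q * q) * (n * (n * W) + n * τ) + (42 * x * j * q * (n * n) + 15 * m * (q * q) * (n * n))
        ≡⟨ l₂ x n m q j W τ ⟩
      3 * (q * q) * (n * n) * (4 * x * W + 5 * m) + (42 * x * j * q * (n * n)) + 12 * (q * q) * n * τ * x
        -- With m + 3 ≤ 2n the nτ points on the coordinate lines fit exactly under the term 8τ of
        -- the count.
        ≤⟨ +-monoʳ-≤ _ (*-monoʳ-≤ (12 * (q * q) * n * τ) x≤2n) ⟩
      3 * (q * q) * (n * n) * (4 * x * W + 5 * m) + (42 * x * j * q * (n * n)) + 12 * (q * q) * n * τ * (2 * n)
        ≡⟨ l₃ x n m q j W τ ⟩
      3 * (q * q) * (n * n) * (4 * x * W + 8 * τ + 5 * m) + 42 * x * j * q * (n * n)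
        ≤⟨ +-monoˡ-≤ _ (*-monoʳ-≤ (3 * (q * q) * (n * n)) C) ⟩
      3 * (q * q) * (n * n) * B + 42 * x * j * q * (n * n)
        ≡⟨ l₄ x n q j B ⟩
      (3 * B * (q * q) + 42 * x * j * q) * (n * n)
        <⟨ *-monoˡ-< (n * n) ⦃ >-nonZero (*-mono-≤ 0<n 0<n) ⦄ (Good.below G) ⟩
      (36 * x * (j * j) + 25 * x * (q * q) + 15 * m * (q * q)) * (n * n)
        ≡⟨ l₅ x n m q j ⟩
      x * ((n * n) * (36 * (j * j) + 25 * (q * q))) + 15 * m * (q * q) * (n * n) ∎))
    where
    open ≤-Reasoning
    x = m + 3
    B = 8 * k + 10 + m * m * m + 2 * (m * m)
    l₁ : ∀ x N n m q j → x * (N * (12 * (q * q)) + (n * n) * (42 * (j * q))) + 15 * m * (q * q) * (n * n)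
       ≡ 12 * x * (q * q) * N + (42 * x * j * q * (n * n) + 15 * m * (q * q) * (n * n))
    l₁ = solve-∀
    l₂ : ∀ x n m q j W τ → 12 * x * (q * q) * (n * (n * W) + n * τ) + (42 * x * j * q * (n * n) + 15 * m * (q * q) * (n * n))
       ≡ 3 * (q * q) * (n * n) * (4 * x * W + 5 * m) + (42 * x * j * q * (n * n)) + 12 * (q * q) * n * τ * x
    l₂ = solve-∀
    l₃ : ∀ x n m q j W τ → 3 * (q * q) * (n * n) * (4 * x * W + 5 * m) + (42 * x * j * q * (n * n)) + 12 *
        (q * q) * n * τ * (2 * n)
       ≡ 3 * (q * q) * (n * n) * (4 * x * W + 8 * τ + 5 * m) + 42 * x * j * q * (n * n)
    l₃ = solve-∀
    l₄ : ∀ x n q j B → 3 * (q * q) * (n * n) * B + 42 * x * j * q * (n * n) ≡ (3 * B * (q * q) + 42 * x * j * q) * (n * n)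
    l₄ = solve-∀
    l₅ : ∀ x n m q j → (36 * x * (j * j) + 25 * x * (q * q) + 15 * m * (q * q)) * (n * n)
       ≡ x * ((n * n) * (36 * (j * j) + 25 * (q * q))) + 15 * m * (q * q) * (n * n)
    l₅ = solve-∀

-- The bound in rational numbers

module RationalForm where
  open PointBound
  open FermatCurve
  open Numerics
  open import Data.Integer using (+_)
  open import Data.Integer.Tactic.RingSolver using (solve-∀)
  open import Data.Rational using (ℚ; _/_; _+_; _*_; _-_; _<_; _≤_; -_; toℚᵘ; Positive; positive)
  import Data.Rational.Properties as ℚ
  open import Data.Rational.Solver using (module +-*-Solver)
  open import Data.Rational.Unnormalised as ℚᵘ using (ℚᵘ; mkℚᵘ; *≡*; *<*; *≤*) renaming (_≃_ to _≃ᵘ_)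
  import Data.Rational.Unnormalised.Properties as ℚᵘ

  ι : ℕ → ℚ
  ι n = + n / 1

  private
    ι-repr : ∀ n → toℚᵘ (ι n) ≃ᵘ mkℚᵘ (+ n) 0
    ι-repr n = ℚ.toℚᵘ-fromℚᵘ (mkℚᵘ (+ n) 0)

  ι-* : ∀ a b → ι (a ℕ.* b) ≡ ι a * ι b
  ι-* a b = ℚ.toℚᵘ-injective (ℚᵘ.≃-trans (ι-repr (a ℕ.* b)) (ℚᵘ.≃-trans (*≡* (cong (ℤ._* + 1) (ℤ.pos-* a b)))
    (ℚᵘ.≃-sym (ℚᵘ.≃-trans (ℚ.toℚᵘ-homo-* (ι a) (ι b)) (ℚᵘ.*-cong (ι-repr a) (ι-repr b))))))

  ι-+ : ∀ a b → ι (a ℕ.+ b) ≡ ι a + ι b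
  ι-+ a b = ℚ.toℚᵘ-injective (ℚᵘ.≃-trans (ι-repr (a ℕ.+ b)) (ℚᵘ.≃-trans
      (*≡* (trans (cong (ℤ._* + 1) (ℤ.pos-+ a b)) (lem (+ a) (+ b))))
    (ℚᵘ.≃-sym (ℚᵘ.≃-trans (ℚ.toℚᵘ-homo-+ (ι a) (ι b)) (ℚᵘ.+-cong (ι-repr a) (ι-repr b))))))
    where lem : ∀ a b → (a ℤ.+ b) ℤ.* + 1 ≡ (a ℤ.* + 1 ℤ.+ b ℤ.* + 1) ℤ.* + 1
          lem = solve-∀

  ι-< : ∀ {a b} → a ℕ.< b → ι a < ι b
  ι-< {a} {b} h = ℚ.toℚᵘ-cancel-< (ℚᵘ.<-respˡ-≃ (ℚᵘ.≃-sym (ι-repr a))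
      (ℚᵘ.<-respʳ-≃ (ℚᵘ.≃-sym (ι-repr b)) (*<* (ℤ.*-monoʳ-<-pos (+ 1) (ℤ.+<+ h)))))

  ι-≤ : ∀ {a b} → a ℕ.≤ b → ι a ≤ ι b
  ι-≤ {a} {b} h = ℚ.toℚᵘ-cancel-≤ (ℚᵘ.≤-respˡ-≃ (ℚᵘ.≃-sym (ι-repr a))
      (ℚᵘ.≤-respʳ-≃ (ℚᵘ.≃-sym (ι-repr b)) (*≤* (ℤ.*-monoʳ-≤-nonNeg (+ 1) (ℤ.+≤+ h)))))

  fraction : ∀ j q .⦃ _ : NonZero q ⦄ → (+ j / q) * ι q ≡ ι j
  fraction j (suc q) = ℚ.toℚᵘ-injective (ℚᵘ.≃-trans (ℚ.toℚᵘ-homo-* (+ j / suc q) (ι (suc q)))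
    (ℚᵘ.≃-trans (ℚᵘ.*-cong (ℚ.toℚᵘ-fromℚᵘ (mkℚᵘ (+ j) q)) (ι-repr (suc q)))
      (ℚᵘ.≃-trans (*≡* (trans (ℤ.*-assoc (+ j) (+ suc q) (+ 1)) (cong (+ j ℤ.*_) (sym (ℤ.pos-* (suc q) 1)))))
          (ℚᵘ.≃-sym (ι-repr j)))))

  ι-pos : ∀ n → 0 ℕ.< n → Positive (ι n)
  ι-pos n h = positive (ι-< h)

  module Rational (N c k q j : ℕ) ⦃ _ : NonZero q ⦄ (0<q : 0 ℕ.< q) where

    s : ℚ
    s = + j / q

    private
      Q = ι q

      pos-12 : Positive (ι (12 ℕ.* (q ℕ.* q)))
      pos-12 = ι-pos _ (ℕ.*-mono-≤ {1} {12} (s≤s z≤n) (ℕ.*-mono-≤ 0<q 0<q))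

      square : ι (q ℕ.* q) ≡ Q * Q
      square = ι-* q q

      sQ : s * Q ≡ ι j
      sQ = fraction j q

    lower : 7 ℕ.* q ℕ.≤ 12 ℕ.* j → + 7 / 12 ≤ s
    lower h = ℚ.*-cancelʳ-≤-pos (ι 12 * Q) ⦃ subst Positive (ι-* 12 q) (ι-pos (12 ℕ.* q) (ℕ.*-mono-≤ {1} {12} (s≤s z≤n) 0<q)) ⦄
      (subst₂ _≤_ (trans (ι-* 7 q) (trans (cong (_* Q) (sym (fraction 7 12))) (ℚ.*-assoc (+ 7 / 12) (ι 12) Q)))
                  (trans (ι-* 12 j) (trans (cong (ι 12 *_) (sym sQ))
                      (solve 3 (λ t s q → t :* (s :* q) := s :* (t :* q)) refl (ι 12) s Q)))
                  (ι-≤ h))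
      where open +-*-Solver

    cube : 2 ℕ.* (j ℕ.* j ℕ.* j) ℕ.≤ k ℕ.* (q ℕ.* q ℕ.* q) → s * s * s ≤ + k / 2
    cube h = ℚ.*-cancelʳ-≤-pos (ι 2 * (Q * Q * Q)) ⦃ subst Positive eq
        (ι-pos (2 ℕ.* (q ℕ.* q ℕ.* q)) (ℕ.*-mono-≤ {1} {2} (s≤s z≤n) (ℕ.*-mono-≤ (ℕ.*-mono-≤ 0<q 0<q) 0<q))) ⦄
      (subst₂ _≤_ (trans (ι-* 2 (j ℕ.* j ℕ.* j)) (trans (cong (ι 2 *_)
          (trans (cubic′ j) (cong₂ _*_ (cong₂ _*_ (sym sQ) (sym sQ)) (sym sQ))))
                      (solve 3 (λ t s q → t :* (s :* q :* (s :* q) :* (s :* q)) := s :* s :* s :*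
                          (t :* (q :* q :* q))) refl (ι 2) s Q)))
                  (trans (ι-* k (q ℕ.* q ℕ.* q)) (trans (cong₂ _*_ (sym (fraction k 2)) (cubic′ q))
                      (ℚ.*-assoc (+ k / 2) (ι 2) (Q * Q * Q))))
                  (ι-≤ h))
      where
      open +-*-Solver
      cubic′ : ∀ x → ι (x ℕ.* x ℕ.* x) ≡ ι x * ι x * ι x
      cubic′ x = trans (ι-* (x ℕ.* x) x) (cong (_* ι x) (ι-* x x))
      eq : ι (2 ℕ.* (q ℕ.* q ℕ.* q)) ≡ ι 2 * (Q * Q * Q)
      eq = trans (ι-* 2 (q ℕ.* q ℕ.* q)) (cong (ι 2 *_) (cubic′ q))

    -- Multiplied by 12q², with sq = j, the claim becomes integral. The negative term stands on the
    -- left of the integral form, and adding -Y to both sides moves it back.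
    upper : N ℕ.* (12 ℕ.* (q ℕ.* q)) ℕ.+ c ℕ.* (42 ℕ.* (j ℕ.* q)) ℕ.< c ℕ.* (36 ℕ.* (j ℕ.* j) ℕ.+ 25 ℕ.* (q ℕ.* q))
      → ι N < ι c * (((+ 3 / 1) * (s * s) - (+ 7 / 2) * s) + (+ 25 / 12))
    upper h = ℚ.*-cancelʳ-<-nonNeg (ι (12 ℕ.* (q ℕ.* q))) ⦃ ℚ.pos⇒nonNeg (ι (12 ℕ.* (q ℕ.* q))) ⦃ pos-12 ⦄ ⦄ (subst₂ _<_
        (trans (cong (_- Y) (trans (ι-+ (N ℕ.* (12 ℕ.* (q ℕ.* q))) (c ℕ.* (42 ℕ.* (j ℕ.* q))))
            (cong (_+ Y) (ι-* N (12 ℕ.* (q ℕ.* q))))))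
          (solve 2 (λ x y → (x :+ y) :- y := x) refl (ι N * ι (12 ℕ.* (q ℕ.* q))) Y))
        (trans (cong₂ _-_ X≡ Y≡) (trans (solve 3 (λ c s q →
             c :* (con (ι 36) :* (s :* q :* (s :* q)) :+ con (ι 25) :* (q :* q)) :- c :* (con (ι 42) :* (s :* q :* q))
               := (c :* ((con (+ 3 / 1) :* (s :* s) :- con (+ 7 / 2) :* s) :+ con (+ 25 / 12))) :*
                   (con (ι 12) :* (q :* q))) refl (ι c) s Q)
           (cong (ι c * (((+ 3 / 1) * (s * s) - (+ 7 / 2) * s) + (+ 25 / 12)) *_)
               (sym (trans (ι-* 12 (q ℕ.* q)) (cong (ι 12 *_) square))))))
        (ℚ.+-monoˡ-< (- Y) (ι-< h)))
      where
      open +-*-Solver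
      Y = ι (c ℕ.* (42 ℕ.* (j ℕ.* q)))
      X≡ : ι (c ℕ.* (36 ℕ.* (j ℕ.* j) ℕ.+ 25 ℕ.* (q ℕ.* q))) ≡ ι c * (ι 36 * (s * Q * (s * Q)) + ι 25 * (Q * Q))
      X≡ = trans (ι-* c _) (cong (ι c *_) (trans (ι-+ (36 ℕ.* (j ℕ.* j)) (25 ℕ.* (q ℕ.* q))) (cong₂ _+_
             (trans (ι-* 36 (j ℕ.* j)) (cong (ι 36 *_) (trans (ι-* j j) (cong₂ _*_ (sym sQ) (sym sQ)))))
             (trans (ι-* 25 (q ℕ.* q)) (cong (ι 25 *_) square)))))
      Y≡ : Y ≡ ι c * (ι 42 * (s * Q * Q))
      Y≡ = trans (ι-* c (42 ℕ.* (j ℕ.* q))) (cong (ι c *_) (trans (ι-* 42 (j ℕ.* q))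
          (cong (ι 42 *_) (trans (ι-* j q) (cong (_* Q) (sym sQ))))))

open import Data.Nat using (ℕ; _+_; _*_; _^_; _∸_; _≤_; _<_; NonZero)
open import Data.Nat.Primality using (Prime)
open import Data.Integer using (+_)
open import Data.Rational using (ℚ; _/_) renaming (_+_ to _+ℚ_; _*_ to _*ℚ_; _-_ to _-ℚ_; _<_ to _<ℚ_; _≤_ to _≤ℚ_)
open import Data.Product using (Σ; _×_)
open import Relation.Binary.PropositionalEquality using (_≡_)

open Construction
open PointBound
open Counting
open FermatCurve
open Numerics
open RationalForm

-- Use of the condition on n, and conclusion

module Assembly (p : ℕ) .⦃ _ : NonZero p ⦄ (pp : Prime p) (a b : ℕ) (0<a : 0 < a) (a<p : a < p) (0<b : 0 < b) (b<p : b < p)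
    (n k : ℕ) (4≤n : 4 ≤ n) (kn : k * n ≡ p ∸ 1) (hyp : 2 * n ^ 3 + 3 * n ^ 2 + 8 * n + 4 * (p ∸ 1) ≤ n ^ 4) where

  1≤n : 1 ≤ n
  1≤n = ℕ.≤-trans (s≤s z≤n) 4≤n

  1+[p-1] : suc (p ∸ 1) ≡ p
  1+[p-1] = ℕ.m+[n∸m]≡n (ℕ.≤-trans 0<a (ℕ.<⇒≤ a<p))

  1≤k : 1 ≤ k
  1≤k = ℕ.n≢0⇒n>0 λ k≡0 → ℕ.<⇒≱ a<p (ℕ.≤-trans (ℕ.≤-reflexive
      (trans (sym 1+[p-1]) (cong suc (trans (sym kn) (cong (_* n) k≡0))))) 0<a)

  -- As p - 1 = kn, the hypothesis can be divided by n; the positive terms beside 4(p-1) make the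
  -- inequality strict.
  4k<n³ : 4 * k < n * n * n
  4k<n³ = ℕ.*-cancelʳ-< n _ _ (begin-strict
      4 * k * n ≡⟨ l₁ k n ⟩
      4 * (k * n) <⟨ ℕ.m<n+m (4 * (k * n)) (ℕ.≤-trans (ℕ.*-mono-≤ {1} {8} (s≤s z≤n) 1≤n)
          (ℕ.m≤n+m (8 * n) (2 * n ^ 3 + 3 * n ^ 2))) ⟩
      2 * n ^ 3 + 3 * n ^ 2 + 8 * n + 4 * (k * n) ≡⟨ cong (λ x → 2 * n ^ 3 + 3 * n ^ 2 + 8 * n + 4 * x) kn ⟩
      2 * n ^ 3 + 3 * n ^ 2 + 8 * n + 4 * (p ∸ 1) ≤⟨ hyp ⟩
      n ^ 4 ≡⟨ l₂ n ⟩
      n * n * n * n ∎)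
    where
    open ℕ.≤-Reasoning
    l₁ : ∀ k n → 4 * k * n ≡ 4 * (k * n)
    l₁ = ℕSolver.solve-∀
    l₂ : ∀ n → n * (n * (n * (n * 1))) ≡ n * n * n * n
    l₂ = ℕSolver.solve-∀

  module _ (m q j : ℕ) (q≢0 : NonZero q) (g : Good k m q j) where
    open Good g
    open Curve p pp a b 0<a a<p 0<b b<p n k 1≤n kn m
    open Bound p pp k m α β using (τ; cleared-count)

    0<q : 0 < q
    0<q = >-nonZero⁻¹ q ⦃ q≢0 ⦄

    open Rational (Npts n a b p) (n * n) k q j ⦃ q≢0 ⦄ 0<q

    m<n : m < n
    m<n = ℕ.≰⇒> λ n≤m → ℕ.<⇒≱ 4k<n³ (ℕ.≤-trans (ℕ.*-mono-≤ (ℕ.*-mono-≤ n≤m n≤m) n≤m) m³≤4k)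

    kn<p : k * n < p
    kn<p = ℕ.≤-reflexive (trans (cong suc kn) 1+[p-1])

    x≤2n : m + 3 ≤ 2 * n
    x≤2n = ℕ.≤-trans (ℕ.≤-reflexive (l₁ m)) (ℕ.≤-trans (ℕ.+-mono-≤ m<n (ℕ.≤-trans (s≤s (s≤s z≤n)) 4≤n)) (ℕ.≤-reflexive (l₂ n)))
      where
      l₁ : ∀ m → m + 3 ≡ suc m + 2
      l₁ = ℕSolver.solve-∀
      l₂ : ∀ n → n + n ≡ 2 * n
      l₂ = ℕSolver.solve-∀

    k<p : k < p
    k<p = ℕ.≤-<-trans (ℕ.≤-trans (ℕ.≤-reflexive (sym (ℕ.*-identityʳ k))) (ℕ.*-monoʳ-≤ k 1≤n)) kn<p

    small : k * m + m < p
    small = ℕ.≤-<-trans (ℕ.≤-trans (ℕ.+-monoʳ-≤ (k * m) m≤k) (ℕ.≤-trans (ℕ.≤-reflexive (lem k m)) (ℕ.*-monoʳ-≤ k m<n))) kn<p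
      where lem : ∀ k m → k * m + k ≡ k * suc m
            lem = ℕSolver.solve-∀

    order≤p : order m ≤ p
    order≤p = ℕ.*-cancelˡ-≤ 2 (ℕ.≤-trans (ℕ.≤-reflexive (order-closed m)) (ℕ.≤-trans (ℕ.*-mono-≤ m≤k x≤2n)
        (ℕ.≤-trans (ℕ.≤-reflexive (lem k n)) (ℕ.*-monoʳ-≤ 2 (ℕ.<⇒≤ kn<p)))))
      where lem : ∀ k n → k * (2 * n) ≡ 2 * (k * n)
            lem = ℕSolver.solve-∀

    conclusion : Σ ℚ (λ s → (+ 7 / 12) ≤ℚ s × (s *ℚ s *ℚ s) ≤ℚ (+ k / 2)
      × (+ Npts n a b p / 1) <ℚ ((+ (n * n) / 1) *ℚ (((+ 3 / 1) *ℚ (s *ℚ s) -ℚ (+ 7 / 2) *ℚ s) +ℚ (+ 25 / 12))))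
    conclusion = s , lower s≥7/12 , cube s³≤k/2 , upper
      (clear-denominators (Npts n a b p) n k m q j (length ws) τ 1≤n x≤2n 0<q points-bound
        (cleared-count 1≤k k<p 1≤m m≤k small order≤p ws ws-distinct ws-points) g)

mainTheorem1 : (p : ℕ) → .{{_ : NonZero p}} → Prime p → (a b : ℕ) → 0 < a → a < p → 0 < b → b < p
    → (n k : ℕ) → 4 ≤ n → k * n ≡ p ∸ 1
    → 2 * n ^ 3 + 3 * n ^ 2 + 8 * n + 4 * (p ∸ 1) ≤ n ^ 4
    → Σ ℚ (λ s → (+ 7 / 12) ≤ℚ s × (s *ℚ s *ℚ s) ≤ℚ (+ k / 2)
    × (+ Npts n a b p / 1) <ℚ ((+ (n * n) / 1) *ℚ (((+ 3 / 1) *ℚ (s *ℚ s) -ℚ (+ 7 / 2) *ℚ s) +ℚ (+ 25 / 12))))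
mainTheorem1 p pp a b 0<a a<p 0<b b<p n k 4≤n kn hyp =
  let open Assembly p pp a b 0<a a<p 0<b b<p n k 4≤n kn hyp
      (m , q , j , q≢0 , g) = good-choice k 1≤k
  in conclusion m q j q≢0 g
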